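{- Let $\mathbb{K}$ be any infinite field. There is no sentence $\psi_{\mathbb{K}}$ of the language $\mathit{MS}_0$ such that, for every (finite) matroid $M$, $M$ is $\mathbb{K}$-representable if and only if $M$ satisfies $\psi_{\mathbb{K}}$.
   Context: All matroids are finite. $\mathit{MS}_0$ is the following monadic second-order language for matroids. It has variables $X_1,X_2,X_3,\ldots$, atomic formulas $X_i\subseteq X_j$, $\mathrm{Sing}(X_i)$, $\mathrm{Ind}(X_i)$, the connectives $\neg,\land$ and the quantifiers $\exists,\forall$. Formulas $\psi$, with their variable sets $\mathrm{Var}(\psi)$ and free-variable sets $\mathrm{Fr}(\psi)$, are built recursively: an atomic formula has $\mathrm{Fr}=\mathrm{Var}=$ the set of variables occurring in it; $\neg\psi$ has the same $\mathrm{Var}$ and $\mathrm{Fr}$ as $\psi$; $\psi_1\land\psi_2$ is a formula provided $\mathrm{Fr}(\psi_i)\cap(\mathrm{Var}(\psi_j)-\mathrm{Fr}(\psi_j))=\emptyset$ for $\{i,j\}=\{1,2\}$, with $\mathrm{Var}$ and $\mathrm{Fr}$ the respective unions; if $X_i\in\mathrm{Fr}(\psi)$ then $\exists X_i\,\psi$ and $\forall X_i\,\psi$ are formulas with variable set $\mathrm{Var}(\psi)$ and free-variable set $\mathrm{Fr}(\psi)-\{X_i\}$. A sentence is a formula with no free variables. A matroid $M$ satisfies a sentence if the sentence is true when variables range over subsets of the ground set $E(M)$, $X_i\subseteq X_j$ means set containment, $\mathrm{Sing}(X_i)$ means $|X_i|=1$, and $\mathrm{Ind}(X_i)$ means $X_i$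 is independent in $M$. -}

module Defs where

open import Level using (Level; _⊔_) renaming (suc to lsuc)
open import Data.Nat using (ℕ; zero; suc)
open import Data.Bool using (Bool; true; false; if_then_else_)
open import Data.Fin using (Fin)
open import Data.Fin.Subset using (Subset; _⊆_; _∈_; ⊥; _∪_; ∣_∣)
open import Data.Vec using (lookup)
open import Data.Product using (Σ; _×_; ∃; ∃-syntax; _,_)
open import Relation.Binary.PropositionalEquality using (_≡_)
open import Relation.Nullary using (¬_)
open import Algebra.Bundles using (CommutativeRing)
open import Function.Definitions using (Injective)
import Data.Empty as E

record Field (c ℓ : Level) : Set (lsuc (c ⊔ ℓ)) where
  field
    commutativeRing : CommutativeRing c ℓ
  open CommutativeRing commutativeRing public
  field
    0≉1     : ¬ (0# ≈ 1#)
    inverse : ∀ x → ¬ (x ≈ 0#) → ∃[ y ] (x * y ≈ 1#)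

Infinite : ∀ {c ℓ} → Field c ℓ → Set (c ⊔ ℓ)
Infinite K = Σ (ℕ → Carrier) (λ f → Injective _≡_ _≈_ f)
  where open Field K

-- Finite matroids, given by independent sets, on ground set Fin n.
-- (Every finite matroid is isomorphic to one on some Fin n.)

record Matroid (n : ℕ) : Set where
  field
    Ind         : Subset n → Bool
    ind-empty   : Ind ⊥ ≡ true
    ind-subset  : ∀ {X Y} → X ⊆ Y → Ind Y ≡ true → Ind X ≡ true
    ind-augment : ∀ {X Y} → Ind X ≡ true → Ind Y ≡ true →
                  Data.Nat._<_ ∣ X ∣ ∣ Y ∣ →
                  ∃[ e ] (e ∈ Y × ¬ (e ∈ X) × Ind (X ∪ Data.Fin.Subset.⁅ e ⁆) ≡ true)

module _ {c ℓ} (K : Field c ℓ) where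
  open Field K

  sumFin : ∀ {m} → (Fin m → Carrier) → Carrier
  sumFin {zero}  f = 0#
  sumFin {suc m} f = f Fin.zero + sumFin (λ i → f (Fin.suc i))
    where import Data.Fin as Fin

  LinIndep : ∀ {n r} → (Fin n → Fin r → Carrier) → Subset n → Set (c ⊔ ℓ)
  LinIndep {n} {r} v X =
    (a : Fin n → Carrier) →
    (∀ (j : Fin r) → sumFin (λ i → if lookup X i then a i * v i j else 0#) ≈ 0#) →
    ∀ i → i ∈ X → a i ≈ 0#

  Representable : ∀ {n} → Matroid n → Set (c ⊔ ℓ)
  Representable {n} M =
    ∃[ r ] Σ (Fin n → Fin r → Carrier) λ v →
      ∀ (X : Subset n) → (Matroid.Ind M X ≡ true → LinIndep v X)
                       × (LinIndep v X → Matroid.Ind M X ≡ true)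

data Formula : Set where
  _⊆ᶠ_ : ℕ → ℕ → Formula
  Sing : ℕ → Formula
  Indᶠ : ℕ → Formula
  ¬ᶠ_  : Formula → Formula
  _∧ᶠ_ : Formula → Formula → Formula
  ∃ᶠ   : ℕ → Formula → Formula
  ∀ᶠ   : ℕ → Formula → Formula

data InVar : ℕ → Formula → Set where
  ⊆-l  : ∀ {i j} → InVar i (i ⊆ᶠ j)
  ⊆-r  : ∀ {i j} → InVar j (i ⊆ᶠ j)
  sing : ∀ {i} → InVar i (Sing i)
  ind  : ∀ {i} → InVar i (Indᶠ i)
  neg  : ∀ {x ψ} → InVar x ψ → InVar x (¬ᶠ ψ)
  ∧-l  : ∀ {x ψ φ} → InVar x ψ → InVar x (ψ ∧ᶠ φ)
  ∧-r  : ∀ {x ψ φ} → InVar x φ → InVar x (ψ ∧ᶠ φ)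
  ex   : ∀ {x i ψ} → InVar x ψ → InVar x (∃ᶠ i ψ)
  all  : ∀ {x i ψ} → InVar x ψ → InVar x (∀ᶠ i ψ)

data InFr : ℕ → Formula → Set where
  ⊆-l  : ∀ {i j} → InFr i (i ⊆ᶠ j)
  ⊆-r  : ∀ {i j} → InFr j (i ⊆ᶠ j)
  sing : ∀ {i} → InFr i (Sing i)
  ind  : ∀ {i} → InFr i (Indᶠ i)
  neg  : ∀ {x ψ} → InFr x ψ → InFr x (¬ᶠ ψ)
  ∧-l  : ∀ {x ψ φ} → InFr x ψ → InFr x (ψ ∧ᶠ φ)
  ∧-r  : ∀ {x ψ φ} → InFr x φ → InFr x (ψ ∧ᶠ φ)
  ex   : ∀ {x i ψ} → ¬ (x ≡ i) → InFr x ψ → InFr x (∃ᶠ i ψ)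
  all  : ∀ {x i ψ} → ¬ (x ≡ i) → InFr x ψ → InFr x (∀ᶠ i ψ)

data WF : Formula → Set where
  wf-⊆    : ∀ {i j} → WF (i ⊆ᶠ j)
  wf-sing : ∀ {i} → WF (Sing i)
  wf-ind  : ∀ {i} → WF (Indᶠ i)
  wf-¬    : ∀ {ψ} → WF ψ → WF (¬ᶠ ψ)
  -- Fr(ψᵢ) ∩ (Var(ψⱼ) − Fr(ψⱼ)) = ∅ for {i,j} = {1,2}
  wf-∧    : ∀ {ψ φ} → WF ψ → WF φ →
            (∀ x → InFr x ψ → InVar x φ → InFr x φ) →
            (∀ x → InFr x φ → InVar x ψ → InFr x ψ) →
            WF (ψ ∧ᶠ φ)
  wf-∃    : ∀ {i ψ} → WF ψ → InFr i ψ → WF (∃ᶠ i ψ)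
  wf-∀    : ∀ {i ψ} → WF ψ → InFr i ψ → WF (∀ᶠ i ψ)

Sentence : Formula → Set
Sentence ψ = WF ψ × (∀ x → ¬ InFr x ψ)

Assignment : ℕ → Set
Assignment n = ℕ → Subset n

update : ∀ {n} → Assignment n → ℕ → Subset n → Assignment n
update σ i S k with Data.Nat._≟_ k i
... | Relation.Nullary.yes _ = S
... | Relation.Nullary.no  _ = σ k

Sat : ∀ {n} → Matroid n → Assignment n → Formula → Set
Sat M σ (i ⊆ᶠ j) = σ i ⊆ σ j
Sat M σ (Sing i) = ∣ σ i ∣ ≡ 1
Sat M σ (Indᶠ i) = Matroid.Ind M (σ i) ≡ true
Sat M σ (¬ᶠ ψ)   = ¬ Sat M σ ψ
Sat M σ (ψ ∧ᶠ φ) = Sat M σ ψ × Sat M σ φ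
Sat M σ (∃ᶠ i ψ) = Σ (Subset _) λ S → Sat M (update σ i S) ψ
Sat M σ (∀ᶠ i ψ) = (S : Subset _) → Sat M (update σ i S) ψ

-- M satisfies a sentence (the assignment is irrelevant for sentences;
-- we use the one sending every variable to ∅).
Satisfies : ∀ {n} → Matroid n → Formula → Set
Satisfies M ψ = Sat M (λ _ → ⊥) ψ

module Submission where

-- Take two chains of points on two lines of a projective plane, and three points c₀, c₁, c₂ on a third line, such that
-- projecting the first line to the second from c₁ and back from c₀ leads from each point of a chain to the next one, while
-- projecting from c₂ and back from c₀ leads from its first point to its last. In suitable coordinates the first map is
-- λ ↦ τ + κλ and the second is an affine combination of it and the identity, so either chain determines the second map as
-- a power of the first. Hence the matroid with chains of lengths m < n is not representable, while for m = n
-- it is represented by the points (1, tαⁱ, 0), (αʲ, 0, tαᵐ) and (0, 1, −αᵉ) for e = 0, 1, m, where α has large multiplicative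
-- order and t is 1 on one chain and a large power of α on the other.
-- As the chains share only three points, the truth of a given formula depends on the first chain through one of finitely
-- many colours, so it cannot separate all lengths.

-- The two chains turn representability into a comparison of two unbounded lengths, which is exactly
-- what finitely many colours cannot make. The matroids are therefore defined combinatorially, from
-- a collinearity relation, so that `glued m n` exists for every pair of lengths whether or not
-- vectors for it can be found. An infinite field may be algebraic over a finite one, and then every
-- nonzero element has finite order. Hence no single α serves all lengths and one is chosen anew for
-- each of them. Equality in the field is not assumed decidable. Pivots, a suitable α and the
-- coordinates of points are found only under a double negation. This is harmless because the
-- theorem is itself a negation. The nonrepresentability argument, which derives many equations from
-- such data, is carried out over the same carrier with equality replaced by its double negation,
-- where equations are stable.

open import Defs
open import Data.Nat using (ℕ)
open import Data.Product using (Σ; _×_)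
open import Relation.Nullary using (¬_)
open import Function.Bundles using (_⇔_)

-- Solving ring equations with integer coefficients.

module IntegerRingSolver where

  open import Data.Nat as ℕ using (ℕ; zero; suc)
  import Data.Nat.Properties as ℕₚ
  open import Data.Integer as ℤ using (ℤ; +_; -[1+_])
  import Data.Integer.Properties as ℤₚ
  open import Data.Maybe using (Maybe; just; nothing)
  open import Relation.Nullary using (yes; no)
  open import Relation.Binary.PropositionalEquality as ≡ using (_≡_)
  open import Algebra.Bundles using (CommutativeRing)
  open import Algebra.Solver.Ring.AlmostCommutativeRing

  module IntegerCoefficients {c ℓ} (R : CommutativeRing c ℓ) where
    open CommutativeRing R
    open import Algebra.Properties.Ring ring
    open import Algebra.Properties.Semiring.Mult.TCOptimised semiring renaming (_×_ to _·_)
    open import Relation.Binary.Reasoning.Setoid setoid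
    open import Algebra.Properties.AbelianGroup +-abelianGroup using (⁻¹-∙-comm)

    -- With the optimised multiples `1 · 1#` computes to `1#`, so in equations given to the solver
    -- `con (pos 0)` and `con (pos 1)` evaluate to `0#` and `1#` themselves. Integers serve as
    -- coefficients because their equality is decidable, which is not assumed of the ring.
    fromℤ : ℤ → Carrier
    fromℤ (+ n)    = n · 1#
    fromℤ -[1+ n ] = - (suc n · 1#)

    suc-× : ∀ n → suc n · 1# ≈ 1# + n · 1#
    suc-× n = ×-homo-+ 1# 1 n

    fromℤ-⊖ : ∀ m n → fromℤ (m ℤ.⊖ n) ≈ m · 1# + - (n · 1#)
    fromℤ-⊖ zero    zero    = sym (-‿inverseʳ 0#)
    fromℤ-⊖ zero    (suc n) = sym (+-identityˡ _)
    fromℤ-⊖ (suc m) zero    = sym (trans (+-congˡ -0#≈0#) (+-identityʳ _))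
    fromℤ-⊖ (suc m) (suc n) = begin
      fromℤ (suc m ℤ.⊖ suc n)               ≡⟨ ≡.cong fromℤ (ℤₚ.[1+m]⊖[1+n]≡m⊖n m n) ⟩
      fromℤ (m ℤ.⊖ n)                       ≈⟨ fromℤ-⊖ m n ⟩
      m · 1# + - (n · 1#)                   ≈⟨ +-congʳ (sym (+-identityˡ _)) ⟩
      0# + m · 1# + - (n · 1#)              ≈⟨ +-congʳ (+-congʳ (sym (-‿inverseʳ 1#))) ⟩
      1# + - 1# + m · 1# + - (n · 1#)       ≈⟨ +-congʳ (trans (+-assoc _ _ _) (trans (+-congˡ (+-comm _ _)) (sym (+-assoc _ _ _)))) ⟩
      1# + m · 1# + - 1# + - (n · 1#)       ≈⟨ +-assoc _ _ _ ⟩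
      1# + m · 1# + (- 1# + - (n · 1#))     ≈⟨ +-cong (sym (suc-× m)) (trans (⁻¹-∙-comm _ _) (-‿cong (sym (suc-× n)))) ⟩
      suc m · 1# + - (suc n · 1#)           ∎

    fromℤ-neg : ∀ i → fromℤ (ℤ.- i) ≈ - fromℤ i
    fromℤ-neg (+ zero)  = sym -0#≈0#
    fromℤ-neg (+ suc n) = refl
    fromℤ-neg -[1+ n ]  = sym (-‿involutive _)

    fromℤ-+ : ∀ i j → fromℤ (i ℤ.+ j) ≈ fromℤ i + fromℤ j
    fromℤ-+ (+ m)    (+ n)    = ×-homo-+ 1# m n
    fromℤ-+ (+ m)    -[1+ n ] = fromℤ-⊖ m (suc n)
    fromℤ-+ -[1+ m ] (+ n)    = trans (fromℤ-⊖ n (suc m)) (+-comm _ _)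
    fromℤ-+ -[1+ m ] -[1+ n ] = begin
      - (suc (suc (m ℕ.+ n)) · 1#)           ≡⟨ ≡.cong (λ k → - (suc k · 1#)) (≡.sym (ℕₚ.+-suc m n)) ⟩
      - ((suc m ℕ.+ suc n) · 1#)             ≈⟨ -‿cong (×-homo-+ 1# (suc m) (suc n)) ⟩
      - (suc m · 1# + suc n · 1#)            ≈⟨ sym (⁻¹-∙-comm _ _) ⟩
      - (suc m · 1#) + - (suc n · 1#)        ∎

    fromℤ-* : ∀ i j → fromℤ (i ℤ.* j) ≈ fromℤ i * fromℤ j
    fromℤ-* (+ m) (+ n) = begin
      fromℤ (+ m ℤ.* + n)   ≡⟨ ≡.cong fromℤ (≡.sym (ℤₚ.pos-* m n)) ⟩
      (m ℕ.* n) · 1#        ≈⟨ ×1-homo-* m n ⟩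
      m · 1# * (n · 1#)     ∎
    fromℤ-* (+ m) -[1+ n ] = begin
      fromℤ (+ m ℤ.* -[1+ n ])      ≡⟨ ≡.cong fromℤ (≡.sym (ℤₚ.neg-distribʳ-* (+ m) (+ suc n))) ⟩
      fromℤ (ℤ.- (+ m ℤ.* + suc n)) ≈⟨ fromℤ-neg (+ m ℤ.* + suc n) ⟩
      - fromℤ (+ m ℤ.* + suc n)     ≈⟨ -‿cong (fromℤ-* (+ m) (+ suc n)) ⟩
      - (m · 1# * (suc n · 1#))     ≈⟨ -‿distribʳ-* _ _ ⟩
      m · 1# * - (suc n · 1#)       ∎
    fromℤ-* -[1+ m ] (+ n) = begin
      fromℤ (-[1+ m ] ℤ.* + n)      ≡⟨ ≡.cong fromℤ (≡.sym (ℤₚ.neg-distribˡ-* (+ suc m) (+ n))) ⟩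
      fromℤ (ℤ.- (+ suc m ℤ.* + n)) ≈⟨ fromℤ-neg (+ suc m ℤ.* + n) ⟩
      - fromℤ (+ suc m ℤ.* + n)     ≈⟨ -‿cong (fromℤ-* (+ suc m) (+ n)) ⟩
      - (suc m · 1# * (n · 1#))     ≈⟨ -‿distribˡ-* _ _ ⟩
      - (suc m · 1#) * (n · 1#)     ∎
    fromℤ-* -[1+ m ] -[1+ n ] = begin
      fromℤ (+ suc m ℤ.* + suc n)            ≈⟨ fromℤ-* (+ suc m) (+ suc n) ⟩
      suc m · 1# * (suc n · 1#)              ≈⟨ sym (-‿involutive _) ⟩
      - - (suc m · 1# * (suc n · 1#))        ≈⟨ -‿cong (-‿distribˡ-* _ _) ⟩
      - (- (suc m · 1#) * (suc n · 1#))      ≈⟨ -‿distribʳ-* _ _ ⟩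
      - (suc m · 1#) * - (suc n · 1#)        ∎

    _≟ᶻ_ : ∀ i j → Maybe (fromℤ i ≈ fromℤ j)
    i ≟ᶻ j with i ℤ.≟ j
    ... | yes ≡.refl = just refl
    ... | no _       = nothing

    homomorphism : ℤ.+-*-rawRing -Raw-AlmostCommutative⟶ fromCommutativeRing R
    homomorphism = record
      { ⟦_⟧ = fromℤ ; +-homo = fromℤ-+ ; *-homo = fromℤ-* ; -‿homo = fromℤ-neg
      ; 0-homo = refl ; 1-homo = refl }

    open import Algebra.Solver.Ring ℤ.+-*-rawRing (fromCommutativeRing R) homomorphism _≟ᶻ_
      public using (solve; _:=_; _:+_; _:*_; _:-_; :-_; con; Polynomial)

open IntegerRingSolver

-- Linear dependence of lists of vectors and Gaussian elimination.

module LinearDependence where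

  open import Level using (_⊔_)
  open import Data.Nat using (zero; suc)
  open import Data.Bool using (true; false; if_then_else_)
  open import Data.Fin using (Fin; zero; suc)
  open import Data.Fin.Subset using (Subset; _∈_)
  open import Data.Vec using (Vec; []; _∷_; lookup; here; there)
  open import Data.Integer using () renaming (+_ to pos)
  open import Data.List using (List; []; _∷_)
  open import Data.List.Relation.Unary.All using (All; []; _∷_)
  open import Data.List.Relation.Binary.Permutation.Propositional using (_↭_; refl; prep; swap; trans; ↭-sym)
  open import Data.Product using (Σ; _×_; ∃₂; _,_; proj₂)
  open import Data.Sum using (_⊎_; inj₁; inj₂)
  open import Data.Unit.Polymorphic using (⊤; tt)
  open import Function using (_∘_)
  open import Relation.Nullary using (yes; no; ¬_)
  open import Relation.Nullary.Decidable using (¬¬-excluded-middle)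
  open import Relation.Binary.PropositionalEquality as ≡ using (_≡_)

  infixl 1 _>>=_
  _>>=_ : ∀ {a b} {A : Set a} {B : Set b} → ¬ ¬ A → (A → ¬ ¬ B) → ¬ ¬ B
  (m >>= f) k = m (λ a → f a k)

  return : ∀ {a} {A : Set a} → A → ¬ ¬ A
  return a k = k a

  ¬¬-∀Fin : ∀ {p} n {P : Fin n → Set p} → (∀ i → ¬ ¬ P i) → ¬ ¬ (∀ i → P i)
  ¬¬-∀Fin zero    f = return λ ()
  ¬¬-∀Fin (suc n) f = do
    p₀ ← f zero
    ps ← ¬¬-∀Fin n (f ∘ suc)
    return λ { zero → p₀ ; (suc i) → ps i }

  -- Independence is studied on lists instead of subsets, because lists can be reordered during
  -- elimination and matched point by point. `select` is the bridge between the two.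
  select : ∀ {a} {A : Set a} {n} → Vec A n → Subset n → List A
  select []       []          = []
  select (p ∷ ps) (true  ∷ X) = p ∷ select ps X
  select (p ∷ ps) (false ∷ X) = select ps X

  module LinearAlgebra {c ℓ} (K : Field c ℓ) where
    open Field K hiding (zero; refl; sym; trans; _-_)
    private module K = Field K
    open IntegerCoefficients commutativeRing
    open import Relation.Binary.Reasoning.Setoid setoid

    *-cancel-0 : ∀ {x y} → ¬ x ≈ 0# → x * y ≈ 0# → y ≈ 0#
    *-cancel-0 {x} {y} x≉0 xy≈0 with inverse x x≉0
    ... | x⁻¹ , xx⁻¹≈1 = begin
      y              ≈⟨ K.sym (*-identityˡ y) ⟩
      1# * y         ≈⟨ *-congʳ (K.sym xx⁻¹≈1) ⟩
      x * x⁻¹ * y    ≈⟨ solve 3 (λ x x⁻¹ y → x :* x⁻¹ :* y := x⁻¹ :* (x :* y)) K.refl x x⁻¹ y ⟩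
      x⁻¹ * (x * y)  ≈⟨ *-congˡ xy≈0 ⟩
      x⁻¹ * 0#       ≈⟨ zeroʳ x⁻¹ ⟩
      0#             ∎

    *-≉0 : ∀ {x y} → ¬ x ≈ 0# → ¬ y ≈ 0# → ¬ x * y ≈ 0#
    *-≉0 x≉0 y≉0 xy≈0 = y≉0 (*-cancel-0 x≉0 xy≈0)

    difference-0 : ∀ {x y} → x + - y ≈ 0# → x ≈ y
    difference-0 {x} {y} x-y≈0 = begin
      x              ≈⟨ solve 2 (λ x y → x := x :+ :- y :+ y) K.refl x y ⟩
      x + - y + y    ≈⟨ +-congʳ x-y≈0 ⟩
      0# + y         ≈⟨ +-identityˡ y ⟩
      y              ∎

    module _ {a} {A : Set a} where

      Coefficients : List A → Set (a ⊔ c)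
      Coefficients = All (λ _ → Carrier)

      combination : ∀ {r} (V : A → Fin r → Carrier) {l} → Coefficients l → Fin r → Carrier
      combination V []                  j = 0#
      combination V (_∷_ {x = x} α αs) j = α * V x j + combination V αs j

      Trivial : ∀ {l} → Coefficients l → Set ℓ
      Trivial []       = ⊤
      Trivial (α ∷ αs) = α ≈ 0# × Trivial αs

      Vanishing : ∀ {r} (V : A → Fin r → Carrier) {l} → Coefficients l → Set ℓ
      Vanishing V αs = ∀ j → combination V αs j ≈ 0#

      -- `Dependent` only denies that all coefficients vanish: without decidable equality no
      -- particular nonzero coefficient need be at hand.
      Independent Dependent : ∀ {r} → (A → Fin r → Carrier) → List A → Set (a ⊔ c ⊔ ℓ)
      Independent V l = (αs : Coefficients l) → Vanishing V αs → Trivial αs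
      Dependent   V l = Σ (Coefficients l) λ αs → Vanishing V αs × ¬ Trivial αs

      zeros : ∀ l → Coefficients l
      zeros []      = []
      zeros (x ∷ l) = 0# ∷ zeros l

      combination-zeros : ∀ {r} (V : A → Fin r → Carrier) l j → combination V (zeros l) j ≈ 0#
      combination-zeros V []      j = K.refl
      combination-zeros V (x ∷ l) j = begin
        0# * V x j + combination V (zeros l) j  ≈⟨ +-cong (zeroˡ _) (combination-zeros V l j) ⟩
        0# + 0#                                 ≈⟨ +-identityˡ 0# ⟩
        0#                                      ∎

      -- Triviality is transported backwards only. As permutations can be inverted, this serves
      -- independence and dependence alike.
      permute : ∀ {r} (V : A → Fin r → Carrier) {l l′} → l ↭ l′ → (αs : Coefficients l) →
        Σ (Coefficients l′) λ βs →
          (∀ j → combination V βs j ≈ combination V αs j) × (Trivial βs → Trivial αs)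
      permute V refl αs = αs , (λ j → K.refl) , λ t → t
      permute V (prep x p) (α ∷ αs) with permute V p αs
      ... | βs , eq , triv = α ∷ βs , (λ j → +-congˡ (eq j)) , λ (z , t) → z , triv t
      permute V (swap x y p) (α ∷ α′ ∷ αs) with permute V p αs
      ... | βs , eq , triv =
        α′ ∷ α ∷ βs
        , (λ j → K.trans (+-congˡ (+-congˡ (eq j)))
                   (solve 3 (λ u v w → u :+ (v :+ w) := v :+ (u :+ w)) K.refl _ _ _))
        , λ (z , z′ , t) → z′ , z , triv t
      permute V (trans p q) αs with permute V p αs
      ... | βs , eq , triv with permute V q βs
      ... | γs , eq′ , triv′ = γs , (λ j → K.trans (eq′ j) (eq j)) , triv ∘ triv′

      independent-↭ : ∀ {r} {V : A → Fin r → Carrier} {l l′} → l ↭ l′ → Independent V l′ → Independent V l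
      independent-↭ {V = V} p indep αs van with permute V p αs
      ... | βs , eq , triv = triv (indep βs λ j → K.trans (eq j) (van j))

      dependent-↭ : ∀ {r} {V : A → Fin r → Carrier} {l l′} → l ↭ l′ → Dependent V l′ → Dependent V l
      dependent-↭ {V = V} p (αs , van , nontriv) with permute V (↭-sym p) αs
      ... | βs , eq , triv = βs , (λ j → K.trans (eq j) (van j)) , nontriv ∘ triv

      independent-tail : ∀ {r} {V : A → Fin r → Carrier} {x l} → Independent V (x ∷ l) → Independent V l
      independent-tail indep αs van =
        proj₂ (indep (0# ∷ αs) λ j → K.trans (+-cong (zeroˡ _) (van j)) (+-identityˡ 0#))

      pivot : ∀ {r} (V : A → Fin (suc r) → Carrier) l →
        ¬ ¬ (All (λ x → V x zero ≈ 0#) l ⊎ ∃₂ λ x l′ → l ↭ x ∷ l′ × ¬ V x zero ≈ 0#)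
      pivot V [] = return (inj₁ [])
      pivot V (x ∷ l) = do
        no x≉0 ← ¬¬-excluded-middle {A = V x zero ≈ 0#}
          where yes x≈0 → do
                  inj₂ (y , l′ , p , y≉0) ← pivot V l
                    where inj₁ l≈0 → return (inj₁ (x≈0 ∷ l≈0))
                  return (inj₂ (y , x ∷ l′ , trans (prep x p) (swap x y refl) , y≉0))
        return (inj₂ (x , l , refl , x≉0))

      module Elimination {r} (V : A → Fin (suc r) → Carrier) where

        combination-head : ∀ {l} → All (λ x → V x zero ≈ 0#) l → (αs : Coefficients l) →
          combination V αs zero ≈ 0#
        combination-head []       []       = K.refl
        combination-head (z ∷ zs) (α ∷ αs) =
          K.trans (+-cong (K.trans (*-congˡ z) (zeroʳ α)) (combination-head zs αs)) (+-identityˡ 0#)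

        tails : A → Fin r → Carrier
        tails x j = V x (suc j)

        combination-tails : ∀ {l} (αs : Coefficients l) j → combination tails αs j ≡ combination V αs (suc j)
        combination-tails []       j = ≡.refl
        combination-tails (α ∷ αs) j = ≡.cong (_ +_) (combination-tails αs j)

        module _ (u : A) (d : Carrier) where

          -- If `d` is inverse to `V u zero`, this subtracts from `x` the multiple of the pivot `u`
          -- that clears coordinate `zero`, and then drops that coordinate.
          reduced : A → Fin r → Carrier
          reduced x j = V x (suc j) + - (V x zero * d * V u (suc j))

          combination-reduced : ∀ {l} (αs : Coefficients l) j →
            combination reduced αs j ≈
            combination V αs (suc j) + - (combination V αs zero * d * V u (suc j))
          combination-reduced [] j =
            solve 2 (λ d u → con (pos 0) := con (pos 0) :+ :- (con (pos 0) :* d :* u)) K.refl d (V u (suc j))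
          combination-reduced (_∷_ {x = x} α αs) j = K.trans (+-congˡ (combination-reduced αs j))
            (solve 7 (λ α x′ x d u s t →
              α :* (x′ :+ :- (x :* d :* u)) :+ (s :+ :- (t :* d :* u)) :=
              α :* x′ :+ s :+ :- ((α :* x :+ t) :* d :* u)) K.refl
              α (V x (suc j)) (V x zero) d (V u (suc j)) (combination V αs (suc j)) (combination V αs zero))

          module _ (inv : V u zero * d ≈ 1#) where

            u≉0 : ¬ V u zero ≈ 0#
            u≉0 u≈0 = 0≉1 (K.trans (K.sym (K.trans (*-congʳ u≈0) (zeroˡ d))) inv)

            independent-reduced : ∀ {l} → Independent reduced l → Independent V (u ∷ l)
            independent-reduced indep (α ∷ αs) van = α≈0 , αs≈0
              where
              αs≈0 : Trivial αs
              αs≈0 = indep αs λ j → begin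
                combination reduced αs j
                  ≈⟨ combination-reduced αs j ⟩
                combination V αs (suc j) + - (combination V αs zero * d * V u (suc j))
                  -- Coordinate `suc j` of the given relation, minus `d * V u (suc j)` times its
                  -- coordinate `zero`, plus a correction with the factor `V u zero * d + - 1#`; all
                  -- three parts vanish.
                  ≈⟨ solve 6 (λ s t d u α u₀ →
                       s :+ :- (t :* d :* u) :=
                       (α :* u :+ s) :+ :- ((α :* u₀ :+ t) :* d :* u) :+ α :* u :* (u₀ :* d :+ :- con (pos 1)))
                       K.refl (combination V αs (suc j)) (combination V αs zero) d (V u (suc j)) α (V u zero) ⟩
                (α * V u (suc j) + combination V αs (suc j))
                  + - ((α * V u zero + combination V αs zero) * d * V u (suc j))
                  + α * V u (suc j) * (V u zero * d + - 1#)
                  ≈⟨ +-cong (+-cong (van (suc j)) (-‿cong (*-congʳ (*-congʳ (van zero))))) (*-congˡ (+-congʳ inv)) ⟩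
                0# + - (0# * d * V u (suc j)) + α * V u (suc j) * (1# + - 1#)
                  ≈⟨ solve 3 (λ d u α →
                       con (pos 0) :+ :- (con (pos 0) :* d :* u) :+ α :* u :* (con (pos 1) :+ :- con (pos 1)) := con (pos 0))
                       K.refl d (V u (suc j)) α ⟩
                0# ∎
              vanish-at : ∀ {l} (αs : Coefficients l) → Trivial αs → ∀ j → combination V αs j ≈ 0#
              vanish-at []       _       j = K.refl
              vanish-at (α ∷ αs) (z , t) j =
                K.trans (+-cong (K.trans (*-congʳ z) (zeroˡ _)) (vanish-at αs t j)) (+-identityˡ 0#)
              α≈0 : α ≈ 0#
              α≈0 = *-cancel-0 u≉0 (begin
                V u zero * α                               ≈⟨ *-comm _ _ ⟩
                α * V u zero                               ≈⟨ K.sym (+-identityʳ _) ⟩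
                α * V u zero + 0#                          ≈⟨ +-congˡ (K.sym (vanish-at αs αs≈0 zero)) ⟩
                α * V u zero + combination V αs zero       ≈⟨ van zero ⟩
                0#                                         ∎)

            dependent-reduced : ∀ {l} → Dependent reduced l → Dependent V (u ∷ l)
            dependent-reduced {l} (αs , van , nontriv) =
              -- The coefficient of `u` is the one that makes coordinate `zero` of the combination
              -- vanish.
              - (combination V αs zero * d) ∷ αs , van′ , nontriv ∘ proj₂
              where
              van′ : Vanishing V {u ∷ l} (- (combination V αs zero * d) ∷ αs)
              van′ zero = begin
                - (combination V αs zero * d) * V u zero + combination V αs zero
                  ≈⟨ solve 3 (λ t d u → :- (t :* d) :* u :+ t := t :* (con (pos 1) :+ :- (u :* d)))
                       K.refl (combination V αs zero) d (V u zero) ⟩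
                combination V αs zero * (1# + - (V u zero * d))
                  ≈⟨ *-congˡ (K.trans (+-congˡ (-‿cong inv)) (-‿inverseʳ 1#)) ⟩
                combination V αs zero * 0#
                  ≈⟨ zeroʳ _ ⟩
                0# ∎
              van′ (suc j) = begin
                - (combination V αs zero * d) * V u (suc j) + combination V αs (suc j)
                  ≈⟨ solve 4 (λ t d u s → :- (t :* d) :* u :+ s := s :+ :- (t :* d :* u))
                       K.refl (combination V αs zero) d (V u (suc j)) (combination V αs (suc j)) ⟩
                combination V αs (suc j) + - (combination V αs zero * d * V u (suc j))
                  ≈⟨ K.sym (combination-reduced αs j) ⟩
                combination reduced αs j
                  ≈⟨ van j ⟩
                0# ∎

      -- Equality in K need not be decidable, so the pivots can only be found under a double negation.
      dichotomy : ∀ {r} (V : A → Fin r → Carrier) l → ¬ ¬ (Independent V l ⊎ Dependent V l)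
      dichotomy {zero}  V []      = return (inj₁ λ { [] _ → tt })
      dichotomy {zero}  V (x ∷ l) = return (inj₂ (1# ∷ zeros l , (λ ()) , λ (z , _) → 0≉1 (K.sym z)))
      dichotomy {suc r} V l = do
        inj₂ (u , l′ , p , u≉0) ← pivot V l
          where inj₁ zs → do
                  inj₁ indep ← dichotomy tails l
                    where inj₂ (αs , van , nontriv) → return (inj₂ (αs
                            , (λ { zero → combination-head zs αs
                                 ; (suc j) → K.trans (K.reflexive (≡.sym (combination-tails αs j))) (van j) })
                            , nontriv))
                  return (inj₁ λ αs van → indep αs λ j → K.trans (K.reflexive (combination-tails αs j)) (van (suc j)))
        let d , inv = inverse (V u zero) u≉0
        inj₁ indep ← dichotomy (reduced u d) l′
          where inj₂ dep → return (inj₂ (dependent-↭ p (dependent-reduced u d inv dep)))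
        return (inj₁ (independent-↭ p (independent-reduced u d inv indep)))
        where open Elimination V

      module _ {r} (V : A → Fin r → Carrier) where

        term : ∀ {n} (v : Fin n → Fin r → Carrier) → Subset n → (Fin n → Carrier) → Fin r → Fin n → Carrier
        term v X α j i = if lookup X i then α i * v i j else 0#

        coefficients : ∀ {n} (ps : Vec A n) X → (Fin n → Carrier) → Coefficients (select ps X)
        coefficients []       []          α = []
        coefficients (p ∷ ps) (true  ∷ X) α = α zero ∷ coefficients ps X (α ∘ suc)
        coefficients (p ∷ ps) (false ∷ X) α = coefficients ps X (α ∘ suc)

        combination-coefficients : ∀ {n} (ps : Vec A n) X α v → (∀ i → v i ≡ V (lookup ps i)) → ∀ j →
          combination V (coefficients ps X α) j ≈ sumFin K (term v X α j)
        combination-coefficients []       []          α v eq j = K.refl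
        combination-coefficients (p ∷ ps) (true  ∷ X) α v eq j =
          +-cong (K.reflexive (≡.cong (λ w → α zero * w j) (≡.sym (eq zero))))
                 (combination-coefficients ps X (α ∘ suc) (v ∘ suc) (eq ∘ suc) j)
        combination-coefficients (p ∷ ps) (false ∷ X) α v eq j =
          K.trans (combination-coefficients ps X (α ∘ suc) (v ∘ suc) (eq ∘ suc) j) (K.sym (+-identityˡ _))

        trivial-coefficients : ∀ {n} (ps : Vec A n) X α → Trivial (coefficients ps X α) → ∀ i → i ∈ X → α i ≈ 0#
        trivial-coefficients (p ∷ ps) (true  ∷ X) α (z , t) zero    i∈X         = z
        trivial-coefficients (p ∷ ps) (true  ∷ X) α (z , t) (suc i) (there i∈X) = trivial-coefficients ps X (α ∘ suc) t i i∈X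
        trivial-coefficients (p ∷ ps) (false ∷ X) α t       (suc i) (there i∈X) = trivial-coefficients ps X (α ∘ suc) t i i∈X

        extend : ∀ {n} (ps : Vec A n) X → Coefficients (select ps X) → Fin n → Carrier
        extend (p ∷ ps) (true  ∷ X) (α ∷ αs) zero    = α
        extend (p ∷ ps) (true  ∷ X) (α ∷ αs) (suc i) = extend ps X αs i
        extend (p ∷ ps) (false ∷ X) αs       zero    = 0#
        extend (p ∷ ps) (false ∷ X) αs       (suc i) = extend ps X αs i

        coefficients-extend : ∀ {n} (ps : Vec A n) X αs → coefficients ps X (extend ps X αs) ≡ αs
        coefficients-extend []       []          []       = ≡.refl
        coefficients-extend (p ∷ ps) (true  ∷ X) (α ∷ αs) = ≡.cong (α ∷_) (coefficients-extend ps X αs)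
        coefficients-extend (p ∷ ps) (false ∷ X) αs       = coefficients-extend ps X αs

        trivial⁻ : ∀ {n} (ps : Vec A n) X α → (∀ i → i ∈ X → α i ≈ 0#) → Trivial (coefficients ps X α)
        trivial⁻ []       []          α z = tt
        trivial⁻ (p ∷ ps) (true  ∷ X) α z = z zero here , trivial⁻ ps X (α ∘ suc) (λ i i∈X → z (suc i) (there i∈X))
        trivial⁻ (p ∷ ps) (false ∷ X) α z = trivial⁻ ps X (α ∘ suc) (λ i i∈X → z (suc i) (there i∈X))

        module _ {n} (ps : Vec A n) (v : Fin n → Fin r → Carrier) (eq : ∀ i → v i ≡ V (lookup ps i)) (X : Subset n) where

          independent⇒linIndep : Independent V (select ps X) → LinIndep K v X
          independent⇒linIndep indep α van = trivial-coefficients ps X α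
            (indep (coefficients ps X α) λ j → K.trans (combination-coefficients ps X α v eq j) (van j))

          linIndep⇒independent : LinIndep K v X → Independent V (select ps X)
          linIndep⇒independent indep αs van = ≡.subst Trivial (coefficients-extend ps X αs)
            (trivial⁻ ps X α (indep α λ j → K.trans (K.sym (combination-coefficients ps X α v eq j))
              (K.trans (K.reflexive (≡.cong (λ βs → combination V βs j) (coefficients-extend ps X αs))) (van j))))
            where α = extend ps X αs

open LinearDependence

-- Matroids of rank at most 3 from a collinearity relation.

module RankThreeMatroids where

  open import Data.Nat using (zero; suc; _≤_; _<_; z≤n; s≤s)
  open import Data.Nat.Properties using (≤-antisym; ≤-trans; m≤m+n)
  open import Data.Bool using (Bool; true; false; not)
  open import Data.Fin using (zero; suc)
  open import Data.Fin.Subset as Subset using (Subset; _∈_; _∉_; _⊆_; _∪_; ⁅_⁆; ∣_∣)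
  open import Data.Fin.Subset.Properties using (drop-∷-⊆; ∪-identityʳ)
  open import Data.Vec using (Vec; []; _∷_; lookup; here; there)
  import Data.Vec.Relation.Unary.All as VecAll
  open import Data.Vec.Relation.Unary.AllPairs using ([]; _∷_)
  import Data.Vec.Relation.Unary.Unique.Propositional as VecUnique
  open import Data.List using (List; []; _∷_; _++_; length)
  open import Data.List.Properties using (++-assoc)
  import Data.List.Relation.Unary.Any as Any
  open import Data.List.Relation.Unary.All as All using (All; []; _∷_)
  open import Data.List.Relation.Unary.AllPairs using ([]; _∷_)
  open import Data.List.Relation.Unary.Unique.Propositional using (Unique)
  open import Data.List.Membership.Propositional using () renaming (_∈_ to _∈ˡ_; _∉_ to _∉ˡ_)
  open import Data.List.Relation.Binary.Sublist.Propositional using ([]; _∷ʳ_; _∷_) renaming (_⊆_ to _⊑_)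
  open import Data.List.Relation.Binary.Sublist.Heterogeneous.Properties using (length-mono-≤; toPointwise)
  open import Data.List.Relation.Binary.Pointwise using (Pointwise-≡⇒≡)
  open import Data.List.Relation.Binary.Permutation.Propositional using (_↭_; refl; prep; swap; trans; ↭-refl)
  open import Data.Product using (_×_; ∃; _,_)
  open import Data.Empty using (⊥)
  open import Function using (_∘_; mk⇔)
  open import Relation.Nullary using (yes; no; ¬_; Dec; does; contradiction)
  open import Relation.Nullary.Decidable using (dec-false; does-⇔)
  open import Relation.Binary.PropositionalEquality as ≡ using (_≡_; _≢_; cong)

  not-does⁺ : ∀ {p} {P : Set p} (d : Dec P) → ¬ P → not (does d) ≡ true
  not-does⁺ d ¬p = cong not (dec-false d ¬p)

  not-does⁻ : ∀ {p} {P : Set p} (d : Dec P) → not (does d) ≡ true → ¬ P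
  not-does⁻ (no ¬p) eq = ¬p

  module _ {a} {A : Set a} where

    select-⊑ : ∀ {n} (ps : Vec A n) {X Y} → X ⊆ Y → select ps X ⊑ select ps Y
    select-⊑ []       {[]}        {[]}        X⊆Y = []
    select-⊑ (p ∷ ps) {true ∷ X}  {true ∷ Y}  X⊆Y = ≡.refl ∷ select-⊑ ps (drop-∷-⊆ X⊆Y)
    select-⊑ (p ∷ ps) {true ∷ X}  {false ∷ Y} X⊆Y = contradiction (X⊆Y here) λ ()
    select-⊑ (p ∷ ps) {false ∷ X} {true ∷ Y}  X⊆Y = p ∷ʳ select-⊑ ps (drop-∷-⊆ X⊆Y)
    select-⊑ (p ∷ ps) {false ∷ X} {false ∷ Y} X⊆Y = select-⊑ ps (drop-∷-⊆ X⊆Y)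

    select-⊥ : ∀ {n} (ps : Vec A n) → select ps Subset.⊥ ≡ []
    select-⊥ []       = ≡.refl
    select-⊥ (p ∷ ps) = select-⊥ ps

    length-select : ∀ {n} (ps : Vec A n) X → length (select ps X) ≡ ∣ X ∣
    length-select []       []          = ≡.refl
    length-select (p ∷ ps) (true  ∷ X) = cong suc (length-select ps X)
    length-select (p ∷ ps) (false ∷ X) = length-select ps X

    select-∪⁅⁆ : ∀ {n} (ps : Vec A n) X e → e ∉ X → select ps (X ∪ ⁅ e ⁆) ↭ lookup ps e ∷ select ps X
    select-∪⁅⁆ (p ∷ ps) (true  ∷ X) zero    e∉X = contradiction here e∉X
    select-∪⁅⁆ (p ∷ ps) (false ∷ X) zero    e∉X rewrite ∪-identityʳ X = ↭-refl
    select-∪⁅⁆ (p ∷ ps) (true  ∷ X) (suc e) e∉X =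
      trans (prep p (select-∪⁅⁆ ps X e (e∉X ∘ there))) (swap p (lookup ps e) ↭-refl)
    select-∪⁅⁆ (p ∷ ps) (false ∷ X) (suc e) e∉X = select-∪⁅⁆ ps X e (e∉X ∘ there)

    select⁺ : ∀ {n} (ps : Vec A n) {X i} → i ∈ X → lookup ps i ∈ˡ select ps X
    select⁺ (p ∷ ps) {true  ∷ X} {zero}  here        = Any.here ≡.refl
    select⁺ (p ∷ ps) {true  ∷ X} {suc i} (there i∈X) = Any.there (select⁺ ps i∈X)
    select⁺ (p ∷ ps) {false ∷ X} {suc i} (there i∈X) = select⁺ ps i∈X

    select⁻ : ∀ {n} (ps : Vec A n) X {p} → p ∈ˡ select ps X → ∃ λ i → i ∈ X × lookup ps i ≡ p
    select⁻ []       []          ()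
    select⁻ (p ∷ ps) (true ∷ X)  (Any.here ≡.refl) = zero , here , ≡.refl
    select⁻ (p ∷ ps) (true ∷ X)  (Any.there q∈) with select⁻ ps X q∈
    ... | i , i∈X , eq = suc i , there i∈X , eq
    select⁻ (p ∷ ps) (false ∷ X) q∈ with select⁻ ps X q∈
    ... | i , i∈X , eq = suc i , there i∈X , eq

    select-All : ∀ {p} {P : A → Set p} {n} {ps : Vec A n} → VecAll.All P ps → ∀ X → All P (select ps X)
    select-All VecAll.[]         []          = []
    select-All (px VecAll.∷ pxs) (true  ∷ X) = px ∷ select-All pxs X
    select-All (px VecAll.∷ pxs) (false ∷ X) = select-All pxs X

    select-unique : ∀ {n} {ps : Vec A n} → VecUnique.Unique ps → ∀ X → Unique (select ps X)
    select-unique []       []          = []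
    select-unique (u ∷ us) (true  ∷ X) = select-All u X ∷ select-unique us X
    select-unique (u ∷ us) (false ∷ X) = select-unique us X

    -- Inverts `select` up to order. It carries lists of points, chosen freely in geometric
    -- arguments, to subsets of the ground set, where a representation has something to say.
    toSubset : ∀ {n} (ps : Vec A n) l → Unique l → All (λ p → ∃ λ i → lookup ps i ≡ p) l →
      ∃ λ X → select ps X ↭ l
    toSubset ps []      _        _ rewrite ≡.sym (select-⊥ ps) = Subset.⊥ , ↭-refl
    toSubset ps (p ∷ l) (p∉ ∷ u) ((i , ≡.refl) ∷ is) with toSubset ps l u is
    ... | X , X↭l = X ∪ ⁅ i ⁆ , trans (select-∪⁅⁆ ps X i i∉X) (prep p X↭l)
      where
      open import Data.List.Relation.Binary.Permutation.Propositional.Properties using (∈-resp-↭)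
      i∉X : i ∉ X
      i∉X i∈X = All.lookup p∉ (∈-resp-↭ X↭l (select⁺ ps i∈X)) ≡.refl

  -- The axioms of points and lines: two transpositions generate all symmetries of `Col`,
  -- `degenerate` then covers every triple with a repeated point, and `through` says that two
  -- distinct points determine their line.
  module RankThree {a} {A : Set a}
    (_≟_ : (p q : A) → Dec (p ≡ q))
    (Col : A → A → A → Set) (Col? : ∀ p q r → Dec (Col p q r))
    (swap₁₂ : ∀ {p q r} → Col p q r → Col q p r)
    (swap₂₃ : ∀ {p q r} → Col p q r → Col p r q)
    (degenerate : ∀ {p q} → Col p p q)
    (through : ∀ {p q r s} → p ≢ q → Col p q r → Col p q s → Col p r s)
    where

    independent : List A → Bool
    independent []                  = true
    independent (_ ∷ [])            = true
    independent (_ ∷ _ ∷ [])        = true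
    independent (p ∷ q ∷ r ∷ [])    = not (does (Col? p q r))
    independent (_ ∷ _ ∷ _ ∷ _ ∷ _) = false

    -- The prefix makes the induction work: a common head is moved into it, so a transposition may
    -- occur at any depth. Order matters only for lists of length 3, where the symmetries of `Col`
    -- apply.
    independent-++-↭ : ∀ l {l₁ l₂} → l₁ ↭ l₂ → independent (l ++ l₁) ≡ independent (l ++ l₂)
    independent-++-↭ l refl = ≡.refl
    independent-++-↭ l {_ ∷ l₁} {_ ∷ l₂} (prep x p) = begin
      independent (l ++ x ∷ l₁)        ≡⟨ cong independent (≡.sym (++-assoc l (x ∷ []) l₁)) ⟩
      independent ((l ++ x ∷ []) ++ l₁)     ≡⟨ independent-++-↭ (l ++ x ∷ []) p ⟩
      independent ((l ++ x ∷ []) ++ l₂)     ≡⟨ cong independent (++-assoc l (x ∷ []) l₂) ⟩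
      independent (l ++ x ∷ l₂)        ∎
      where open ≡.≡-Reasoning
    independent-++-↭ l {_ ∷ _ ∷ l₁} {_ ∷ _ ∷ l₂} (swap x y p) = begin
      independent (l ++ x ∷ y ∷ l₁)            ≡⟨ transpose l l₁ ⟩
      independent (l ++ y ∷ x ∷ l₁)            ≡⟨ cong independent (≡.sym (++-assoc l (y ∷ x ∷ []) l₁)) ⟩
      independent ((l ++ y ∷ x ∷ []) ++ l₁)    ≡⟨ independent-++-↭ (l ++ y ∷ x ∷ []) p ⟩
      independent ((l ++ y ∷ x ∷ []) ++ l₂)    ≡⟨ cong independent (++-assoc l (y ∷ x ∷ []) l₂) ⟩
      independent (l ++ y ∷ x ∷ l₂)            ∎
      where
      open ≡.≡-Reasoning
      transpose : ∀ l m → independent (l ++ x ∷ y ∷ m) ≡ independent (l ++ y ∷ x ∷ m)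
      transpose []              []          = ≡.refl
      transpose []              (p ∷ [])    = cong not (does-⇔ (mk⇔ swap₁₂ swap₁₂) (Col? x y p) (Col? y x p))
      transpose []              (p ∷ q ∷ _) = ≡.refl
      transpose (p ∷ [])        []          = cong not (does-⇔ (mk⇔ swap₂₃ swap₂₃) (Col? p x y) (Col? p y x))
      transpose (p ∷ [])        (q ∷ _)     = ≡.refl
      transpose (p ∷ q ∷ [])    m           = ≡.refl
      transpose (p ∷ q ∷ r ∷ [])    m       = ≡.refl
      transpose (p ∷ q ∷ r ∷ s ∷ l) m       = ≡.refl
    independent-++-↭ l (trans p q) = ≡.trans (independent-++-↭ l p) (independent-++-↭ l q)

    independent-↭ : ∀ {l₁ l₂} → l₁ ↭ l₂ → independent l₁ ≡ independent l₂
    independent-↭ = independent-++-↭ []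

    independent-length : ∀ l → independent l ≡ true → length l ≤ 3
    independent-length []              _  = z≤n
    independent-length (_ ∷ [])        _  = s≤s z≤n
    independent-length (_ ∷ _ ∷ [])    _  = s≤s (s≤s z≤n)
    independent-length (_ ∷ _ ∷ _ ∷ []) _ = s≤s (s≤s (s≤s z≤n))

    independent-⊑ : ∀ {l₁ l₂} → l₁ ⊑ l₂ → independent l₂ ≡ true → independent l₁ ≡ true
    independent-⊑ {[]}               τ eq = ≡.refl
    independent-⊑ {_ ∷ []}           τ eq = ≡.refl
    independent-⊑ {_ ∷ _ ∷ []}       τ eq = ≡.refl
    -- An independent list has at most 3 entries, so a sublist with at least 3 is all of it.
    independent-⊑ {l₁@(_ ∷ _ ∷ _ ∷ l)} {l₂} τ eq = ≡.trans (cong independent l₁≡l₂) eq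
      where
      l₁≡l₂ : l₁ ≡ l₂
      l₁≡l₂ = Pointwise-≡⇒≡ (toPointwise
        (≤-antisym (length-mono-≤ τ) (≤-trans (independent-length l₂ eq) (m≤m+n 3 (length l)))) τ)

    -- Geometry enters only for two points against three: if none of `p`, `q`, `r` extends
    -- `a ∷ b ∷ []`, all three lie on the line of `a` and `b`. They are then collinear by `through`,
    -- applied again to the line respanned by `p` and `a` unless these coincide.
    augment : ∀ {l₁ l₂} → Unique l₁ → Unique l₂ → independent l₂ ≡ true → length l₁ < length l₂ →
      ∃ λ p → p ∈ˡ l₂ × p ∉ˡ l₁ × independent (p ∷ l₁) ≡ true
    augment {[]} {p ∷ _} _ _ _ _ = p , Any.here ≡.refl , (λ ()) , ≡.refl
    augment {a ∷ []} {p ∷ []} _ _ _ (s≤s ())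
    augment {a ∷ []} {p ∷ q ∷ _} _ ((p≢q ∷ _) ∷ _) _ _ with p ≟ a
    ... | no p≢a     = p , Any.here ≡.refl , (λ { (Any.here p≡a) → p≢a p≡a }) , ≡.refl
    ... | yes ≡.refl = q , Any.there (Any.here ≡.refl) , (λ { (Any.here q≡p) → p≢q (≡.sym q≡p) }) , ≡.refl
    augment {a ∷ b ∷ []} {p ∷ []} _ _ _ (s≤s ())
    augment {a ∷ b ∷ []} {p ∷ q ∷ []} _ _ _ (s≤s (s≤s ()))
    augment {a ∷ b ∷ []} {p ∷ q ∷ r ∷ []} ((a≢b ∷ _) ∷ _) _ pqr _ =
      pick (Col? a b p) (Col? a b q) (Col? a b r)
      where
      new : ∀ {s} → ¬ Col a b s → s ∉ˡ a ∷ b ∷ [] × independent (s ∷ a ∷ b ∷ []) ≡ true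
      new {s} ¬abs =
        (λ { (Any.here ≡.refl)             → ¬abs (swap₂₃ degenerate)
           ; (Any.there (Any.here ≡.refl)) → ¬abs (swap₁₂ (swap₂₃ degenerate)) })
        , not-does⁺ (Col? s a b) (¬abs ∘ swap₂₃ ∘ swap₁₂)
      pick : Dec (Col a b p) → Dec (Col a b q) → Dec (Col a b r) →
        ∃ λ s → s ∈ˡ p ∷ q ∷ r ∷ [] × s ∉ˡ a ∷ b ∷ [] × independent (s ∷ a ∷ b ∷ []) ≡ true
      pick (no ¬p) _       _       = p , Any.here ≡.refl , new ¬p
      pick _       (no ¬q) _       = q , Any.there (Any.here ≡.refl) , new ¬q
      pick _       _       (no ¬r) = r , Any.there (Any.there (Any.here ≡.refl)) , new ¬r
      pick (yes abp) (yes abq) (yes abr) = contradiction pqr-collinear (not-does⁻ (Col? p q r) pqr)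
        where
        pqr-collinear : Col p q r
        pqr-collinear with a ≟ p
        ... | yes ≡.refl = through a≢b abq abr
        ... | no a≢p     = through (a≢p ∘ ≡.sym) (swap₁₂ (through a≢b abp abq)) (swap₁₂ (through a≢b abp abr))
    augment {_ ∷ _ ∷ _ ∷ _} {_ ∷ []} _ _ _ (s≤s ())
    augment {_ ∷ _ ∷ _ ∷ _} {_ ∷ _ ∷ []} _ _ _ (s≤s (s≤s ()))
    augment {_ ∷ _ ∷ _ ∷ _} {_ ∷ _ ∷ _ ∷ []} _ _ _ (s≤s (s≤s (s≤s ())))

    matroid : ∀ {n} (ps : Vec A n) → VecUnique.Unique ps → Matroid n
    matroid ps uniq = record
      { Ind         = λ X → independent (select ps X)
      ; ind-empty   = cong independent (select-⊥ ps)
      ; ind-subset  = λ X⊆Y → independent-⊑ (select-⊑ ps X⊆Y)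
      ; ind-augment = λ {X} {Y} _ indepY ∣X∣<∣Y∣ → extract X Y (augment
          (select-unique uniq X) (select-unique uniq Y) indepY
          (≡.subst₂ _<_ (≡.sym (length-select ps X)) (≡.sym (length-select ps Y)) ∣X∣<∣Y∣))
      }
      where
      extract : ∀ X Y → (∃ λ p → p ∈ˡ select ps Y × p ∉ˡ select ps X × independent (p ∷ select ps X) ≡ true) →
        ∃ λ e → e ∈ Y × e ∉ X × independent (select ps (X ∪ ⁅ e ⁆)) ≡ true
      extract X Y (p , p∈ , p∉ , indep) with select⁻ ps Y p∈
      ... | e , e∈Y , ≡.refl = e , e∈Y , e∉X , ≡.trans (independent-↭ (select-∪⁅⁆ ps X e e∉X)) indep
        where
        e∉X : e ∉ X
        e∉X = p∉ ∘ select⁺ ps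

open RankThreeMatroids

-- The matroids glued from two chains and three centres.

module TwoChains where

  open import Data.Nat as ℕ using (ℕ; zero; suc; _+_; _≤_)
  open import Data.Nat.Properties using (+-comm; +-assoc; +-cancelˡ-≡; m≤m+n; m≤n+m; ≤-reflexive; ≤-trans; <-irrefl)
  open import Data.Bool using (Bool; true; false)
  import Data.Bool as Bool
  open import Data.Fin as Fin using (Fin; zero; suc; toℕ)
  open import Data.Fin.Properties using (toℕ-injective; toℕ≤pred[n])
  open import Data.Vec as Vec using (Vec; tabulate)
  import Data.Vec.Relation.Unary.All as VecAll
  import Data.Vec.Relation.Unary.All.Properties as VecAllₚ
  import Data.Vec.Relation.Unary.AllPairs.Properties as AllPairsₚ
  import Data.Vec.Relation.Unary.Unique.Propositional as VecUnique
  import Data.Vec.Relation.Unary.Unique.Propositional.Properties as VecUniqueₚ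
  open import Data.Product using (_×_; _,_)
  open import Data.Sum using (_⊎_; inj₁; inj₂)
  open import Data.Unit using (⊤)
  open import Function using (_∘_)
  open import Relation.Nullary using (no; ¬_; Dec; contradiction)
  open import Relation.Nullary.Decidable using (map′; _×-dec_; _⊎-dec_)
  open import Relation.Binary.PropositionalEquality using (_≡_; _≢_; refl; cong; sym; trans)

  -- The chain `false` is called left and `true` right; `p₃` gives the centres. Indices are
  -- unbounded, so that points of configurations with different lengths can be compared; bounds
  -- enter only through `points` and `Valid`.
  data Point : Set where
    p₁ p₂ : Bool → ℕ → Point
    p₃    : Fin 3 → Point

  _≟_ : (p q : Point) → Dec (p ≡ q)
  p₁ b i ≟ p₁ d j = map′ (λ { (refl , refl) → refl }) (λ { refl → refl , refl }) (b Bool.≟ d ×-dec i ℕ.≟ j)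
  p₂ b i ≟ p₂ d j = map′ (λ { (refl , refl) → refl }) (λ { refl → refl , refl }) (b Bool.≟ d ×-dec i ℕ.≟ j)
  p₃ k   ≟ p₃ l   = map′ (cong p₃) (λ { refl → refl }) (k Fin.≟ l)
  p₁ _ _ ≟ p₂ _ _ = no λ ()
  p₁ _ _ ≟ p₃ _   = no λ ()
  p₂ _ _ ≟ p₁ _ _ = no λ ()
  p₂ _ _ ≟ p₃ _   = no λ ()
  p₃ _   ≟ p₁ _ _ = no λ ()
  p₃ _   ≟ p₂ _ _ = no λ ()

  -- Three of the labels 1, 2, 4 add up to 7 only if they are distinct.
  line : Point → ℕ
  line (p₁ _ _) = 1
  line (p₂ _ _) = 2
  line (p₃ _)   = 4

  exponent : ℕ → Fin 3 → ℕ
  exponent M zero             = 0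
  exponent M (suc zero)       = 1
  exponent M (suc (suc zero)) = M

  -- The points p₂ b j are numbered from the far end of the chain, so that p₁ b i, p₂ b j and p₃ k are collinear when
  -- i + j + exponent M k = M. Points of the other chain get a gain exceeding M, which keeps them out of balanced triples.
  gain : Bool → ℕ → Point → ℕ
  gain b     M (p₃ k)       = exponent M k
  gain false M (p₁ false i) = i
  gain false M (p₂ false i) = i
  gain true  M (p₁ true  i) = i
  gain true  M (p₂ true  i) = i
  gain false M (p₁ true  i) = suc M
  gain false M (p₂ true  i) = suc M
  gain true  M (p₁ false i) = suc M
  gain true  M (p₂ false i) = suc M

  Long : Point → Point → Point → Set
  Long p q r = line p ≡ line q × line q ≡ line r

  -- These triples form the short lines, which meet the three long lines in different points. The
  -- sum of gains is the vanishing of a determinant, written in exponents of α.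
  record Balanced (b : Bool) (M : ℕ) (p q r : Point) : Set where
    constructor _,_
    field
      lines-sum : line p + line q + line r ≡ 7
      gains-sum : gain b M p + gain b M q + gain b M r ≡ M

  open Balanced

  balanced? : ∀ b M p q r → Dec (Balanced b M p q r)
  balanced? b M p q r = map′ (λ (l , g) → l , g) (λ (l , g) → l , g)
    (line p + line q + line r ℕ.≟ 7 ×-dec gain b M p + gain b M q + gain b M r ℕ.≟ M)

  Degenerate : Point → Point → Point → Set
  Degenerate p q r = p ≡ q ⊎ q ≡ r ⊎ p ≡ r

  swap₁₂-sum : ∀ a b c {s} → a + b + c ≡ s → b + a + c ≡ s
  swap₁₂-sum a b c = trans (cong (_+ c) (+-comm b a))

  swap₂₃-sum : ∀ a b c {s} → a + b + c ≡ s → a + c + b ≡ s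
  swap₂₃-sum a b c eq = trans (+-assoc a c b) (trans (cong (a +_) (+-comm c b)) (trans (sym (+-assoc a b c)) eq))

  line-⊥ : ∀ p q r → line p ≡ line q → line p + line q + line r ≢ 7
  line-⊥ (p₁ _ _) (p₁ _ _) (p₁ _ _) _ ()
  line-⊥ (p₁ _ _) (p₁ _ _) (p₂ _ _) _ ()
  line-⊥ (p₁ _ _) (p₁ _ _) (p₃ _)   _ ()
  line-⊥ (p₂ _ _) (p₂ _ _) (p₁ _ _) _ ()
  line-⊥ (p₂ _ _) (p₂ _ _) (p₂ _ _) _ ()
  line-⊥ (p₂ _ _) (p₂ _ _) (p₃ _)   _ ()
  line-⊥ (p₃ _)   (p₃ _)   (p₁ _ _) _ ()
  line-⊥ (p₃ _)   (p₃ _)   (p₂ _ _) _ ()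
  line-⊥ (p₃ _)   (p₃ _)   (p₃ _)   _ ()

  gain≤ : ∀ b M {p q r} → Balanced b M p q r → gain b M p ≤ M
  gain≤ b M {p} {q} {r} (_ , eq) =
    ≤-trans (≤-trans (m≤m+n _ (gain b M q)) (m≤m+n _ (gain b M r))) (≤-reflexive eq)

  balanced-swap₁₂ : ∀ b M {p q r} → Balanced b M p q r → Balanced b M q p r
  balanced-swap₁₂ b M {p} {q} {r} (l , g) =
    swap₁₂-sum (line p) (line q) (line r) l , swap₁₂-sum (gain b M p) (gain b M q) (gain b M r) g

  balanced-swap₂₃ : ∀ b M {p q r} → Balanced b M p q r → Balanced b M p r q
  balanced-swap₂₃ b M {p} {q} {r} (l , g) =
    swap₂₃-sum (line p) (line q) (line r) l , swap₂₃-sum (gain b M p) (gain b M q) (gain b M r) g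

  exponent-injective : ∀ k {i j} → exponent (2 + k) i ≡ exponent (2 + k) j → i ≡ j
  exponent-injective k {zero}         {zero}         _ = refl
  exponent-injective k {suc zero}     {suc zero}     _ = refl
  exponent-injective k {suc (suc zero)} {suc (suc zero)} _ = refl
  exponent-injective k {zero}         {suc zero}     ()
  exponent-injective k {zero}         {suc (suc zero)} ()
  exponent-injective k {suc zero}     {zero}         ()
  exponent-injective k {suc zero}     {suc (suc zero)} ()
  exponent-injective k {suc (suc zero)} {zero}       ()
  exponent-injective k {suc (suc zero)} {suc zero}   ()

  -- The points of the other chain all share the gain `suc M`, so the bound has to exclude them.
  -- Among the centres injectivity needs 0, 1 and `M` to be distinct; this is why lengths have the
  -- form `2 + k`.
  gain-injective : ∀ b k p q → line p ≡ line q → gain b (2 + k) p ≡ gain b (2 + k) q →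
    gain b (2 + k) p ≤ 2 + k → p ≡ q
  gain-injective b     k (p₃ i)       (p₃ j)       _ eq   _ = cong p₃ (exponent-injective k eq)
  gain-injective false k (p₁ false i) (p₁ false i) _ refl _ = refl
  gain-injective false k (p₂ false i) (p₂ false i) _ refl _ = refl
  gain-injective true  k (p₁ true i)  (p₁ true i)  _ refl _ = refl
  gain-injective true  k (p₂ true i)  (p₂ true i)  _ refl _ = refl
  gain-injective false k (p₁ false i) (p₁ true _)  _ refl i≤ = contradiction i≤ (<-irrefl refl)
  gain-injective false k (p₂ false i) (p₂ true _)  _ refl i≤ = contradiction i≤ (<-irrefl refl)
  gain-injective true  k (p₁ true i)  (p₁ false _) _ refl i≤ = contradiction i≤ (<-irrefl refl)
  gain-injective true  k (p₂ true i)  (p₂ false _) _ refl i≤ = contradiction i≤ (<-irrefl refl)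
  gain-injective false k (p₁ true i)  (p₁ _ _)     _ _    i≤ = contradiction i≤ (<-irrefl refl)
  gain-injective false k (p₂ true i)  (p₂ _ _)     _ _    i≤ = contradiction i≤ (<-irrefl refl)
  gain-injective true  k (p₁ false i) (p₁ _ _)     _ _    i≤ = contradiction i≤ (<-irrefl refl)
  gain-injective true  k (p₂ false i) (p₂ _ _)     _ _    i≤ = contradiction i≤ (<-irrefl refl)

  -- The chains have only the centres in common: every other point has too large a gain with respect
  -- to one of them.
  both-small : ∀ M N p → gain false M p ≤ M → gain true N p ≤ N → line p ≡ 4
  both-small M N (p₃ _)       _ _ = refl
  both-small M N (p₁ false _) _ N< = contradiction N< (<-irrefl refl)
  both-small M N (p₂ false _) _ N< = contradiction N< (<-irrefl refl)
  both-small M N (p₁ true _)  M< _ = contradiction M< (<-irrefl refl)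
  both-small M N (p₂ true _)  M< _ = contradiction M< (<-irrefl refl)

  length-of : ℕ → ℕ → Bool → ℕ
  length-of m n false = 2 + m
  length-of m n true  = 2 + n

  Valid : ℕ → ℕ → Point → Set
  Valid m n (p₁ b i) = i ≤ length-of m n b
  Valid m n (p₂ b i) = i ≤ length-of m n b
  Valid m n (p₃ k)   = ⊤

  Collinear : ℕ → ℕ → Point → Point → Point → Set
  Collinear m n p q r =
    Degenerate p q r ⊎ Long p q r ⊎ Balanced false (2 + m) p q r ⊎ Balanced true (2 + n) p q r

  pattern degenerate d = inj₁ d
  pattern long l       = inj₂ (inj₁ l)
  pattern balancedˡ s  = inj₂ (inj₂ (inj₁ s))
  pattern balancedʳ s  = inj₂ (inj₂ (inj₂ s))

  module Configuration (m n : ℕ) where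

    Col : Point → Point → Point → Set
    Col = Collinear m n

    Col? : ∀ p q r → Dec (Col p q r)
    Col? p q r =
      (p ≟ q ⊎-dec q ≟ r ⊎-dec p ≟ r)
      ⊎-dec (line p ℕ.≟ line q ×-dec line q ℕ.≟ line r)
      ⊎-dec balanced? false (2 + m) p q r
      ⊎-dec balanced? true (2 + n) p q r

    not-collinear : ∀ {p q r} → p ≢ q → q ≢ r → p ≢ r → ¬ Long p q r → line p + line q + line r ≢ 7 → ¬ Col p q r
    not-collinear p≢q q≢r p≢r ¬long ≢7 (degenerate (inj₁ e))        = p≢q e
    not-collinear p≢q q≢r p≢r ¬long ≢7 (degenerate (inj₂ (inj₁ e))) = q≢r e
    not-collinear p≢q q≢r p≢r ¬long ≢7 (degenerate (inj₂ (inj₂ e))) = p≢r e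
    not-collinear p≢q q≢r p≢r ¬long ≢7 (long l)            = ¬long l
    not-collinear p≢q q≢r p≢r ¬long ≢7 (balancedˡ (l , _)) = ≢7 l
    not-collinear p≢q q≢r p≢r ¬long ≢7 (balancedʳ (l , _)) = ≢7 l

    balanced-collinear : ∀ b i j k → i + j + exponent (length-of m n b) k ≡ length-of m n b →
      Col (p₁ b i) (p₂ b j) (p₃ k)
    balanced-collinear false i j k g = balancedˡ (refl , g)
    balanced-collinear true  i j k g = balancedʳ (refl , g)

    swap₁₂ : ∀ {p q r} → Col p q r → Col q p r
    swap₁₂ (degenerate (inj₁ p≡q))        = degenerate (inj₁ (sym p≡q))
    swap₁₂ (degenerate (inj₂ (inj₁ q≡r))) = degenerate (inj₂ (inj₂ q≡r))
    swap₁₂ (degenerate (inj₂ (inj₂ p≡r))) = degenerate (inj₂ (inj₁ p≡r))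
    swap₁₂ (long (pq , qr))               = long (sym pq , trans pq qr)
    swap₁₂ (balancedˡ s)                  = balancedˡ (balanced-swap₁₂ false (2 + m) s)
    swap₁₂ (balancedʳ s)                  = balancedʳ (balanced-swap₁₂ true (2 + n) s)

    swap₂₃ : ∀ {p q r} → Col p q r → Col p r q
    swap₂₃ (degenerate (inj₁ p≡q))        = degenerate (inj₂ (inj₂ p≡q))
    swap₂₃ (degenerate (inj₂ (inj₁ q≡r))) = degenerate (inj₂ (inj₁ (sym q≡r)))
    swap₂₃ (degenerate (inj₂ (inj₂ p≡r))) = degenerate (inj₁ p≡r)
    swap₂₃ (long (pq , qr))               = long (trans pq qr , sym qr)
    swap₂₃ (balancedˡ s)                  = balancedˡ (balanced-swap₂₃ false (2 + m) s)
    swap₂₃ (balancedʳ s)                  = balancedʳ (balanced-swap₂₃ true (2 + n) s)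

    same-gain : ∀ b k p q {r s} → Balanced b (2 + k) p q r → Balanced b (2 + k) p q s → r ≡ s
    same-gain b k p q {r} {s} B@(lr , gr) (ls , gs) =
      gain-injective b k r s
        (+-cancelˡ-≡ (line p + line q) (line r) (line s) (trans lr (sym ls)))
        (+-cancelˡ-≡ (gain b (2 + k) p + gain b (2 + k) q) _ _ (trans gr (sym gs)))
        (≤-trans (m≤n+m _ (gain b (2 + k) p + gain b (2 + k) q)) (≤-reflexive gr))

    -- Both `p` and `q` would be centres, hence on one long line, whereas a balanced triple meets
    -- each long line once.
    not-both : ∀ {p q r s} → Balanced false (2 + m) p q r → ¬ Balanced true (2 + n) p q s
    not-both {p} {q} {r} {s} B B′ = line-⊥ p q r
      (trans (centre B B′) (sym (centre (balanced-swap₁₂ false (2 + m) B) (balanced-swap₁₂ true (2 + n) B′))))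
      (lines-sum B)
      where
      centre : ∀ {p q r s} → Balanced false (2 + m) p q r → Balanced true (2 + n) p q s → line p ≡ 4
      centre {p} {q} {r} {s} B B′ =
        both-small (2 + m) (2 + n) p (gain≤ false (2 + m) {p} {q} {r} B) (gain≤ true (2 + n) {p} {q} {s} B′)

    -- Apart from degenerate triples, two lines through `p` and `q` must be of the same kind:
    -- `line-⊥` separates short lines from long ones, and `not-both` separates the short lines of
    -- the two chains. On a short line the third point is unique by `same-gain`.
    through : ∀ {p q r s} → p ≢ q → Col p q r → Col p q s → Col p r s
    through p≢q (degenerate (inj₁ p≡q))         _   = contradiction p≡q p≢q
    through p≢q (degenerate (inj₂ (inj₁ refl))) pqs = pqs
    through p≢q (degenerate (inj₂ (inj₂ refl))) _   = degenerate (inj₁ refl)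
    through p≢q _   (degenerate (inj₁ p≡q))         = contradiction p≡q p≢q
    through p≢q pqr (degenerate (inj₂ (inj₁ refl))) = swap₂₃ pqr
    through p≢q _   (degenerate (inj₂ (inj₂ refl))) = degenerate (inj₂ (inj₂ refl))
    through p≢q (long (pq , qr)) (long (_ , qs))    = long (trans pq qr , trans (sym qr) qs)
    through {p} {q} {s = s} p≢q (long (pq , _)) (balancedˡ (l , _)) = contradiction l (line-⊥ p q s pq)
    through {p} {q} {s = s} p≢q (long (pq , _)) (balancedʳ (l , _)) = contradiction l (line-⊥ p q s pq)
    through {p} {q} {r} p≢q (balancedˡ (l , _)) (long (pq , _)) = contradiction l (line-⊥ p q r pq)
    through {p} {q} {r} p≢q (balancedʳ (l , _)) (long (pq , _)) = contradiction l (line-⊥ p q r pq)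
    through {p} {q} p≢q (balancedˡ B) (balancedˡ B′) = degenerate (inj₂ (inj₁ (same-gain false m p q B B′)))
    through {p} {q} p≢q (balancedʳ B) (balancedʳ B′) = degenerate (inj₂ (inj₁ (same-gain true n p q B B′)))
    through {p} {q} {r} {s} p≢q (balancedˡ B) (balancedʳ B′) = contradiction B′ (not-both {p} {q} {r} {s} B)
    through {p} {q} {r} {s} p≢q (balancedʳ B) (balancedˡ B′) = contradiction B (not-both {p} {q} {s} {r} B′)

    open RankThree _≟_ Col Col? swap₁₂ swap₂₃ (degenerate (inj₁ refl)) through public

  firsts seconds : Bool → ∀ k → Vec Point (suc k)
  firsts  b k = tabulate (p₁ b ∘ toℕ)
  seconds b k = tabulate (p₂ b ∘ toℕ)

  chain : Bool → ∀ k → Vec Point (suc k + suc k)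
  chain b k = firsts b k Vec.++ seconds b k

  centres : Vec Point 3
  centres = tabulate p₃

  -- The centres are put with the right chain. This part of the ground set does not depend on `m`,
  -- so sets of its elements can be kept while the left chain changes its length.
  rest : ∀ n → Vec Point (3 + (suc (2 + n) + suc (2 + n)))
  rest n = centres Vec.++ chain true (2 + n)

  points : ∀ m n → Vec Point ((suc (2 + m) + suc (2 + m)) + (3 + (suc (2 + n) + suc (2 + n))))
  points m n = chain false (2 + m) Vec.++ rest n

  chain-All : ∀ {P : Point → Set} b k → (∀ i → i ≤ k → P (p₁ b i)) → (∀ i → i ≤ k → P (p₂ b i)) →
    VecAll.All P (chain b k)
  chain-All b k f g = VecAllₚ.++⁺ {xs = firsts b k} {ys = seconds b k}
    (VecAllₚ.tabulate⁺ λ i → f (toℕ i) (toℕ≤pred[n] i))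
    (VecAllₚ.tabulate⁺ λ i → g (toℕ i) (toℕ≤pred[n] i))

  rest-All : ∀ {P : Point → Set} n → (∀ k → P (p₃ k)) →
    (∀ i → i ≤ 2 + n → P (p₁ true i)) → (∀ i → i ≤ 2 + n → P (p₂ true i)) → VecAll.All P (rest n)
  rest-All n h f g = VecAllₚ.++⁺ {xs = centres} {ys = chain true (2 + n)}
    (VecAllₚ.tabulate⁺ h) (chain-All true (2 + n) f g)

  chain-unique : ∀ b k → VecUnique.Unique (chain b k)
  chain-unique b k = AllPairsₚ.++⁺ {xs = firsts b k} {ys = seconds b k}
    (VecUniqueₚ.tabulate⁺ (toℕ-injective ∘ p₁-injective))
    (VecUniqueₚ.tabulate⁺ (toℕ-injective ∘ p₂-injective))
    (VecAllₚ.tabulate⁺ {f = p₁ b ∘ toℕ} λ _ → VecAllₚ.tabulate⁺ {f = p₂ b ∘ toℕ} λ _ ())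
    where
    p₁-injective : ∀ {i j} → p₁ b i ≡ p₁ b j → i ≡ j
    p₁-injective refl = refl
    p₂-injective : ∀ {i j} → p₂ b i ≡ p₂ b j → i ≡ j
    p₂-injective refl = refl

  rest-unique : ∀ n → VecUnique.Unique (rest n)
  rest-unique n = AllPairsₚ.++⁺ {xs = centres} {ys = chain true (2 + n)}
    (VecUniqueₚ.tabulate⁺ {f = p₃} λ { refl → refl }) (chain-unique true (2 + n))
    (VecAllₚ.tabulate⁺ {f = p₃} λ _ → chain-All true (2 + n) (λ _ _ ()) (λ _ _ ()))

  points-unique : ∀ m n → VecUnique.Unique (points m n)
  points-unique m n = AllPairsₚ.++⁺ {xs = chain false (2 + m)} {ys = rest n}
    (chain-unique false (2 + m)) (rest-unique n)
    (chain-All false (2 + m) (λ _ _ → rest-All n (λ _ ()) (λ _ _ ()) (λ _ _ ()))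
                             (λ _ _ → rest-All n (λ _ ()) (λ _ _ ()) (λ _ _ ())))

  points-All : ∀ {P : Point → Set} m n →
    (∀ i → i ≤ 2 + m → P (p₁ false i)) → (∀ i → i ≤ 2 + m → P (p₂ false i)) →
    (∀ i → i ≤ 2 + n → P (p₁ true i)) → (∀ i → i ≤ 2 + n → P (p₂ true i)) → (∀ k → P (p₃ k)) →
    VecAll.All P (points m n)
  points-All m n f g f′ g′ h = VecAllₚ.++⁺ {xs = chain false (2 + m)} {ys = rest n}
    (chain-All false (2 + m) f g) (rest-All n h f′ g′)

  glued : ∀ m n → Matroid ((suc (2 + m) + suc (2 + m)) + (3 + (suc (2 + n) + suc (2 + n))))
  glued m n = Configuration.matroid m n (points m n) (points-unique m n)

open TwoChains

-- Finitely many colours of the left chain.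

module Colours where

  open import Data.Nat as ℕ using (ℕ; zero; suc; _+_; _*_; _^_)
  open import Data.Nat.Properties using (<-irrefl)
  open import Data.Bool using (Bool; true; false; not)
  open import Data.Fin as Fin using (Fin; zero; suc; funToFin; finToFun; combine)
  open import Data.Fin.Properties using (finToFun-funToFin; combine-injective)
  open import Data.Fin.Subset as Subset using (Subset; _⊆_; ∣_∣)
  open import Data.Fin.Subset.Properties using (anySubset?; _⊆?_; drop-∷-⊆)
  open import Data.Vec as Vec using (Vec; []; _∷_; here; there)
  open import Data.List as List using (List; []; _∷_)
  open import Data.List.Relation.Unary.All using (All; []; _∷_)
  open import Data.List.Relation.Unary.AllPairs using ([]; _∷_)
  open import Data.List.Relation.Unary.Unique.Propositional using (Unique)
  open import Data.Product using (_×_; ∃; _,_; proj₁; proj₂)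
  open import Data.Sum using (inj₁; inj₂)
  open import Function using (_∘_; mk⇔)
  open import Relation.Nullary using (yes; no; ¬_; Dec; does; contradiction)
  open import Relation.Nullary.Decidable using (does-⇔; dec-true)
  open import Relation.Binary.PropositionalEquality as ≡ using (_≡_; _≢_; refl; cong; sym; trans)

  data Left : Point → Set where
    left₁ : ∀ {i} → Left (p₁ false i)
    left₂ : ∀ {i} → Left (p₂ false i)

  data Right : Point → Set where
    right₁ : ∀ {i} → Right (p₁ true i)
    right₂ : ∀ {i} → Right (p₂ true i)
    right₃ : ∀ {k} → Right (p₃ k)

  left≢right : ∀ {p q} → Left p → Right q → p ≢ q
  left≢right left₁ () refl
  left≢right left₂ () refl

  left-unbalanced : ∀ {M p q r} → Left p → ¬ Balanced true M p q r
  left-unbalanced {M} {q = q} {r} left₁ B = <-irrefl refl (gain≤ true M {q = q} {r} B)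
  left-unbalanced {M} {q = q} {r} left₂ B = <-irrefl refl (gain≤ true M {q = q} {r} B)

  right-balanced : ∀ {M p q r} → Right p → Balanced false M p q r → line p ≡ 4
  right-balanced {M} {q = q} {r} right₁ B = contradiction (gain≤ false M {q = q} {r} B) (<-irrefl refl)
  right-balanced {M} {q = q} {r} right₂ B = contradiction (gain≤ false M {q = q} {r} B) (<-irrefl refl)
  right-balanced right₃ B = refl

  right-right-unbalanced : ∀ {M p q r} → Right q → Right r → ¬ Balanced false M p q r
  right-right-unbalanced {M} {p} {q} {r} Rq Rr B = line-⊥ q r p
    (trans (right-balanced {r = p} Rq B′) (sym (right-balanced {r = p} Rr (balanced-swap₁₂ false M B′))))
    (lines-sum B′)
    where
    open Balanced
    B′ : Balanced false M q r p
    B′ = balanced-swap₂₃ false M (balanced-swap₁₂ false M B)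

  -- The length of the right chain enters only through its balanced triples, and those contain no
  -- left point.
  left-collinear : ∀ {m n n′ a q r} → Left a → Collinear m n a q r → Collinear m n′ a q r
  left-collinear La (degenerate d) = degenerate d
  left-collinear La (long l)       = long l
  left-collinear La (balancedˡ B)  = balancedˡ B
  left-collinear La (balancedʳ B)  = contradiction B (left-unbalanced La)

  -- A balanced triple of the left chain has at most one right point, namely a centre; so two right
  -- points rule out any influence of `m`.
  right-collinear : ∀ {m m′ n p q r} → Right q → Right r → Collinear m n p q r → Collinear m′ n p q r
  right-collinear Rq Rr (degenerate d) = degenerate d
  right-collinear Rq Rr (long l)       = long l
  right-collinear Rq Rr (balancedˡ B)  = contradiction B (right-right-unbalanced Rq Rr)
  right-collinear Rq Rr (balancedʳ B)  = balancedʳ B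

  -- To a pair of left points the right points appear in five classes: the points of the right chain
  -- on either line, and each centre by itself. The index 0 just picks a representative.
  probe : Fin 5 → Point
  probe zero                         = p₁ true 0
  probe (suc zero)                   = p₂ true 0
  probe (suc (suc k))                = p₃ k

  probe-of : ∀ {p} → Right p → Fin 5
  probe-of right₁       = zero
  probe-of right₂       = suc zero
  probe-of (right₃ {k}) = suc (suc k)

  probe-collinear : ∀ {m n n′ a b r} → Left a → Left b → (R : Right r) →
    (Collinear m n a b r → Collinear m n′ a b (probe (probe-of R))) ×
    (Collinear m n′ a b (probe (probe-of R)) → Collinear m n a b r)
  probe-collinear {m} {n} {n′} {a} {b} La Lb (right₃ {k}) = left-collinear La , left-collinear La
  probe-collinear {m} {n} {n′} {a} {b} La Lb (right₁ {i}) = move , move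
    where
    move : ∀ {i j n n′} → Collinear m n a b (p₁ true i) → Collinear m n′ a b (p₁ true j)
    move (degenerate (inj₁ a≡b))        = degenerate (inj₁ a≡b)
    move (degenerate (inj₂ (inj₁ b≡r))) = contradiction b≡r (left≢right Lb right₁)
    move (degenerate (inj₂ (inj₂ a≡r))) = contradiction a≡r (left≢right La right₁)
    move (long l)                       = long l
    -- Line and left gain of `p₁ true i` do not involve `i`, so the same proofs serve for
    -- `p₁ true j`.
    move (balancedˡ (l , g))            = balancedˡ (l , g)
    move (balancedʳ B)                  = contradiction B (left-unbalanced La)
  probe-collinear {m} {n} {n′} {a} {b} La Lb (right₂ {i}) = move , move
    where
    move : ∀ {i j n n′} → Collinear m n a b (p₂ true i) → Collinear m n′ a b (p₂ true j)
    move (degenerate (inj₁ a≡b))        = degenerate (inj₁ a≡b)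
    move (degenerate (inj₂ (inj₁ b≡r))) = contradiction b≡r (left≢right Lb right₂)
    move (degenerate (inj₂ (inj₂ a≡r))) = contradiction a≡r (left≢right La right₂)
    move (long l)                       = long l
    move (balancedˡ (l , g))            = balancedˡ (l , g)
    move (balancedʳ B)                  = contradiction B (left-unbalanced La)

  -- No short line contains a left point and two right points. Of a single left point, therefore,
  -- only its long line matters.
  one-left-collinear : ∀ {m n a r s} → Left a → Right r → Right s → r ≢ s → Collinear m n a r s → Long a r s
  one-left-collinear La Rr Rs r≢s (degenerate (inj₁ a≡r))        = contradiction a≡r (left≢right La Rr)
  one-left-collinear La Rr Rs r≢s (degenerate (inj₂ (inj₁ r≡s))) = contradiction r≡s r≢s
  one-left-collinear La Rr Rs r≢s (degenerate (inj₂ (inj₂ a≡s))) = contradiction a≡s (left≢right La Rs)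
  one-left-collinear La Rr Rs r≢s (long l)      = l
  one-left-collinear La Rr Rs r≢s (balancedˡ B) = contradiction B (right-right-unbalanced Rr Rs)
  one-left-collinear La Rr Rs r≢s (balancedʳ B) = contradiction B (left-unbalanced La)

  bit : Bool → Fin 2
  bit true  = suc zero
  bit false = zero

  bit-injective : ∀ {b c} → bit b ≡ bit c → b ≡ c
  bit-injective {true}  {true}  _ = refl
  bit-injective {false} {false} _ = refl

  -- All that the independence of these left points together with some right points can depend on,
  -- besides their number. The parameter 0 for the right chain is a placeholder, justified by
  -- `left-collinear`.
  tests : ℕ → List Point → Fin 5 → Bool
  tests m (a ∷ [])         k = does (line a ℕ.≟ 1)
  tests m (a ∷ b ∷ [])     k = does (Configuration.Col? m 0 a b (probe k))
  tests m (a ∷ b ∷ d ∷ []) k = does (Configuration.Col? m 0 a b d)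
  tests m _                k = false

  truncated-length : List Point → Fin 5
  truncated-length []              = zero
  truncated-length (_ ∷ [])        = suc zero
  truncated-length (_ ∷ _ ∷ [])    = suc (suc zero)
  truncated-length (_ ∷ _ ∷ _ ∷ []) = suc (suc (suc zero))
  truncated-length (_ ∷ _ ∷ _ ∷ _ ∷ _) = suc (suc (suc (suc zero)))

  -- Five truncated lengths and five bits, a bound uniform in `m`. Lists of four or more points are
  -- dependent whatever is added to them, so their lengths need not be told apart.
  shape : ℕ → List Point → Fin (5 * 2 ^ 5)
  shape m l = combine (truncated-length l) (funToFin (bit ∘ tests m l))

  funToFin-injective : ∀ {k} {f g : Fin k → Fin 2} → funToFin f ≡ funToFin g → ∀ i → f i ≡ g i
  funToFin-injective {k} {f} {g} eq i =
    trans (sym (finToFun-funToFin f i)) (trans (cong (λ z → finToFun {2} {k} z i) eq) (finToFun-funToFin g i))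

  line-test : ∀ {a a′} → Left a → Left a′ → does (line a ℕ.≟ 1) ≡ does (line a′ ℕ.≟ 1) → line a ≡ line a′
  line-test left₁ left₁ _ = refl
  line-test left₂ left₂ _ = refl

  module _ {m m′ n : ℕ} where
    private
      module C  = Configuration m n
      module C′ = Configuration m′ n

    independent-shape : ∀ l l′ r → shape m l ≡ shape m′ l′ → All Left l → All Left l′ → All Right r → Unique r →
      C.independent (l List.++ r) ≡ C′.independent (l′ List.++ r)
    independent-shape l l′ r eq = go l l′ r (proj₁ parts) (λ k → bit-injective (funToFin-injective {f = bit ∘ tests m l} {bit ∘ tests m′ l′} (proj₂ parts) k))
      where
      parts = combine-injective (truncated-length l) _ (truncated-length l′) _ eq

      C-≡ : ∀ {p p′ q r} → (C.Col p q r → C′.Col p′ q r) → (C′.Col p′ q r → C.Col p q r) →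
        not (does (C.Col? p q r)) ≡ not (does (C′.Col? p′ q r))
      C-≡ f g = cong not (does-⇔ (mk⇔ f g) (C.Col? _ _ _) (C′.Col? _ _ _))

      go : ∀ l l′ r → truncated-length l ≡ truncated-length l′ → (∀ k → tests m l k ≡ tests m′ l′ k) →
        All Left l → All Left l′ → All Right r → Unique r →
        C.independent (l List.++ r) ≡ C′.independent (l′ List.++ r)
      go [] [] []                  _ _ _ _ _ _ = refl
      go [] [] (_ ∷ [])            _ _ _ _ _ _ = refl
      go [] [] (_ ∷ _ ∷ [])        _ _ _ _ _ _ = refl
      go [] [] (p ∷ _ ∷ _ ∷ [])    _ _ _ _ (_ ∷ Rq ∷ Rr ∷ []) _ = C-≡ {p} {p} (right-collinear Rq Rr) (right-collinear Rq Rr)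
      go [] [] (_ ∷ _ ∷ _ ∷ _ ∷ _) _ _ _ _ _ _ = refl
      go (a ∷ []) (a′ ∷ []) []               _ _ _ _ _ _ = refl
      go (a ∷ []) (a′ ∷ []) (_ ∷ [])         _ _ _ _ _ _ = refl
      go (a ∷ []) (a′ ∷ []) (r ∷ s ∷ [])     _ t (La ∷ []) (La′ ∷ []) (Rr ∷ Rs ∷ []) ((r≢s ∷ []) ∷ _) =
        C-≡ {a} {a′} (λ col → let ar , rs = one-left-collinear La Rr Rs r≢s col in long (trans (sym lines) ar , rs))
            (λ col → let ar , rs = one-left-collinear La′ Rr Rs r≢s col in long (trans lines ar , rs))
        where
        lines : line a ≡ line a′
        lines = line-test La La′ (t zero)
      go (a ∷ []) (a′ ∷ []) (_ ∷ _ ∷ _ ∷ _)  _ _ _ _ _ _ = refl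
      go (a ∷ b ∷ []) (a′ ∷ b′ ∷ []) []          _ _ _ _ _ _ = refl
      go (a ∷ b ∷ []) (a′ ∷ b′ ∷ []) (r ∷ [])    _ t (La ∷ Lb ∷ []) (La′ ∷ Lb′ ∷ []) (Rr ∷ []) _ =
        trans (cong not (does-⇔ (mk⇔ f g) (C.Col? a b r) (Configuration.Col? m 0 a b _)))
        (trans (cong not (t (probe-of Rr)))
        (cong not (does-⇔ (mk⇔ g′ f′) (Configuration.Col? m′ 0 a′ b′ _) (C′.Col? a′ b′ r))))
        where
        f = proj₁ (probe-collinear La Lb Rr)
        g = proj₂ (probe-collinear La Lb Rr)
        f′ = proj₁ (probe-collinear La′ Lb′ Rr)
        g′ = proj₂ (probe-collinear La′ Lb′ Rr)
      go (a ∷ b ∷ []) (a′ ∷ b′ ∷ []) (_ ∷ _ ∷ _) _ _ _ _ _ _ = refl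
      go (a ∷ b ∷ d ∷ []) (a′ ∷ b′ ∷ d′ ∷ []) []      _ t (La ∷ _) (La′ ∷ _) _ _ =
        trans (cong not (does-⇔ (mk⇔ (left-collinear La) (left-collinear La)) (C.Col? a b d) (Configuration.Col? m 0 a b d)))
        (trans (cong not (t zero))
        (cong not (does-⇔ (mk⇔ (left-collinear La′) (left-collinear La′)) (Configuration.Col? m′ 0 a′ b′ d′) (C′.Col? a′ b′ d′))))
      go (a ∷ b ∷ d ∷ []) (a′ ∷ b′ ∷ d′ ∷ []) (_ ∷ _) _ _ _ _ _ _ = refl
      go (_ ∷ _ ∷ _ ∷ _ ∷ _) (_ ∷ _ ∷ _ ∷ _ ∷ _) _ _ _ _ _ _ _ = refl
      go [] (_ ∷ []) _ () _ _ _ _ _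
      go [] (_ ∷ _ ∷ []) _ () _ _ _ _ _
      go [] (_ ∷ _ ∷ _ ∷ []) _ () _ _ _ _ _
      go [] (_ ∷ _ ∷ _ ∷ _ ∷ _) _ () _ _ _ _ _
      go (_ ∷ []) (_ ∷ _ ∷ []) _ () _ _ _ _ _
      go (_ ∷ []) (_ ∷ _ ∷ _ ∷ []) _ () _ _ _ _ _
      go (_ ∷ []) (_ ∷ _ ∷ _ ∷ _ ∷ _) _ () _ _ _ _ _
      go (_ ∷ _ ∷ []) (_ ∷ _ ∷ _ ∷ []) _ () _ _ _ _ _
      go (_ ∷ _ ∷ []) (_ ∷ _ ∷ _ ∷ _ ∷ _) _ () _ _ _ _ _

  ++-⊆⁺ : ∀ {a b} {X X′ : Subset a} {Y Y′ : Subset b} → X ⊆ X′ → Y ⊆ Y′ → (X Vec.++ Y) ⊆ (X′ Vec.++ Y′)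
  ++-⊆⁺ {X = []}    {[]}     X⊆ Y⊆ = Y⊆
  ++-⊆⁺ {X = _ ∷ _} {_ ∷ _}  X⊆ Y⊆ {zero}  here with X⊆ here
  ... | here = here
  ++-⊆⁺ {X = _ ∷ X} {_ ∷ X′} X⊆ Y⊆ {suc i} (there i∈) = there (++-⊆⁺ (drop-∷-⊆ X⊆) Y⊆ i∈)

  ++-⊆⁻ˡ : ∀ {a b} {X X′ : Subset a} {Y Y′ : Subset b} → (X Vec.++ Y) ⊆ (X′ Vec.++ Y′) → X ⊆ X′
  ++-⊆⁻ˡ {X = _ ∷ X} {_ ∷ X′} ⊆′ {zero}  here with ⊆′ here
  ... | here = here
  ++-⊆⁻ˡ {X = _ ∷ X} {_ ∷ X′} ⊆′ {suc i} (there i∈) = there (++-⊆⁻ˡ (drop-∷-⊆ ⊆′) i∈)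

  ++-⊆⁻ʳ : ∀ {a b} (X X′ : Subset a) {Y Y′ : Subset b} → (X Vec.++ Y) ⊆ (X′ Vec.++ Y′) → Y ⊆ Y′
  ++-⊆⁻ʳ []      []       ⊆′ = ⊆′
  ++-⊆⁻ʳ (_ ∷ X) (_ ∷ X′) ⊆′ = ++-⊆⁻ʳ X X′ (drop-∷-⊆ ⊆′)

  ∣++∣ : ∀ {a b} (X : Subset a) (Y : Subset b) → ∣ X Vec.++ Y ∣ ≡ ∣ X ∣ + ∣ Y ∣
  ∣++∣ []          Y = refl
  ∣++∣ (true  ∷ X) Y = cong suc (∣++∣ X Y)
  ∣++∣ (false ∷ X) Y = ∣++∣ X Y

  select-++ : ∀ {ℓ} {A : Set ℓ} {a b} (ps : Vec A a) (qs : Vec A b) X Y →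
    select (ps Vec.++ qs) (X Vec.++ Y) ≡ select ps X List.++ select qs Y
  select-++ []       qs []          Y = refl
  select-++ (p ∷ ps) qs (true  ∷ X) Y = cong (p ∷_) (select-++ ps qs X Y)
  select-++ (p ∷ ps) qs (false ∷ X) Y = select-++ ps qs X Y

  -- `Sing` asks whether the sizes of a left and a right part add up to 1, so all sizes above 1
  -- count alike.
  clip : ℕ → Fin 3
  clip zero          = zero
  clip (suc zero)    = suc zero
  clip (suc (suc _)) = suc (suc zero)

  clip-+ : ∀ a a′ t → clip a ≡ clip a′ → a + t ≡ 1 → a′ + t ≡ 1
  clip-+ zero          zero           t _ eq = eq
  clip-+ (suc zero)    (suc zero)     t _ eq = eq
  clip-+ (suc (suc _)) (suc (suc _))  t _ ()
  clip-+ zero          (suc zero)     t () _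
  clip-+ zero          (suc (suc _))  t () _

  width : ℕ → ℕ
  width m = suc (2 + m) + suc (2 + m)

  colours : Formula → ℕ
  colours (_ ⊆ᶠ _) = 2
  colours (Sing _) = 3
  colours (Indᶠ _) = 5 * 2 ^ 5
  colours (¬ᶠ ψ)   = colours ψ
  colours (ψ ∧ᶠ φ) = colours ψ * colours φ
  colours (∃ᶠ _ ψ) = 2 ^ colours ψ
  colours (∀ᶠ _ ψ) = 2 ^ colours ψ

  -- The type of a left assignment with respect to `ψ`, as in the composition method of Feferman and
  -- Vaught. Under either quantifier it is the set of colours of `ψ` attained by subsets of the left
  -- chain, whence the powers of 2 in `colours`. The number of colours is the same for all `m`.
  colour : ∀ m → Assignment (width m) → ∀ ψ → Fin (colours ψ)
  attained : ∀ m → Assignment (width m) → ℕ → ∀ ψ → Fin (colours ψ) → Bool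

  colour m σ (i ⊆ᶠ j) = bit (does (σ i ⊆? σ j))
  colour m σ (Sing i) = clip ∣ σ i ∣
  colour m σ (Indᶠ i) = shape m (select (chain false (2 + m)) (σ i))
  colour m σ (¬ᶠ ψ)   = colour m σ ψ
  colour m σ (ψ ∧ᶠ φ) = combine (colour m σ ψ) (colour m σ φ)
  colour m σ (∃ᶠ i ψ) = funToFin (bit ∘ attained m σ i ψ)
  colour m σ (∀ᶠ i ψ) = funToFin (bit ∘ attained m σ i ψ)

  attained m σ i ψ k = does (anySubset? λ S → colour m (update σ i S) ψ Fin.≟ k)

  -- The move of a back-and-forth game: the colour reached by `S` on one chain belongs to the common
  -- set of attained colours, so some `S′` on the other chain answers it.
  attained-transfer : ∀ {m m′ σ σ′} i ψ → funToFin (bit ∘ attained m σ i ψ) ≡ funToFin (bit ∘ attained m′ σ′ i ψ) →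
    ∀ S → ∃ λ S′ → colour m (update σ i S) ψ ≡ colour m′ (update σ′ i S′) ψ
  attained-transfer {m} {m′} {σ} {σ′} i ψ eq S = extract (anySubset? λ S′ → colour m′ (update σ′ i S′) ψ Fin.≟ k) (trans
      (sym (bit-injective (funToFin-injective {f = bit ∘ attained m σ i ψ} {bit ∘ attained m′ σ′ i ψ} eq k)))
      (dec-true (anySubset? λ S → colour m (update σ i S) ψ Fin.≟ k) (S , refl)))
    where
    k = colour m (update σ i S) ψ
    extract : (d : Dec (∃ λ S′ → colour m′ (update σ′ i S′) ψ ≡ k)) → does d ≡ true →
      ∃ λ S′ → k ≡ colour m′ (update σ′ i S′) ψ
    extract (yes (S′ , eq)) _ = S′ , sym eq

  Glued : ∀ {a b} → Assignment (a + b) → Assignment a → Assignment b → Set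
  Glued ρ σ τ = ∀ k → ρ k ≡ σ k Vec.++ τ k

  glued-update : ∀ {a b} {ρ : Assignment (a + b)} {σ : Assignment a} {τ : Assignment b} → Glued ρ σ τ → ∀ i S T →
    Glued (update ρ i (S Vec.++ T)) (update σ i S) (update τ i T)
  glued-update glue i S T k with k ℕ.≟ i
  ... | yes _ = refl
  ... | no _  = glue k

  left-part : ∀ m X → All Left (select (chain false (2 + m)) X)
  left-part m X = select-All (chain-All false (2 + m) (λ _ _ → left₁) (λ _ _ → left₂)) X

  right-part : ∀ n Y → All Right (select (rest n) Y)
  right-part n Y = select-All (rest-All n (λ _ → right₃) (λ _ _ → right₁) (λ _ _ → right₂)) Y

  -- Equality of colours is symmetric, so negation is handled by exchanging the two sides. A
  -- quantified set is split into its traces on the left chain and on the rest; the first is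
  -- answered by `attained-transfer`, the second is kept.
  transfer : ∀ {m m′ n} ψ {σ σ′} {τ : Assignment (3 + width n)} {ρ ρ′} → colour m σ ψ ≡ colour m′ σ′ ψ →
    Glued ρ σ τ → Glued ρ′ σ′ τ → Sat (glued m n) ρ ψ → Sat (glued m′ n) ρ′ ψ
  transfer (i ⊆ᶠ j) {σ} {σ′} {τ} {ρ} {ρ′} eq glue glue′ sat =
    ≡.subst₂ _⊆_ (sym (glue′ i)) (sym (glue′ j))
      (++-⊆⁺ (⊆-transfer (σ i ⊆? σ j) (σ′ i ⊆? σ′ j) (bit-injective eq) (++-⊆⁻ˡ sat′)) (++-⊆⁻ʳ (σ i) (σ j) sat′))
    where
    sat′ : (σ i Vec.++ τ i) ⊆ (σ j Vec.++ τ j)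
    sat′ = ≡.subst₂ _⊆_ (glue i) (glue j) sat
    ⊆-transfer : ∀ {p q} {P : Set p} {Q : Set q} (d : Dec P) (e : Dec Q) → does d ≡ does e → P → Q
    ⊆-transfer d       (yes q) _ _ = q
    ⊆-transfer (no ¬p) (no _)  _ p = contradiction p ¬p
  transfer (Sing i) {σ} {σ′} {τ} eq glue glue′ sat =
    trans (trans (cong ∣_∣ (glue′ i)) (∣++∣ (σ′ i) (τ i)))
      (clip-+ (∣ σ i ∣) (∣ σ′ i ∣) (∣ τ i ∣) eq (trans (sym (trans (cong ∣_∣ (glue i)) (∣++∣ (σ i) (τ i)))) sat))
  transfer {m} {m′} {n} (Indᶠ i) {σ} {σ′} {τ} {ρ} {ρ′} eq glue glue′ sat = begin
    C′.independent (select (points m′ n) (ρ′ i))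
      ≡⟨ cong C′.independent (trans (cong (select (points m′ n)) (glue′ i)) (select-++ (chain false (2 + m′)) (rest n) (σ′ i) (τ i))) ⟩
    C′.independent (select (chain false (2 + m′)) (σ′ i) List.++ select (rest n) (τ i))
      ≡⟨ independent-shape (select (chain false (2 + m)) (σ i)) _ _ eq (left-part m (σ i)) (left-part m′ (σ′ i))
           (right-part n (τ i)) (select-unique (rest-unique n) (τ i)) ⟨
    C.independent (select (chain false (2 + m)) (σ i) List.++ select (rest n) (τ i))
      ≡⟨ cong C.independent (trans (cong (select (points m n)) (glue i)) (select-++ (chain false (2 + m)) (rest n) (σ i) (τ i))) ⟨
    C.independent (select (points m n) (ρ i))
      ≡⟨ sat ⟩
    true ∎
    where
    open ≡.≡-Reasoning
    module C  = Configuration m n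
    module C′ = Configuration m′ n
  transfer (¬ᶠ ψ) eq glue glue′ ¬sat sat = ¬sat (transfer ψ (sym eq) glue′ glue sat)
  transfer (ψ ∧ᶠ φ) {σ} {σ′} eq glue glue′ (sat₁ , sat₂) =
    transfer ψ (proj₁ parts) glue glue′ sat₁ , transfer φ (proj₂ parts) glue glue′ sat₂
    where parts = combine-injective (colour _ σ ψ) (colour _ σ φ) (colour _ σ′ ψ) (colour _ σ′ φ) eq
  transfer {m} {m′} {n} (∃ᶠ i ψ) {σ} {σ′} {τ} {ρ} {ρ′} eq glue glue′ (U , sat) with Vec.splitAt (width m) U
  ... | S , T , refl with attained-transfer {σ = σ} {σ′} i ψ eq S
  ... | S′ , eq′ = S′ Vec.++ T ,
    transfer ψ eq′ (glued-update {ρ = ρ} {σ} {τ} glue i S T) (glued-update {ρ = ρ′} {σ′} {τ} glue′ i S′ T) sat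
  transfer {m} {m′} {n} (∀ᶠ i ψ) {σ} {σ′} {τ} {ρ} {ρ′} eq glue glue′ sat U with Vec.splitAt (width m′) U
  ... | S′ , T , refl with attained-transfer {σ = σ′} {σ} i ψ (sym eq) S′
  ... | S , eq′ =
    transfer ψ (sym eq′) (glued-update {ρ = ρ} {σ} {τ} glue i S T) (glued-update {ρ = ρ′} {σ′} {τ} glue′ i S′ T)
      (sat (S Vec.++ T))

  ⊥-++ : ∀ a b → Subset.⊥ {a + b} ≡ Subset.⊥ {a} Vec.++ Subset.⊥ {b}
  ⊥-++ zero    b = refl
  ⊥-++ (suc a) b = cong (false ∷_) (⊥-++ a b)

  satisfies-transfer : ∀ {m m′ n} ψ → colour m (λ _ → Subset.⊥) ψ ≡ colour m′ (λ _ → Subset.⊥) ψ →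
    Satisfies (glued m n) ψ → Satisfies (glued m′ n) ψ
  satisfies-transfer {m} {m′} ψ eq =
    transfer ψ {τ = λ _ → Subset.⊥} eq (λ _ → ⊥-++ (width m) _) (λ _ → ⊥-++ (width m′) _)

open Colours

-- Elements of large multiplicative order in infinite fields.

module PowersInInfiniteFields where

  open import Level using (_⊔_)
  open import Data.Nat as ℕ using (ℕ; zero; suc; _≤_; _<_; _!)
  import Data.Nat.Properties as ℕₚ
  open import Data.Nat.Divisibility using (_∣_; divides; ∣-trans; m∣m*n; m≤n⇒m!∣n!)
  open import Data.Fin using (Fin; zero; suc; toℕ)
  open import Data.Fin.Properties using (toℕ-injective)
  open import Data.Integer using () renaming (+_ to pos)
  open import Data.Product using (Σ; _×_; ∃; _,_)
  open import Function using (_∘_)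
  open import Relation.Nullary using (¬_)
  open import Relation.Binary.Definitions using (tri<; tri≈; tri>)
  open import Relation.Binary.PropositionalEquality as ≡ using (_≡_; _≢_; refl; cong)

  module Roots {c ℓ} (K : Field c ℓ) where
    open Field K hiding (zero; refl; sym; trans; _-_)
    private module K = Field K
    open LinearAlgebra K using (*-cancel-0; difference-0; *-≉0)
    open IntegerCoefficients commutativeRing
    open import Algebra.Properties.Semiring.Exp semiring public
    open import Relation.Binary.Reasoning.Setoid setoid

    -- P is a polynomial function of degree at most d in which xᵈ has coefficient k,
    -- expressed by iterated division by linear factors x − a.
    Polynomial-function : ℕ → Carrier → (Carrier → Carrier) → Set (c ⊔ ℓ)
    Polynomial-function zero    k P = ∀ x → P x ≈ k
    Polynomial-function (suc d) k P = ∀ a → Σ (Carrier → Carrier) λ Q →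
      Polynomial-function d k Q × (∀ x → P x ≈ P a + (x + - a) * Q x)

    polynomial-+ : ∀ d {k k′ P P′} → Polynomial-function d k P → Polynomial-function d k′ P′ →
      Polynomial-function d (k + k′) (λ x → P x + P′ x)
    polynomial-+ zero    f f′   = λ x → +-cong (f x) (f′ x)
    polynomial-+ (suc d) f f′ a with f a | f′ a
    ... | Q , g , eq | Q′ , g′ , eq′ = (λ x → Q x + Q′ x) , polynomial-+ d g g′ ,
      λ x → K.trans (+-cong (eq x) (eq′ x))
        (solve 5 (λ p p′ y q q′ → (p :+ y :* q) :+ (p′ :+ y :* q′) := (p :+ p′) :+ y :* (q :+ q′)) K.refl _ _ _ _ _)

    polynomial-* : ∀ d s {k P} → Polynomial-function d k P → Polynomial-function d (s * k) (λ x → s * P x)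
    polynomial-* zero    s f   = λ x → *-congˡ (f x)
    polynomial-* (suc d) s f a with f a
    ... | Q , g , eq = (λ x → s * Q x) , polynomial-* d s g ,
      λ x → K.trans (*-congˡ (eq x))
        (solve 4 (λ s p y q → s :* (p :+ y :* q) := s :* p :+ y :* (s :* q)) K.refl _ _ _ _)

    polynomial-suc : ∀ d {k P} → Polynomial-function d k P → Polynomial-function (suc d) 0# P
    polynomial-suc zero    f a = (λ _ → 0#) , (λ _ → K.refl) ,
      λ x → K.trans (f x) (K.trans (K.sym (f a)) (K.sym (K.trans (+-congˡ (zeroʳ _)) (+-identityʳ _))))
    polynomial-suc (suc d) f a with f a
    ... | Q , g , eq = Q , polynomial-suc d g , eq

    polynomial-cong : ∀ d {k k′ P} → k ≈ k′ → Polynomial-function d k P → Polynomial-function d k′ P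
    polynomial-cong zero    k≈k′ f   = λ x → K.trans (f x) k≈k′
    polynomial-cong (suc d) k≈k′ f a with f a
    ... | Q , g , eq = Q , polynomial-cong d k≈k′ g , eq

    -- From P(x) = P(a) + (x - a)Q(x) follows xP(x) = aP(a) + (x - a)(P(x) + aQ(x)). The summand aQ
    -- has too low a degree to change the leading coefficient.
    polynomial-x* : ∀ d {k P} → Polynomial-function d k P → Polynomial-function (suc d) k (λ x → x * P x)
    polynomial-x* zero {P = P} f a = P , f , λ x → begin
      x * P x                          ≈⟨ solve 3 (λ x a p → x :* p := a :* p :+ (x :+ :- a) :* p) K.refl x a (P x) ⟩
      a * P x + (x + - a) * P x        ≈⟨ +-congʳ (*-congˡ (K.trans (f x) (K.sym (f a)))) ⟩
      a * P a + (x + - a) * P x        ∎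
    polynomial-x* (suc d) {P = P} f a with f a
    ... | Q , g , eq =
      (λ x → P x + a * Q x)
      , polynomial-cong (suc d) (+-identityʳ _) (polynomial-+ (suc d) f (polynomial-suc d (polynomial-* d a g)))
      , λ x → begin
        x * P x                              ≈⟨ solve 3 (λ x a p → x :* p := a :* p :+ (x :+ :- a) :* p) K.refl x a (P x) ⟩
        a * P x + (x + - a) * P x            ≈⟨ +-congʳ (*-congˡ (eq x)) ⟩
        a * (P a + (x + - a) * Q x) + (x + - a) * P x
          ≈⟨ solve 5 (λ a b y q p → a :* (b :+ y :* q) :+ y :* p := a :* b :+ y :* (p :+ a :* q)) K.refl a (P a) (x + - a) (Q x) (P x) ⟩
        a * P a + (x + - a) * (P x + a * Q x) ∎

    polynomial-^ : ∀ d → Polynomial-function d 1# (_^ d)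
    polynomial-^ zero    = λ _ → K.refl
    polynomial-^ (suc d) = polynomial-x* d (polynomial-^ d)

    -- Dividing off the linear factor of one root keeps the leading coefficient, and the other roots
    -- are roots of the quotient because they differ from the first.
    too-many-roots : ∀ d {k P} → Polynomial-function d k P → ¬ k ≈ 0# → (r : Fin (suc d) → Carrier) →
      (∀ i j → i ≢ j → ¬ r i ≈ r j) → ¬ (∀ i → P (r i) ≈ 0#)
    too-many-roots zero    f k≉0 r distinct roots = k≉0 (K.trans (K.sym (f (r zero))) (roots zero))
    too-many-roots (suc d) {P = P} f k≉0 r distinct roots with f (r zero)
    ... | Q , g , eq = too-many-roots d g k≉0 (r ∘ suc) (λ i j i≢j → distinct (suc i) (suc j) λ { refl → i≢j refl })
      λ i → *-cancel-0 (λ z → distinct (suc i) zero (λ ()) (difference-0 z)) (begin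
        (r (suc i) + - r zero) * Q (r (suc i))                  ≈⟨ K.sym (+-identityˡ _) ⟩
        0# + (r (suc i) + - r zero) * Q (r (suc i))             ≈⟨ +-congʳ (K.sym (roots zero)) ⟩
        P (r zero) + (r (suc i) + - r zero) * Q (r (suc i))     ≈⟨ K.sym (eq (r (suc i))) ⟩
        P (r (suc i))                                           ≈⟨ roots (suc i) ⟩
        0#                                                      ∎)

    -- Not all of `suc d` distinct elements are roots, but without decidable equality none can be
    -- singled out as a nonroot; hence the double negation.
    nonroot : Infinite K → ∀ d {k P} → Polynomial-function d k P → ¬ k ≈ 0# → ¬ ¬ ∃ λ α → ¬ P α ≈ 0#
    nonroot (f , inj) d {P = P} poly k≉0 none =
      ¬¬-∀Fin (suc d) {P = λ i → P (f (toℕ i)) ≈ 0#} (λ i ¬z → none (f (toℕ i) , ¬z))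
        (too-many-roots d poly k≉0 (f ∘ toℕ) λ i j i≢j eq → i≢j (toℕ-injective (inj eq)))

    ^-≉0 : ∀ {α} → ¬ α ≈ 0# → ∀ k → ¬ α ^ k ≈ 0#
    ^-≉0 α≉0 zero    z = 0≉1 (K.sym z)
    ^-≉0 α≉0 (suc k) z = ^-≉0 α≉0 k (*-cancel-0 α≉0 z)

    1^n≈1 : ∀ n → 1# ^ n ≈ 1#
    1^n≈1 zero    = K.refl
    1^n≈1 (suc n) = K.trans (*-identityˡ _) (1^n≈1 n)

    Distinct-powers : ℕ → Carrier → Set ℓ
    Distinct-powers D α = ∀ {i j} → i ≤ D → j ≤ D → i ≢ j → ¬ α ^ i ≈ α ^ j

    -- A non-root of x^(1+D!) − x is nonzero and its multiplicative order exceeds D.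
    distinct-powers : Infinite K → ∀ D → ¬ ¬ ∃ λ α → ¬ α ≈ 0# × Distinct-powers D α
    distinct-powers inf D = do
      α , nonzero ← nonroot inf (suc N) (polynomial-cong (suc N) (+-identityʳ 1#)
        (polynomial-+ (suc N) (polynomial-^ (suc N)) minus-x)) (0≉1 ∘ K.sym)
      return (α , α≉0 nonzero , distinct nonzero)
      where
      N′ = ℕ.pred (D !)
      N = suc N′
      N≡D! : N ≡ D !
      N≡D! = ℕₚ.suc-pred (D !) {{D ℕₚ.!≢0}}
      F : Carrier → Carrier
      F x = x ^ suc N + - 1# * x
      raise : ∀ d e {k P} → Polynomial-function d k P → Polynomial-function (suc e ℕ.+ d) 0# P
      raise d zero    f = polynomial-suc d f
      raise d (suc e) f = polynomial-suc (suc e ℕ.+ d) (raise d e f)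
      minus-x : Polynomial-function (suc N) 0# (λ x → - 1# * x)
      minus-x = ≡.subst (λ d → Polynomial-function (suc d) 0# (λ x → - 1# * x)) (ℕₚ.+-comm N′ 1)
        (raise 1 N′ (polynomial-* 1 (- 1#) (λ a → (λ _ → 1#) , (λ _ → K.refl) ,
          λ x → solve 2 (λ x a → x := a :+ (x :+ :- a) :* con (pos 1)) K.refl x a)))
      module _ {α} (nonzero : ¬ F α ≈ 0#) where
        α≉0 : ¬ α ≈ 0#
        α≉0 z = nonzero (begin
          α * α ^ N + - 1# * α     ≈⟨ +-cong (*-congʳ z) (*-congˡ z) ⟩
          0# * α ^ N + - 1# * 0#   ≈⟨ +-cong (zeroˡ _) (zeroʳ _) ⟩
          0# + 0#                  ≈⟨ +-identityˡ 0# ⟩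
          0#                       ∎)
        order : ∀ k → 1 ≤ k → k ≤ D → ¬ α ^ k ≈ 1#
        order (suc k) _ k≤D αᵏ≈1 with ≡.subst (suc k ∣_) (≡.sym N≡D!) (∣-trans (m∣m*n (k !)) (m≤n⇒m!∣n! k≤D))
        ... | divides q N≡q*k = nonzero (begin
          α * α ^ N + - 1# * α     ≈⟨ +-congʳ (*-congˡ αᴺ≈1) ⟩
          α * 1# + - 1# * α        ≈⟨ solve 1 (λ α → α :* con (pos 1) :+ :- con (pos 1) :* α := con (pos 0)) K.refl α ⟩
          0#                       ∎)
          where
          αᴺ≈1 : α ^ N ≈ 1#
          αᴺ≈1 = begin
            α ^ N                  ≡⟨ cong (α ^_) (≡.trans N≡q*k (ℕₚ.*-comm q (suc k))) ⟩
            α ^ (suc k ℕ.* q)      ≈⟨ K.sym (^-assocʳ α (suc k) q) ⟩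
            (α ^ suc k) ^ q        ≈⟨ ^-congˡ q αᵏ≈1 ⟩
            1# ^ q                 ≈⟨ 1^n≈1 q ⟩
            1#                     ∎
        increasing : ∀ {i j} → i < j → j ≤ D → ¬ α ^ i ≈ α ^ j
        increasing {i} {j} i<j j≤D eq = order (j ℕ.∸ i) (ℕₚ.m<n⇒0<n∸m i<j) (ℕₚ.≤-trans (ℕₚ.m∸n≤m j i) j≤D)
          (difference-0 (*-cancel-0 (^-≉0 α≉0 i) (begin
            α ^ i * (α ^ (j ℕ.∸ i) + - 1#)             ≈⟨ solve 2 (λ a b → a :* (b :+ :- con (pos 1)) := a :* b :+ :- a) K.refl _ _ ⟩
            α ^ i * α ^ (j ℕ.∸ i) + - α ^ i            ≈⟨ +-congʳ (K.sym (^-homo-* α i (j ℕ.∸ i))) ⟩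
            α ^ (i ℕ.+ (j ℕ.∸ i)) + - α ^ i            ≡⟨ cong (λ k → α ^ k + - α ^ i) (ℕₚ.m+[n∸m]≡n (ℕₚ.<⇒≤ i<j)) ⟩
            α ^ j + - α ^ i                            ≈⟨ +-congʳ (K.sym eq) ⟩
            α ^ i + - α ^ i                            ≈⟨ -‿inverseʳ _ ⟩
            0#                                         ∎)))
        distinct : Distinct-powers D α
        distinct {i} {j} i≤D j≤D i≢j eq with ℕₚ.<-cmp i j
        ... | tri< i<j _ _ = increasing i<j j≤D eq
        ... | tri≈ _ i≡j _ = i≢j i≡j
        ... | tri> _ _ j<i = increasing j<i i≤D (K.sym eq)

open PowersInInfiniteFields

-- Determinants of size 3 and linear dependence.

module ThreeDimensions where

  open import Data.Nat using (zero; suc)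
  open import Data.Fin using (Fin; zero; suc)
  open import Data.Integer using () renaming (+_ to pos)
  open import Data.List using ([]; _∷_)
  open import Data.List.Relation.Unary.All using ([]; _∷_)
  open import Data.List.Relation.Unary.AllPairs using ([]; _∷_)
  open import Data.Product using (_×_; _,_; proj₁; proj₂)
  open import Data.Unit.Polymorphic using (tt)
  open import Function using (_∘_)
  open import Relation.Nullary using (¬_)
  open import Relation.Binary.PropositionalEquality using (refl)

  module Determinants {c ℓ} (K : Field c ℓ) where
    open Field K hiding (zero; refl; sym; trans; _-_)
    private module K = Field K
    open LinearAlgebra K
    open IntegerCoefficients commutativeRing
    open import Relation.Binary.Reasoning.Setoid setoid

    Vector : Set c
    Vector = Fin 3 → Carrier

    ⟨_,_,_⟩ : Carrier → Carrier → Carrier → Vector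
    ⟨ a , b , d ⟩ zero             = a
    ⟨ a , b , d ⟩ (suc zero)       = b
    ⟨ a , b , d ⟩ (suc (suc zero)) = d

    determinant : (a b c d e f g h i : Carrier) → Carrier
    determinant a b c d e f g h i =
      a * (e * i + - (f * h)) + - (b * (d * i + - (f * g))) + c * (d * h + - (e * g))

    :determinant : ∀ {n} (a b c d e f g h i : Polynomial n) → Polynomial n
    :determinant a b c d e f g h i =
      a :* (e :* i :+ :- (f :* h)) :+ :- (b :* (d :* i :+ :- (f :* g))) :+ c :* (d :* h :+ :- (e :* g))

    det : Vector → Vector → Vector → Carrier
    det u v w = determinant (u zero) (u (suc zero)) (u (suc (suc zero)))
                            (v zero) (v (suc zero)) (v (suc (suc zero)))
                            (w zero) (w (suc zero)) (w (suc (suc zero)))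

    det-swap₁₂ : ∀ u v w → det u v w ≈ - det v u w
    det-swap₁₂ u v w = solve 9 (λ a b c d e f g h i →
      :determinant a b c d e f g h i := :- :determinant d e f a b c g h i) K.refl _ _ _ _ _ _ _ _ _

    det-swap₂₃ : ∀ u v w → det u v w ≈ - det u w v
    det-swap₂₃ u v w = solve 9 (λ a b c d e f g h i →
      :determinant a b c d e f g h i := :- :determinant a b c g h i d e f) K.refl _ _ _ _ _ _ _ _ _

    -- The Laplace expansion along the first column of the 4 by 4 determinant with rows `t`, `u`,
    -- `v`, `w`, each preceded by a copy of its coordinate `j`. It vanishes as a column is repeated.
    cramer : ∀ t u v w j →
      t j * det u v w + (- (u j) * det t v w + (v j * det t u w + - (w j) * det t u v)) ≈ 0#
    cramer t u v w zero = solve 12 (λ p q r a b c d e f g h i →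
      p :* :determinant a b c d e f g h i :+ (:- a :* :determinant p q r d e f g h i :+
      (d :* :determinant p q r a b c g h i :+ :- g :* :determinant p q r a b c d e f)) := con (pos 0)) K.refl
      _ _ _ _ _ _ _ _ _ _ _ _
    cramer t u v w (suc zero) = solve 12 (λ p q r a b c d e f g h i →
      q :* :determinant a b c d e f g h i :+ (:- b :* :determinant p q r d e f g h i :+
      (e :* :determinant p q r a b c g h i :+ :- h :* :determinant p q r a b c d e f)) := con (pos 0)) K.refl
      _ _ _ _ _ _ _ _ _ _ _ _
    cramer t u v w (suc (suc zero)) = solve 12 (λ p q r a b c d e f g h i →
      r :* :determinant a b c d e f g h i :+ (:- c :* :determinant p q r d e f g h i :+
      (f :* :determinant p q r a b c g h i :+ :- i :* :determinant p q r a b c d e f)) := con (pos 0)) K.refl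
      _ _ _ _ _ _ _ _ _ _ _ _

    -‿≉0 : ∀ {x} → ¬ x ≈ 0# → ¬ - x ≈ 0#
    -‿≉0 {x} x≉0 z = x≉0 (begin
      x          ≈⟨ solve 1 (λ x → x := :- (:- x)) K.refl x ⟩
      - (- x)    ≈⟨ -‿cong z ⟩
      - 0#       ≈⟨ solve 0 (:- con (pos 0) := con (pos 0)) K.refl ⟩
      0#         ∎)

    -‿≈0 : ∀ {x} → x ≈ 0# → - x ≈ 0#
    -‿≈0 z = K.trans (-‿cong z) (solve 0 (:- con (pos 0) := con (pos 0)) K.refl)

    difference-≉0 : ∀ {x y} → ¬ x ≈ y → ¬ x + - y ≈ 0#
    difference-≉0 x≉y z = x≉y (difference-0 z)

    det-swap₁₂-0 : ∀ u v w → det u v w ≈ 0# → det v u w ≈ 0#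
    det-swap₁₂-0 u v w z = K.trans (det-swap₁₂ v u w) (-‿≈0 z)

    det-swap₂₃-0 : ∀ u v w → det u v w ≈ 0# → det u w v ≈ 0#
    det-swap₂₃-0 u v w z = K.trans (det-swap₂₃ u w v) (-‿≈0 z)

    -- Scaling the first row by `α` and adding multiples of the other two to it gives the
    -- determinant on the left, and that row is zero.
    scale-det : ∀ u v w α β γ → (∀ j → α * u j + (β * v j + (γ * w j + 0#)) ≈ 0#) → α * det u v w ≈ 0#
    scale-det u v w α β γ van = begin
      α * det u v w
        ≈⟨ solve 12 (λ α β γ a b c d e f g h i →
             α :* :determinant a b c d e f g h i :=
             :determinant (α :* a :+ (β :* d :+ (γ :* g :+ con (pos 0))))
                          (α :* b :+ (β :* e :+ (γ :* h :+ con (pos 0))))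
                          (α :* c :+ (β :* f :+ (γ :* i :+ con (pos 0)))) d e f g h i)
             K.refl _ _ _ _ _ _ _ _ _ _ _ _ ⟩
      det ⟨ sum zero , sum (suc zero) , sum (suc (suc zero)) ⟩ v w
        ≈⟨ +-cong (+-cong (*-congʳ (van zero)) (-‿cong (*-congʳ (van (suc zero))))) (*-congʳ (van (suc (suc zero)))) ⟩
      det ⟨ 0# , 0# , 0# ⟩ v w
        ≈⟨ solve 6 (λ d e f g h i → :determinant (con (pos 0)) (con (pos 0)) (con (pos 0)) d e f g h i := con (pos 0))
             K.refl _ _ _ _ _ _ ⟩
      0# ∎
      where
      sum : Vector
      sum j = α * u j + (β * v j + (γ * w j + 0#))

    zero-coefficients : ∀ u v w → ¬ det u v w ≈ 0# → ∀ α β γ →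
      (∀ j → α * u j + (β * v j + (γ * w j + 0#)) ≈ 0#) → α ≈ 0# × β ≈ 0# × γ ≈ 0#
    zero-coefficients u v w nz α β γ van =
      zero-coefficient nz (scale-det u v w α β γ van)
      , zero-coefficient (nz ∘ det-swap₁₂-0 v u w)
          (scale-det v u w β α γ λ j → K.trans
            (solve 3 (λ x y z → y :+ (x :+ (z :+ con (pos 0))) := x :+ (y :+ (z :+ con (pos 0)))) K.refl _ _ _) (van j))
      , zero-coefficient (nz ∘ det-swap₂₃-0 u w v ∘ det-swap₁₂-0 w u v)
          (scale-det w u v γ α β λ j → K.trans
            (solve 3 (λ x y z → z :+ (x :+ (y :+ con (pos 0))) := x :+ (y :+ (z :+ con (pos 0)))) K.refl _ _ _) (van j))
      where
      zero-coefficient : ∀ {x y} → ¬ y ≈ 0# → x * y ≈ 0# → x ≈ 0#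
      zero-coefficient y≉0 xy≈0 = *-cancel-0 y≉0 (K.trans (*-comm _ _) xy≈0)

    module _ {A : Set} (V : A → Vector) where

      independent-triple : ∀ {p q r} → ¬ det (V p) (V q) (V r) ≈ 0# → Independent V (p ∷ q ∷ r ∷ [])
      independent-triple {p} {q} {r} nz (α ∷ β ∷ γ ∷ []) van =
        let α≈0 , β≈0 , γ≈0 = zero-coefficients (V p) (V q) (V r) nz α β γ van in α≈0 , β≈0 , γ≈0 , tt

      independent-pair : ∀ {p q} u → ¬ det (V p) (V q) u ≈ 0# → Independent V (p ∷ q ∷ [])
      independent-pair {p} {q} u nz (α ∷ β ∷ []) van =
        let α≈0 , β≈0 , _ = zero-coefficients (V p) (V q) u nz α β 0# (λ j → K.trans
              (solve 3 (λ x y z → x :+ (y :+ (con (pos 0) :* z :+ con (pos 0))) := x :+ (y :+ con (pos 0))) K.refl _ _ _) (van j))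
        in α≈0 , β≈0 , tt

      -- In the `cramer` relation of `V p`, `V q`, `V r` and `u` the term with `u` drops out, and
      -- the coefficient left to `V r` is the nonzero determinant.
      dependent-triple : ∀ {p q r l} u → ¬ det (V p) (V q) u ≈ 0# → det (V p) (V q) (V r) ≈ 0# →
        ¬ Independent V (p ∷ q ∷ r ∷ l)
      dependent-triple {p} {q} {r} {l} u nz z indep = nz (proj₁ (proj₂ (proj₂ (indep
        (det (V q) (V r) u ∷ - det (V p) (V r) u ∷ det (V p) (V q) u ∷ zeros l) λ j → begin
          det (V q) (V r) u * V p j + (- det (V p) (V r) u * V q j + (det (V p) (V q) u * V r j + combination V (zeros l) j))
            ≈⟨ +-congˡ (+-congˡ (+-congˡ (combination-zeros V l j))) ⟩
          det (V q) (V r) u * V p j + (- det (V p) (V r) u * V q j + (det (V p) (V q) u * V r j + 0#))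
            ≈⟨ solve 8 (λ x p y q z r t u →
                 x :* p :+ (:- y :* q :+ (z :* r :+ con (pos 0))) :=
                 p :* x :+ (:- q :* y :+ (r :* z :+ :- u :* t)) :+ u :* t) K.refl _ _ _ _ _ _ (det (V p) (V q) (V r)) (u j) ⟩
          V p j * det (V q) (V r) u + (- V q j * det (V p) (V r) u + (V r j * det (V p) (V q) u + - u j * det (V p) (V q) (V r)))
            + u j * det (V p) (V q) (V r)
            ≈⟨ +-cong (cramer (V p) (V q) (V r) u j) (*-congˡ z) ⟩
          0# + u j * 0#
            ≈⟨ solve 1 (λ u → con (pos 0) :+ u :* con (pos 0) := con (pos 0)) K.refl _ ⟩
          0# ∎))))

      -- Up to sign this is the coefficient of `V s` in the `cramer` relation. Applied to a nonzero
      -- determinant, it shows that four or more vectors cannot be independent.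
      dependent-quadruple : ∀ {p q r s l} → Independent V (p ∷ q ∷ r ∷ s ∷ l) → det (V p) (V q) (V r) ≈ 0#
      dependent-quadruple {p} {q} {r} {s} {l} indep = begin
        det (V p) (V q) (V r)           ≈⟨ solve 1 (λ x → x := :- (:- x)) K.refl _ ⟩
        - - det (V p) (V q) (V r)       ≈⟨ -‿≈0 (proj₁ (proj₂ (proj₂ (proj₂ (indep
          (det (V q) (V r) (V s) ∷ - det (V p) (V r) (V s) ∷ det (V p) (V q) (V s) ∷ - det (V p) (V q) (V r) ∷ zeros l) λ j →
            K.trans (+-congˡ (+-congˡ (+-congˡ (+-congˡ (combination-zeros V l j))))) (K.trans
              (solve 8 (λ x p y q z r t s →
                 x :* p :+ (:- y :* q :+ (z :* r :+ (:- t :* s :+ con (pos 0)))) :=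
                 p :* x :+ (:- q :* y :+ (r :* z :+ :- s :* t))) K.refl _ _ _ _ _ _ _ _)
              (cramer (V p) (V q) (V r) (V s) j))))))) ⟩
        0#                              ∎

open ThreeDimensions

-- Representation of two chains of equal length.

module EqualLengths where

  open import Data.Nat as ℕ using (ℕ; zero; suc; _≤_; z≤n; s≤s)
  import Data.Nat.Properties as ℕₚ
  open import Data.Bool using (Bool; true; false)
  import Data.Bool as Bool
  open import Data.Fin using (zero; suc)
  open import Data.Integer using () renaming (+_ to pos)
  open import Data.List using ([]; _∷_)
  open import Data.List.Relation.Unary.All using (All; []; _∷_)
  open import Data.List.Relation.Unary.AllPairs using ([]; _∷_)
  open import Data.List.Relation.Unary.Unique.Propositional using (Unique)
  open import Data.Vec using (lookup)
  open import Data.Product using (_×_; ∃; _,_)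
  open import Data.Sum using (_⊎_; inj₁; inj₂)
  open import Data.Unit using (⊤)
  import Data.Unit.Polymorphic as Poly
  open import Function using (_∘_)
  open import Relation.Nullary using (yes; no; ¬_; contradiction)
  open import Relation.Nullary.Decidable using (_×-dec_)
  open import Relation.Binary.PropositionalEquality as ≡ using (_≡_; _≢_; refl; cong)

  module Representation {c ℓ} (K : Field c ℓ) (n : ℕ) where
    open Field K hiding (zero; refl; sym; trans; _-_)
    private module K = Field K
    open LinearAlgebra K
    open Determinants K
    open Roots K
    open IntegerCoefficients commutativeRing
    open import Relation.Binary.Reasoning.Setoid setoid
    open Configuration n n

    -- `B` bounds every sum `i + j + exponent M k`, the largest exponent compared within one chain.
    -- Shifting the right chain by `suc B` puts its exponents beyond those of the left one, and all
    -- stay within `suc B + B`, the range in which powers of α are distinct.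
    M B : ℕ
    M = 2 ℕ.+ n
    B = M ℕ.+ M ℕ.+ M

    offset : Bool → ℕ
    offset false = 0
    offset true  = suc B

    offset-injective : ∀ b d {i j} → i ≤ B → j ≤ B → offset b ℕ.+ i ≡ offset d ℕ.+ j → b ≡ d × i ≡ j
    offset-injective false false i≤ j≤ eq = refl , eq
    offset-injective true  true  i≤ j≤ eq = refl , ℕₚ.+-cancelˡ-≡ (suc B) _ _ eq
    offset-injective false true  i≤ j≤ refl = contradiction i≤ (ℕₚ.<⇒≱ (s≤s (ℕₚ.m≤m+n B _)))
    offset-injective true  false i≤ j≤ refl = contradiction j≤ (ℕₚ.<⇒≱ (s≤s (ℕₚ.m≤m+n B _)))

    offset-bound : ∀ b {i} → i ≤ B → offset b ℕ.+ i ≤ suc B ℕ.+ B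
    offset-bound false i≤ = ℕₚ.≤-trans i≤ (ℕₚ.m≤n+m B (suc B))
    offset-bound true  i≤ = ℕₚ.+-monoʳ-≤ (suc B) i≤

    Bounded : Point → Set
    Bounded (p₁ _ i) = i ≤ M
    Bounded (p₂ _ i) = i ≤ M
    Bounded (p₃ _)   = ⊤

    exponent≤ : ∀ k → exponent M k ≤ M
    exponent≤ zero             = z≤n
    exponent≤ (suc zero)       = s≤s z≤n
    exponent≤ (suc (suc zero)) = ℕₚ.≤-refl

    ≤B : ∀ {i} → i ≤ M → i ≤ B
    ≤B i≤ = ℕₚ.≤-trans i≤ (ℕₚ.m≤n+m M (M ℕ.+ M))

    +≤B : ∀ {i} → i ≤ M → M ℕ.+ i ≤ B
    +≤B i≤ = ℕₚ.+-mono-≤ (ℕₚ.m≤m+n M M) i≤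

    module _ {α} (α≉0 : ¬ α ≈ 0#) (distinct : Distinct-powers (suc B ℕ.+ B) α) where

      vector : Point → Vector
      vector (p₁ b i) = ⟨ 1# , α ^ (offset b ℕ.+ i) , 0# ⟩
      vector (p₂ b j) = ⟨ α ^ j , 0# , α ^ (offset b ℕ.+ M) ⟩
      vector (p₃ k)   = ⟨ 0# , 1# , - α ^ exponent M k ⟩

      D : Point → Point → Point → Carrier
      D p q r = det (vector p) (vector q) (vector r)

      nz : ∀ k → ¬ α ^ k ≈ 0#
      nz = ^-≉0 α≉0

      differ : ∀ b d {i j} → i ≤ B → j ≤ B → (b ≡ d → i ≢ j) → ¬ α ^ (offset b ℕ.+ i) ≈ α ^ (offset d ℕ.+ j)
      differ b d i≤ j≤ apart = distinct (offset-bound b i≤) (offset-bound d j≤) λ eq →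
        let b≡d , i≡j = offset-injective b d i≤ j≤ eq in apart b≡d i≡j

      differ₁ : ∀ {b i d j} → i ≤ M → j ≤ M → p₁ b i ≢ p₁ d j → ¬ α ^ (offset b ℕ.+ i) ≈ α ^ (offset d ℕ.+ j)
      differ₁ {b} {d = d} i≤ j≤ p≢q = differ b d (≤B i≤) (≤B j≤) λ { refl refl → p≢q refl }

      -- The two sides are the products of the minor of two vectors on the second line, so that they
      -- are not proportional.
      differ₂ : ∀ {b i d j} → i ≤ M → j ≤ M → p₂ b i ≢ p₂ d j →
        ¬ α ^ (offset b ℕ.+ M) * α ^ j ≈ α ^ (offset d ℕ.+ M) * α ^ i
      differ₂ {b} {i} {d} {j} i≤ j≤ p≢q eq = differ b d (+≤B j≤) (+≤B i≤)
        (λ { refl e → p≢q (cong (p₂ b) (≡.sym (ℕₚ.+-cancelˡ-≡ M _ _ e))) })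
        (begin
          α ^ (offset b ℕ.+ (M ℕ.+ j))    ≡⟨ cong (α ^_) (≡.sym (ℕₚ.+-assoc (offset b) M j)) ⟩
          α ^ (offset b ℕ.+ M ℕ.+ j)      ≈⟨ ^-homo-* α (offset b ℕ.+ M) j ⟩
          α ^ (offset b ℕ.+ M) * α ^ j    ≈⟨ eq ⟩
          α ^ (offset d ℕ.+ M) * α ^ i    ≈⟨ K.sym (^-homo-* α (offset d ℕ.+ M) i) ⟩
          α ^ (offset d ℕ.+ M ℕ.+ i)      ≡⟨ cong (α ^_) (ℕₚ.+-assoc (offset d) M i) ⟩
          α ^ (offset d ℕ.+ (M ℕ.+ i))    ∎)

      differ₃ : ∀ {k l} → p₃ k ≢ p₃ l → ¬ α ^ exponent M k ≈ α ^ exponent M l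
      differ₃ {k} {l} p≢q = differ false false (≤B (exponent≤ k)) (≤B (exponent≤ l))
        λ _ e → p≢q (cong p₃ (exponent-injective n e))

      -- Collinearity is decidable, so settling it together with the determinant yields both halves
      -- of faithfulness without deciding any equality in the field.
      Verdict : Point → Point → Point → Set ℓ
      Verdict p q r = (Col p q r × D p q r ≈ 0#) ⊎ (¬ Col p q r × ¬ D p q r ≈ 0#)

      verdict-swap₁₂ : ∀ p q r → Verdict q p r → Verdict p q r
      verdict-swap₁₂ p q r (inj₁ (col , z))  = inj₁ (swap₁₂ col , det-swap₁₂-0 (vector q) (vector p) (vector r) z)
      verdict-swap₁₂ p q r (inj₂ (¬col , ≉)) = inj₂ (¬col ∘ swap₁₂ , ≉ ∘ det-swap₁₂-0 (vector p) (vector q) (vector r))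

      verdict-swap₂₃ : ∀ p q r → Verdict p r q → Verdict p q r
      verdict-swap₂₃ p q r (inj₁ (col , z))  = inj₁ (swap₂₃ col , det-swap₂₃-0 (vector p) (vector r) (vector q) z)
      verdict-swap₂₃ p q r (inj₂ (¬col , ≉)) = inj₂ (¬col ∘ swap₂₃ , ≉ ∘ det-swap₂₃-0 (vector p) (vector q) (vector r))

      :1 :0 : ∀ {k} → Polynomial k
      :1 = con (pos 1)
      :0 = con (pos 0)

      verdict₁₁₁ : ∀ b i b′ i′ b″ i″ → Verdict (p₁ b i) (p₁ b′ i′) (p₁ b″ i″)
      verdict₁₁₁ _ _ _ _ _ _ = inj₁ (long (refl , refl) ,
        solve 3 (λ s t u → :determinant :1 s :0 :1 t :0 :1 u :0 := :0) K.refl _ _ _)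

      verdict₂₂₂ : ∀ b i b′ i′ b″ i″ → Verdict (p₂ b i) (p₂ b′ i′) (p₂ b″ i″)
      verdict₂₂₂ _ _ _ _ _ _ = inj₁ (long (refl , refl) ,
        solve 6 (λ s t u x y z → :determinant s :0 x t :0 y u :0 z := :0) K.refl _ _ _ _ _ _)

      verdict₃₃₃ : ∀ k l m → Verdict (p₃ k) (p₃ l) (p₃ m)
      verdict₃₃₃ _ _ _ = inj₁ (long (refl , refl) ,
        solve 3 (λ s t u → :determinant :0 :1 s :0 :1 t :0 :1 u := :0) K.refl _ _ _)

      verdict₁₁₂ : ∀ b i b′ i′ d j → i ≤ M → i′ ≤ M → p₁ b i ≢ p₁ b′ i′ → Verdict (p₁ b i) (p₁ b′ i′) (p₂ d j)
      verdict₁₁₂ b i b′ i′ d j i≤ i′≤ p≢q = inj₂ (not-collinear p≢q (λ ()) (λ ()) (λ ()) (λ ()) , λ z →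
        *-≉0 (nz (offset d ℕ.+ M)) (difference-≉0 (differ₁ i≤ i′≤ p≢q ∘ K.sym)) (K.trans (K.sym
          (solve 4 (λ s t z w → :determinant :1 s :0 :1 t :0 z :0 w := w :* (t :+ :- s)) K.refl _ _ (α ^ j) _)) z))

      verdict₁₁₃ : ∀ b i b′ i′ k → i ≤ M → i′ ≤ M → p₁ b i ≢ p₁ b′ i′ → Verdict (p₁ b i) (p₁ b′ i′) (p₃ k)
      verdict₁₁₃ b i b′ i′ k i≤ i′≤ p≢q = inj₂ (not-collinear p≢q (λ ()) (λ ()) (λ ()) (λ ()) , λ z →
        *-≉0 (nz (exponent M k)) (difference-≉0 (differ₁ i≤ i′≤ p≢q)) (K.trans (K.sym
          (solve 3 (λ s t a → :determinant :1 s :0 :1 t :0 :0 :1 (:- a) := a :* (s :+ :- t)) K.refl _ _ _)) z))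

      verdict₂₂₁ : ∀ b i b′ i′ d j → i ≤ M → i′ ≤ M → p₂ b i ≢ p₂ b′ i′ → Verdict (p₂ b i) (p₂ b′ i′) (p₁ d j)
      verdict₂₂₁ b i b′ i′ d j i≤ i′≤ p≢q = inj₂ (not-collinear p≢q (λ ()) (λ ()) (λ ()) (λ ()) , λ z →
        *-≉0 (nz (offset d ℕ.+ j)) (difference-≉0 (differ₂ i≤ i′≤ p≢q)) (K.trans (K.sym
          (solve 5 (λ z w z′ w′ s → :determinant z :0 w z′ :0 w′ :1 s :0 := s :* (w :* z′ :+ :- (w′ :* z))) K.refl _ _ _ _ _)) z))

      verdict₂₂₃ : ∀ b i b′ i′ k → i ≤ M → i′ ≤ M → p₂ b i ≢ p₂ b′ i′ → Verdict (p₂ b i) (p₂ b′ i′) (p₃ k)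
      verdict₂₂₃ b i b′ i′ k i≤ i′≤ p≢q = inj₂ (not-collinear p≢q (λ ()) (λ ()) (λ ()) (λ ()) , λ z →
        difference-≉0 (differ₂ i≤ i′≤ p≢q) (K.trans (K.sym
          (solve 5 (λ z w z′ w′ a → :determinant z :0 w z′ :0 w′ :0 :1 a := w :* z′ :+ :- (w′ :* z)) K.refl _ _ _ _ _)) z))

      verdict₃₃₁ : ∀ k l d j → p₃ k ≢ p₃ l → Verdict (p₃ k) (p₃ l) (p₁ d j)
      verdict₃₃₁ k l d j p≢q = inj₂ (not-collinear p≢q (λ ()) (λ ()) (λ ()) (λ ()) , λ z →
        difference-≉0 (differ₃ p≢q) (K.trans (K.sym
          (solve 3 (λ a b s → :determinant :0 :1 (:- a) :0 :1 (:- b) :1 s :0 := a :+ :- b) K.refl _ _ (α ^ (offset d ℕ.+ j)))) z))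

      verdict₃₃₂ : ∀ k l d j → p₃ k ≢ p₃ l → Verdict (p₃ k) (p₃ l) (p₂ d j)
      verdict₃₃₂ k l d j p≢q = inj₂ (not-collinear p≢q (λ ()) (λ ()) (λ ()) (λ ()) , λ z →
        *-≉0 (nz j) (difference-≉0 (differ₃ p≢q)) (K.trans (K.sym
          (solve 4 (λ a b z w → :determinant :0 :1 (:- a) :0 :1 (:- b) z :0 w := z :* (a :+ :- b)) K.refl _ _ _ (α ^ (offset d ℕ.+ M)))) z))

      collinear-gains : ∀ b i d j k → Col (p₁ b i) (p₂ d j) (p₃ k) → b ≡ d × i ℕ.+ j ℕ.+ exponent M k ≡ M
      collinear-gains false i false j k (balancedˡ (_ , g)) = refl , g
      collinear-gains true  i true  j k (balancedʳ (_ , g)) = refl , g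
      collinear-gains true  i d     j k (balancedˡ g) = contradiction (gain≤ false M g) (ℕₚ.<-irrefl refl)
      collinear-gains false i d     j k (balancedʳ g) = contradiction (gain≤ true M g) (ℕₚ.<-irrefl refl)
      collinear-gains b     i true  j k (balancedˡ g) = contradiction (gain≤ false M (balanced-swap₁₂ false M g)) (ℕₚ.<-irrefl refl)
      collinear-gains b     i false j k (balancedʳ g) = contradiction (gain≤ true M (balanced-swap₁₂ true M g)) (ℕₚ.<-irrefl refl)
      collinear-gains b     i d     j k (degenerate (inj₁ ()))
      collinear-gains b     i d     j k (degenerate (inj₂ (inj₁ ())))
      collinear-gains b     i d     j k (degenerate (inj₂ (inj₂ ())))
      collinear-gains b     i d     j k (long (() , _))

      gains-collinear : ∀ b i j k → i ℕ.+ j ℕ.+ exponent M k ≡ M → Col (p₁ b i) (p₂ b j) (p₃ k)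
      gains-collinear false = balanced-collinear false
      gains-collinear true  = balanced-collinear true

      -- A difference of two powers of α, so it vanishes exactly when the exponents agree. By the
      -- choice of `offset` this means `b ≡ d` together with the balance of gains.
      D₁₂₃ : ∀ b i d j k → D (p₁ b i) (p₂ d j) (p₃ k) ≈
        α ^ (offset b ℕ.+ (i ℕ.+ j ℕ.+ exponent M k)) + - α ^ (offset d ℕ.+ M)
      D₁₂₃ b i d j k = begin
        D (p₁ b i) (p₂ d j) (p₃ k)
          ≈⟨ solve 4 (λ s z w a → :determinant :1 s :0 z :0 w :0 :1 (:- a) := s :* z :* a :+ :- w) K.refl _ _ _ _ ⟩
        α ^ (offset b ℕ.+ i) * α ^ j * α ^ exponent M k + - α ^ (offset d ℕ.+ M)
          ≈⟨ +-congʳ (*-congʳ (K.sym (^-homo-* α (offset b ℕ.+ i) j))) ⟩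
        α ^ (offset b ℕ.+ i ℕ.+ j) * α ^ exponent M k + - α ^ (offset d ℕ.+ M)
          ≈⟨ +-congʳ (K.sym (^-homo-* α (offset b ℕ.+ i ℕ.+ j) (exponent M k))) ⟩
        α ^ (offset b ℕ.+ i ℕ.+ j ℕ.+ exponent M k) + - α ^ (offset d ℕ.+ M)
          ≡⟨ cong (λ e → α ^ e + - α ^ (offset d ℕ.+ M))
               (≡.trans (cong (ℕ._+ exponent M k) (ℕₚ.+-assoc (offset b) i j)) (ℕₚ.+-assoc (offset b) (i ℕ.+ j) (exponent M k))) ⟩
        α ^ (offset b ℕ.+ (i ℕ.+ j ℕ.+ exponent M k)) + - α ^ (offset d ℕ.+ M) ∎

      verdict₁₂₃ : ∀ b i d j k → i ≤ M → j ≤ M → Verdict (p₁ b i) (p₂ d j) (p₃ k)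
      verdict₁₂₃ b i d j k i≤ j≤ with b Bool.≟ d ×-dec i ℕ.+ j ℕ.+ exponent M k ℕ.≟ M
      ... | yes (refl , g) = inj₁ (gains-collinear b i j k g , (begin
        D (p₁ b i) (p₂ b j) (p₃ k)                  ≈⟨ D₁₂₃ b i b j k ⟩
        α ^ (offset b ℕ.+ (i ℕ.+ j ℕ.+ exponent M k)) + - α ^ (offset b ℕ.+ M)
                                                    ≡⟨ cong (λ e → α ^ (offset b ℕ.+ e) + - α ^ (offset b ℕ.+ M)) g ⟩
        α ^ (offset b ℕ.+ M) + - α ^ (offset b ℕ.+ M)   ≈⟨ -‿inverseʳ _ ⟩
        0#                                          ∎))
      ... | no ¬g = inj₂ (¬g ∘ collinear-gains b i d j k , λ z →
        difference-≉0 (differ b d (ℕₚ.+-mono-≤ (ℕₚ.+-mono-≤ i≤ j≤) (exponent≤ k)) (≤B ℕₚ.≤-refl) λ b≡d e → ¬g (b≡d , e))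
          (K.trans (K.sym (D₁₂₃ b i d j k)) z))

      verdict : ∀ p q r → Bounded p → Bounded q → Bounded r → p ≢ q → p ≢ r → q ≢ r → Verdict p q r
      verdict p@(p₁ _ _) q@(p₁ _ _) r@(p₁ _ _) vp vq vr pq pr qr = verdict₁₁₁ _ _ _ _ _ _
      verdict p@(p₂ _ _) q@(p₂ _ _) r@(p₂ _ _) vp vq vr pq pr qr = verdict₂₂₂ _ _ _ _ _ _
      verdict p@(p₃ _)   q@(p₃ _)   r@(p₃ _)   vp vq vr pq pr qr = verdict₃₃₃ _ _ _
      verdict p@(p₁ _ _) q@(p₁ _ _) r@(p₂ _ _) vp vq vr pq pr qr = verdict₁₁₂ _ _ _ _ _ _ vp vq pq
      verdict p@(p₁ _ _) q@(p₂ _ _) r@(p₁ _ _) vp vq vr pq pr qr =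
        verdict-swap₂₃ p q r (verdict₁₁₂ _ _ _ _ _ _ vp vr pr)
      verdict p@(p₂ _ _) q@(p₁ _ _) r@(p₁ _ _) vp vq vr pq pr qr =
        verdict-swap₁₂ p q r (verdict-swap₂₃ q p r (verdict₁₁₂ _ _ _ _ _ _ vq vr qr))
      verdict p@(p₁ _ _) q@(p₁ _ _) r@(p₃ _)   vp vq vr pq pr qr = verdict₁₁₃ _ _ _ _ _ vp vq pq
      verdict p@(p₁ _ _) q@(p₃ _)   r@(p₁ _ _) vp vq vr pq pr qr =
        verdict-swap₂₃ p q r (verdict₁₁₃ _ _ _ _ _ vp vr pr)
      verdict p@(p₃ _)   q@(p₁ _ _) r@(p₁ _ _) vp vq vr pq pr qr =
        verdict-swap₁₂ p q r (verdict-swap₂₃ q p r (verdict₁₁₃ _ _ _ _ _ vq vr qr))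
      verdict p@(p₂ _ _) q@(p₂ _ _) r@(p₁ _ _) vp vq vr pq pr qr = verdict₂₂₁ _ _ _ _ _ _ vp vq pq
      verdict p@(p₂ _ _) q@(p₁ _ _) r@(p₂ _ _) vp vq vr pq pr qr =
        verdict-swap₂₃ p q r (verdict₂₂₁ _ _ _ _ _ _ vp vr pr)
      verdict p@(p₁ _ _) q@(p₂ _ _) r@(p₂ _ _) vp vq vr pq pr qr =
        verdict-swap₁₂ p q r (verdict-swap₂₃ q p r (verdict₂₂₁ _ _ _ _ _ _ vq vr qr))
      verdict p@(p₂ _ _) q@(p₂ _ _) r@(p₃ _)   vp vq vr pq pr qr = verdict₂₂₃ _ _ _ _ _ vp vq pq
      verdict p@(p₂ _ _) q@(p₃ _)   r@(p₂ _ _) vp vq vr pq pr qr =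
        verdict-swap₂₃ p q r (verdict₂₂₃ _ _ _ _ _ vp vr pr)
      verdict p@(p₃ _)   q@(p₂ _ _) r@(p₂ _ _) vp vq vr pq pr qr =
        verdict-swap₁₂ p q r (verdict-swap₂₃ q p r (verdict₂₂₃ _ _ _ _ _ vq vr qr))
      verdict p@(p₃ _)   q@(p₃ _)   r@(p₁ _ _) vp vq vr pq pr qr = verdict₃₃₁ _ _ _ _ pq
      verdict p@(p₃ _)   q@(p₁ _ _) r@(p₃ _)   vp vq vr pq pr qr =
        verdict-swap₂₃ p q r (verdict₃₃₁ _ _ _ _ pr)
      verdict p@(p₁ _ _) q@(p₃ _)   r@(p₃ _)   vp vq vr pq pr qr =
        verdict-swap₁₂ p q r (verdict-swap₂₃ q p r (verdict₃₃₁ _ _ _ _ qr))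
      verdict p@(p₃ _)   q@(p₃ _)   r@(p₂ _ _) vp vq vr pq pr qr = verdict₃₃₂ _ _ _ _ pq
      verdict p@(p₃ _)   q@(p₂ _ _) r@(p₃ _)   vp vq vr pq pr qr =
        verdict-swap₂₃ p q r (verdict₃₃₂ _ _ _ _ pr)
      verdict p@(p₂ _ _) q@(p₃ _)   r@(p₃ _)   vp vq vr pq pr qr =
        verdict-swap₁₂ p q r (verdict-swap₂₃ q p r (verdict₃₃₂ _ _ _ _ qr))
      verdict p@(p₁ _ _) q@(p₂ _ _) r@(p₃ _)   vp vq vr pq pr qr = verdict₁₂₃ _ _ _ _ _ vp vq
      verdict p@(p₁ _ _) q@(p₃ _)   r@(p₂ _ _) vp vq vr pq pr qr =
        verdict-swap₂₃ p q r (verdict₁₂₃ _ _ _ _ _ vp vr)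
      verdict p@(p₂ _ _) q@(p₁ _ _) r@(p₃ _)   vp vq vr pq pr qr =
        verdict-swap₁₂ p q r (verdict₁₂₃ _ _ _ _ _ vq vp)
      verdict p@(p₂ _ _) q@(p₃ _)   r@(p₁ _ _) vp vq vr pq pr qr =
        verdict-swap₂₃ p q r (verdict-swap₁₂ p r q (verdict₁₂₃ _ _ _ _ _ vr vp))
      verdict p@(p₃ _)   q@(p₁ _ _) r@(p₂ _ _) vp vq vr pq pr qr =
        verdict-swap₁₂ p q r (verdict-swap₂₃ q p r (verdict₁₂₃ _ _ _ _ _ vq vr))
      verdict p@(p₃ _)   q@(p₂ _ _) r@(p₁ _ _) vp vq vr pq pr qr =
        verdict-swap₁₂ p q r (verdict-swap₂₃ q p r (verdict-swap₁₂ q r p (verdict₁₂₃ _ _ _ _ _ vr vq)))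

      -- A unit vector off the line of `p` and `q`. It makes pairs independent, and for a collinear
      -- triple it supplies the nonzero coefficient of a dependence.
      transversal : ∀ p q → Bounded p → Bounded q → p ≢ q → ∃ λ u → ¬ det (vector p) (vector q) u ≈ 0#
      transversal (p₁ b i) (p₁ d j) vp vq p≢q = ⟨ 0# , 0# , 1# ⟩ , λ z →
        difference-≉0 (differ₁ vp vq p≢q ∘ K.sym) (K.trans (K.sym
          (solve 2 (λ s t → :determinant :1 s :0 :1 t :0 :0 :0 :1 := t :+ :- s) K.refl _ _)) z)
      transversal (p₂ b i) (p₂ d j) vp vq p≢q = ⟨ 0# , 1# , 0# ⟩ , λ z →
        difference-≉0 (differ₂ vp vq p≢q) (K.trans (K.sym
          (solve 4 (λ z w z′ w′ → :determinant z :0 w z′ :0 w′ :0 :1 :0 := w :* z′ :+ :- (w′ :* z)) K.refl _ _ _ _)) z)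
      transversal (p₃ k) (p₃ l) vp vq p≢q = ⟨ 1# , 0# , 0# ⟩ , λ z →
        difference-≉0 (differ₃ p≢q) (K.trans (K.sym
          (solve 2 (λ a b → :determinant :0 :1 (:- a) :0 :1 (:- b) :1 :0 :0 := a :+ :- b) K.refl _ _)) z)
      transversal (p₁ b i) (p₂ d j) vp vq p≢q = ⟨ 1# , 0# , 0# ⟩ , λ z →
        *-≉0 (nz (offset b ℕ.+ i)) (nz (offset d ℕ.+ M)) (K.trans (K.sym
          (solve 3 (λ s z w → :determinant :1 s :0 z :0 w :1 :0 :0 := s :* w) K.refl _ (α ^ j) _)) z)
      transversal (p₂ d j) (p₁ b i) vp vq p≢q = ⟨ 1# , 0# , 0# ⟩ , λ z →
        -‿≉0 (*-≉0 (nz (offset b ℕ.+ i)) (nz (offset d ℕ.+ M))) (K.trans (K.sym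
          (solve 3 (λ s z w → :determinant z :0 w :1 s :0 :1 :0 :0 := :- (s :* w)) K.refl _ (α ^ j) _)) z)
      transversal (p₁ b i) (p₃ k) vp vq p≢q = ⟨ 0# , 0# , 1# ⟩ , λ z →
        0≉1 (K.sym (K.trans (K.sym
          (solve 2 (λ s a → :determinant :1 s :0 :0 :1 (:- a) :0 :0 :1 := :1) K.refl (α ^ (offset b ℕ.+ i)) (α ^ exponent M k))) z))
      transversal (p₃ k) (p₁ b i) vp vq p≢q = ⟨ 0# , 0# , 1# ⟩ , λ z →
        -‿≉0 (0≉1 ∘ K.sym) (K.trans (K.sym
          (solve 2 (λ s a → :determinant :0 :1 (:- a) :1 s :0 :0 :0 :1 := :- :1) K.refl (α ^ (offset b ℕ.+ i)) (α ^ exponent M k))) z)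
      transversal (p₂ b i) (p₃ k) vp vq p≢q = ⟨ 0# , 0# , 1# ⟩ , λ z →
        nz i (K.trans (K.sym
          (solve 3 (λ z w a → :determinant z :0 w :0 :1 (:- a) :0 :0 :1 := z) K.refl _ (α ^ (offset b ℕ.+ M)) (α ^ exponent M k))) z)
      transversal (p₃ k) (p₂ b i) vp vq p≢q = ⟨ 0# , 0# , 1# ⟩ , λ z →
        -‿≉0 (nz i) (K.trans (K.sym
          (solve 3 (λ z w a → :determinant :0 :1 (:- a) z :0 w :0 :0 :1 := :- z) K.refl _ (α ^ (offset b ℕ.+ M)) (α ^ exponent M k))) z)

      -- Reduces the independence of a single vector to that of a pair.
      partner : ∀ p → ∃ λ q → Bounded q × q ≢ p
      partner (p₁ _ _) = p₃ zero , _ , λ ()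
      partner (p₂ _ _) = p₃ zero , _ , λ ()
      partner (p₃ _)   = p₁ false 0 , z≤n , λ ()

      points-independent : ∀ p q → Bounded p → Bounded q → p ≢ q → Independent vector (p ∷ q ∷ [])
      points-independent p q vp vq p≢q with transversal p q vp vq p≢q
      ... | u , ≉0 = independent-pair vector u ≉0

      independent⇒Independent : ∀ l → Unique l → All Bounded l → independent l ≡ true → Independent vector l
      independent⇒Independent [] _ _ _ [] _ = Poly.tt
      independent⇒Independent (p ∷ []) _ (vp ∷ []) _ with partner p
      ... | q , vq , q≢p = independent-tail (points-independent q p vq vp q≢p)
      independent⇒Independent (p ∷ q ∷ []) ((p≢q ∷ []) ∷ _) (vp ∷ vq ∷ []) _ = points-independent p q vp vq p≢q
      independent⇒Independent (p ∷ q ∷ r ∷ []) ((p≢q ∷ p≢r ∷ []) ∷ (q≢r ∷ []) ∷ _) (vp ∷ vq ∷ vr ∷ []) indep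
        with verdict p q r vp vq vr p≢q p≢r q≢r
      ... | inj₁ (col , _) = contradiction col (not-does⁻ (Col? p q r) indep)
      ... | inj₂ (_ , ≉0)  = independent-triple vector ≉0

      Independent⇒independent : ∀ l → Unique l → All Bounded l → Independent vector l → independent l ≡ true
      Independent⇒independent []           _ _ _ = refl
      Independent⇒independent (_ ∷ [])     _ _ _ = refl
      Independent⇒independent (_ ∷ _ ∷ []) _ _ _ = refl
      Independent⇒independent (p ∷ q ∷ r ∷ l) ((p≢q ∷ p≢r ∷ _) ∷ (q≢r ∷ _) ∷ _) (vp ∷ vq ∷ vr ∷ _) indep
        with verdict p q r vp vq vr p≢q p≢r q≢r | transversal p q vp vq p≢q
      ... | inj₁ (_ , z) | u , ≉0 = contradiction indep (dependent-triple vector u ≉0 z)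
      ... | inj₂ (¬col , ≉0) | _ = conclude l indep
        where
        conclude : ∀ l → Independent vector (p ∷ q ∷ r ∷ l) → independent (p ∷ q ∷ r ∷ l) ≡ true
        conclude []      _     = not-does⁺ (Col? p q r) ¬col
        conclude (s ∷ l) indep = contradiction (dependent-quadruple vector indep) ≉0

      bounded : ∀ X → All Bounded (select (points n n) X)
      bounded = select-All (points-All n n (λ _ i≤ → i≤) (λ _ i≤ → i≤) (λ _ i≤ → i≤) (λ _ i≤ → i≤) (λ _ → _))

      representation : Representable K (glued n n)
      representation = 3 , (λ i → vector (lookup (points n n) i)) , λ X →
        (λ indep → independent⇒linIndep vector (points n n) _ (λ _ → refl) X
          (independent⇒Independent _ (select-unique (points-unique n n) X) (bounded X) indep))
        , λ lin → Independent⇒independent _ (select-unique (points-unique n n) X) (bounded X)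
            (linIndep⇒independent vector (points n n) _ (λ _ → refl) X lin)

    representable : Infinite K → ¬ ¬ Representable K (glued n n)
    representable inf = do
      α , α≉0 , distinct ← distinct-powers inf (suc B ℕ.+ B)
      return (representation α≉0 distinct)

open EqualLengths

-- No representation when the right chain is longer.

module UnequalLengths where

  open import Level using (_⊔_)
  open import Data.Nat as ℕ using (ℕ; zero; suc; _≤_; _<_; z≤n; s≤s)
  import Data.Nat.Properties as ℕₚ
  open import Data.Bool using (Bool; true; false; not)
  open import Data.Fin using (Fin; zero; suc)
  open import Data.Integer using () renaming (+_ to pos)
  open import Data.List using ([]; _∷_)
  open import Data.List.Relation.Unary.All using (All; []; _∷_)
  open import Data.List.Relation.Unary.AllPairs using ([]; _∷_)
  open import Data.List.Relation.Unary.Unique.Propositional using (Unique)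
  open import Data.Product using (_×_; ∃₂; _,_; proj₁; proj₂)
  open import Data.Empty using (⊥)
  open import Data.Unit using (tt)
  import Data.Unit.Polymorphic as Poly
  open import Function using (_∘_)
  open import Relation.Nullary using (yes; no; ¬_)
  open import Relation.Nullary.Decidable using (dec-true)
  open import Relation.Binary.PropositionalEquality as ≡ using (_≡_; _≢_; refl; cong)

  module Obstruction {c ℓ} (K : Field c ℓ) (stable : ∀ {x y} → ¬ ¬ Field._≈_ K x y → Field._≈_ K x y)
    (m n : ℕ) (m<n : m < n) {r : ℕ} (V : Point → Fin r → Field.Carrier K)
    (faithful : ∀ l → Unique l → All (Valid m n) l →
      (Configuration.independent m n l ≡ true → LinearAlgebra.Independent K V l) ×
      (Configuration.independent m n l ≡ false → ¬ ¬ LinearAlgebra.Dependent K V l))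
    where

    open Field K hiding (zero; refl; sym; trans; _-_)
    private module K = Field K
    open LinearAlgebra K
    open Determinants K
    open IntegerCoefficients commutativeRing
    open import Algebra.Properties.Semiring.Exp semiring
    open import Relation.Binary.Reasoning.Setoid setoid
    open Configuration m n

    size : Bool → ℕ
    size = length-of m n

    V-independent : ∀ l → Unique l → All (Valid m n) l → independent l ≡ true → Independent V l
    V-independent l u v = proj₁ (faithful l u v)

    V-dependent : ∀ l → Unique l → All (Valid m n) l → independent l ≡ false → ¬ ¬ Dependent V l
    V-dependent l u v = proj₂ (faithful l u v)

    O C₀ C₁ C₂ : Point
    O  = p₁ false 0
    C₀ = p₃ zero
    C₁ = p₃ (suc zero)
    C₂ = p₃ (suc (suc zero))

    triple-independent : ∀ {p q r} → p ≢ q → p ≢ r → q ≢ r → ¬ Long p q r → line p ℕ.+ line q ℕ.+ line r ≢ 7 →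
      Valid m n p → Valid m n q → Valid m n r → Independent V (p ∷ q ∷ r ∷ [])
    triple-independent {p} {q} {r} p≢q p≢r q≢r ¬long ≢7 vp vq vr = V-independent (p ∷ q ∷ r ∷ [])
      ((p≢q ∷ p≢r ∷ []) ∷ (q≢r ∷ []) ∷ [] ∷ []) (vp ∷ vq ∷ vr ∷ [])
      (not-does⁺ (Col? p q r) (not-collinear p≢q q≢r p≢r ¬long ≢7))

    basis : Independent V (O ∷ C₀ ∷ C₁ ∷ [])
    basis = triple-independent (λ ()) (λ ()) (λ ()) (λ ()) (λ ()) z≤n tt tt

    collinear-dependent : ∀ p q r → Valid m n p → Valid m n q → Valid m n r → Col p q r → ¬ ¬ Dependent V (p ∷ q ∷ r ∷ [])
    collinear-dependent p q r vp vq vr col with p ≟ q | p ≟ r | q ≟ r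
    ... | yes refl | _ | _ = return (1# ∷ - 1# ∷ 0# ∷ []
        , (λ j → solve 2 (λ x y → con (pos 1) :* x :+ (:- con (pos 1) :* x :+ (con (pos 0) :* y :+ con (pos 0))) := con (pos 0)) K.refl _ _)
        , λ (z , _) → 0≉1 (K.sym z))
    ... | no _ | yes refl | _ = return (1# ∷ 0# ∷ - 1# ∷ []
        , (λ j → solve 2 (λ x y → con (pos 1) :* x :+ (con (pos 0) :* y :+ (:- con (pos 1) :* x :+ con (pos 0))) := con (pos 0)) K.refl _ _)
        , λ (z , _) → 0≉1 (K.sym z))
    ... | no _ | no _ | yes refl = return (0# ∷ 1# ∷ - 1# ∷ []
        , (λ j → solve 2 (λ x y → con (pos 0) :* y :+ (con (pos 1) :* x :+ (:- con (pos 1) :* x :+ con (pos 0))) := con (pos 0)) K.refl _ _)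
        , λ (_ , z , _) → 0≉1 (K.sym z))
    ... | no p≢q | no p≢r | no q≢r = V-dependent (p ∷ q ∷ r ∷ []) ((p≢q ∷ p≢r ∷ []) ∷ (q≢r ∷ []) ∷ [] ∷ [])
      (vp ∷ vq ∷ vr ∷ []) (cong not (dec-true (Col? p q r) col))

    -- The dimension `r` of a representation is arbitrary, so determinants are taken of coordinates
    -- with respect to `basis`. The line of centres is at infinity, `C₀` and `C₁` are the directions
    -- of the two axes, and chain points become affine, with first coordinate 1.
    point : Vector → Fin r → Carrier
    point w j = w zero * V O j + (w (suc zero) * V C₀ j + w (suc (suc zero)) * V C₁ j)

    point-+* : ∀ α w w′ j → point (λ i → α * w i + w′ i) j ≈ α * point w j + point w′ j
    point-+* α w w′ j = solve 10 (λ α a b c a′ b′ c′ x y z →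
      (α :* a :+ a′) :* x :+ ((α :* b :+ b′) :* y :+ (α :* c :+ c′) :* z) :=
      α :* (a :* x :+ (b :* y :+ c :* z)) :+ (a′ :* x :+ (b′ :* y :+ c′ :* z))) K.refl _ _ _ _ _ _ _ _ _ _

    point-0 : ∀ j → point (λ _ → 0#) j ≈ 0#
    point-0 j = solve 3 (λ x y z → con (pos 0) :* x :+ (con (pos 0) :* y :+ con (pos 0) :* z) := con (pos 0)) K.refl _ _ _

    point-cong : ∀ {w w′} → (∀ i → w i ≈ w′ i) → ∀ j → point w j ≈ point w′ j
    point-cong eq j = +-cong (*-congʳ (eq zero)) (+-cong (*-congʳ (eq (suc zero))) (*-congʳ (eq (suc (suc zero)))))

    point-injective : ∀ w → (∀ j → point w j ≈ 0#) → ∀ i → w i ≈ 0#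
    point-injective w z i with basis (w zero ∷ w (suc zero) ∷ w (suc (suc zero)) ∷ [])
      (λ j → K.trans (+-congˡ (+-congˡ (+-identityʳ _))) (z j))
    point-injective w z zero             | a , _ , _ = a
    point-injective w z (suc zero)       | _ , b , _ = b
    point-injective w z (suc (suc zero)) | _ , _ , d , _ = d

    combine₃ : (α β γ : Carrier) (w w′ w″ : Vector) → Vector
    combine₃ α β γ w w′ w″ i = α * w i + (β * w′ i + (γ * w″ i + 0#))

    point-combine₃ : ∀ α β γ w w′ w″ j →
      point (combine₃ α β γ w w′ w″) j ≈ α * point w j + (β * point w′ j + (γ * point w″ j + 0#))
    point-combine₃ α β γ w w′ w″ j =
      K.trans (point-+* α w (λ i → β * w′ i + (γ * w″ i + 0#)) j) (+-congˡ (K.trans (point-+* β w′ (λ i → γ * w″ i + 0#) j)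
        (+-congˡ (K.trans (point-+* γ w″ (λ _ → 0#) j) (+-congˡ (point-0 j))))))

    -- A representation matters only up to scaling each vector, so coordinates are homogeneous.
    record Coordinates (p : Point) (w : Vector) : Set (c ⊔ ℓ) where
      field
        scale    : Carrier
        scale≉0  : ¬ scale ≈ 0#
        position : ∀ j → V p j ≈ scale * point w j
    open Coordinates

    coordinates-cong : ∀ {p w w′} → (∀ i → w i ≈ w′ i) → Coordinates p w → Coordinates p w′
    coordinates-cong eq P = record
      { scale = scale P ; scale≉0 = scale≉0 P
      ; position = λ j → K.trans (position P j) (*-congˡ (point-cong eq j)) }

    dependent-det : ∀ {p q r w w′ w″} → Coordinates p w → Coordinates q w′ → Coordinates r w″ →
      Dependent V (p ∷ q ∷ r ∷ []) → det w w′ w″ ≈ 0#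
    dependent-det {p} {q} {r} {w} {w′} {w″} P Q R (α ∷ β ∷ γ ∷ [] , van , nontriv) = stable λ nz →
      let a , b , d = zero-coefficients w w′ w″ nz (α * scale P) (β * scale Q) (γ * scale R) coordinatewise
      in nontriv (unscale P a , unscale Q b , unscale R d , Poly.tt)
      where
      unscale : ∀ {p w α} (P : Coordinates p w) → α * scale P ≈ 0# → α ≈ 0#
      unscale P z = *-cancel-0 (scale≉0 P) (K.trans (*-comm _ _) z)
      coordinatewise : ∀ i → combine₃ (α * scale P) (β * scale Q) (γ * scale R) w w′ w″ i ≈ 0#
      coordinatewise = point-injective (combine₃ (α * scale P) (β * scale Q) (γ * scale R) w w′ w″) λ j → begin
        point (combine₃ (α * scale P) (β * scale Q) (γ * scale R) w w′ w″) j
          ≈⟨ point-combine₃ _ _ _ w w′ w″ j ⟩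
        α * scale P * point w j + (β * scale Q * point w′ j + (γ * scale R * point w″ j + 0#))
          ≈⟨ +-cong (*-assoc _ _ _) (+-cong (*-assoc _ _ _) (+-congʳ (*-assoc _ _ _))) ⟩
        α * (scale P * point w j) + (β * (scale Q * point w′ j) + (γ * (scale R * point w″ j) + 0#))
          ≈⟨ +-cong (*-congˡ (K.sym (position P j))) (+-cong (*-congˡ (K.sym (position Q j))) (+-congʳ (*-congˡ (K.sym (position R j))))) ⟩
        α * V p j + (β * V q j + (γ * V r j + 0#))
          ≈⟨ van j ⟩
        0# ∎

    collinear-det : ∀ {p q r w w′ w″} → Valid m n p → Valid m n q → Valid m n r → Col p q r →
      Coordinates p w → Coordinates q w′ → Coordinates r w″ → det w w′ w″ ≈ 0#
    collinear-det {p} {q} {r} vp vq vr col P Q R = stable do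
      dep ← collinear-dependent p q r vp vq vr col
      return (dependent-det P Q R dep)

    independent-coefficient : ∀ {p q r w w′ w″} α β γ → Coordinates p w → Coordinates q w′ → Coordinates r w″ →
      Independent V (p ∷ q ∷ r ∷ []) → (∀ i → combine₃ α β γ w w′ w″ i ≈ 0#) → γ ≈ 0#
    independent-coefficient {p} {q} {r} {w} {w′} {w″} α β γ P Q R indep rel =
      *-cancel-0 (*-≉0 (scale≉0 P) (scale≉0 Q)) (K.trans (*-comm _ _) (proj₁ (proj₂ (proj₂ (indep
        -- Multiplying each coefficient by the scales of the other two points brings out the product
        -- of all three as a common factor, without division.
        (α * (scale Q * scale R) ∷ β * (scale P * scale R) ∷ γ * (scale P * scale Q) ∷ []) λ j → begin
          α * (scale Q * scale R) * V p j + (β * (scale P * scale R) * V q j + (γ * (scale P * scale Q) * V r j + 0#))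
            ≈⟨ +-cong (*-congˡ (position P j)) (+-cong (*-congˡ (position Q j)) (+-congʳ (*-congˡ (position R j)))) ⟩
          α * (scale Q * scale R) * (scale P * point w j) + (β * (scale P * scale R) * (scale Q * point w′ j)
            + (γ * (scale P * scale Q) * (scale R * point w″ j) + 0#))
            ≈⟨ solve 9 (λ α β γ s t u x y z →
                 α :* (t :* u) :* (s :* x) :+ (β :* (s :* u) :* (t :* y) :+ (γ :* (s :* t) :* (u :* z) :+ con (pos 0))) :=
                 s :* t :* u :* (α :* x :+ (β :* y :+ (γ :* z :+ con (pos 0))))) K.refl _ _ _ _ _ _ _ _ _ ⟩
          scale P * scale Q * scale R * (α * point w j + (β * point w′ j + (γ * point w″ j + 0#)))
            ≈⟨ *-congˡ (K.sym (point-combine₃ α β γ w w′ w″ j)) ⟩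
          scale P * scale Q * scale R * point (combine₃ α β γ w w′ w″) j
            ≈⟨ *-congˡ (K.trans (point-cong rel j) (point-0 j)) ⟩
          scale P * scale Q * scale R * 0#
            ≈⟨ zeroʳ _ ⟩
          0# ∎)))))

    coordinates-injective : ∀ {p q w w′} → Valid m n p → Valid m n q → p ≢ q → Coordinates p w → Coordinates q w′ →
      ¬ (∀ i → w i ≈ w′ i)
    coordinates-injective {p} {q} {w} {w′} vp vq p≢q P Q eq = scale≉0 Q (proj₁ (
      V-independent (p ∷ q ∷ []) ((p≢q ∷ []) ∷ [] ∷ []) (vp ∷ vq ∷ []) refl
        (scale Q ∷ - scale P ∷ []) λ j → begin
          scale Q * V p j + (- scale P * V q j + 0#)
            ≈⟨ +-cong (*-congˡ (K.trans (position P j) (*-congˡ (point-cong eq j)))) (+-congʳ (*-congˡ (position Q j))) ⟩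
          scale Q * (scale P * point w′ j) + (- scale P * (scale Q * point w′ j) + 0#)
            ≈⟨ solve 3 (λ s t x → t :* (s :* x) :+ (:- s :* (t :* x) :+ con (pos 0)) := con (pos 0)) K.refl _ _ _ ⟩
          0# ∎))

    unit-coordinates : ∀ {p w} → (∀ j → V p j ≈ point w j) → Coordinates p w
    unit-coordinates eq = record { scale = 1# ; scale≉0 = 0≉1 ∘ K.sym ; position = λ j → K.trans (eq j) (K.sym (*-identityˡ _)) }

    coordinates-O : Coordinates O ⟨ 1# , 0# , 0# ⟩
    coordinates-O = unit-coordinates λ j →
      solve 3 (λ x y z → x := con (pos 1) :* x :+ (con (pos 0) :* y :+ con (pos 0) :* z)) K.refl _ _ _

    coordinates-C₀ : Coordinates C₀ ⟨ 0# , 1# , 0# ⟩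
    coordinates-C₀ = unit-coordinates λ j →
      solve 3 (λ x y z → y := con (pos 0) :* x :+ (con (pos 1) :* y :+ con (pos 0) :* z)) K.refl _ _ _

    coordinates-C₁ : Coordinates C₁ ⟨ 0# , 0# , 1# ⟩
    coordinates-C₁ = unit-coordinates λ j →
      solve 3 (λ x y z → z := con (pos 0) :* x :+ (con (pos 0) :* y :+ con (pos 1) :* z)) K.refl _ _ _

    coordinates-C₂ : ¬ ¬ ∃₂ λ s t → Coordinates C₂ ⟨ 0# , s , t ⟩
    coordinates-C₂ = do
      α ∷ β ∷ γ ∷ [] , van , nontriv ← collinear-dependent C₂ C₀ C₁ tt tt tt (long (refl , refl))
      let α≉0 = λ α≈0 → nontriv (α≈0 , independent-tail {V = V} basis (β ∷ γ ∷ []) λ j → begin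
                  β * V C₀ j + (γ * V C₁ j + 0#)                      ≈⟨ K.sym (+-identityˡ _) ⟩
                  0# + (β * V C₀ j + (γ * V C₁ j + 0#))               ≈⟨ +-congʳ (K.sym (K.trans (*-congʳ α≈0) (zeroˡ _))) ⟩
                  α * V C₂ j + (β * V C₀ j + (γ * V C₁ j + 0#))       ≈⟨ van j ⟩
                  0#                                                  ∎)
          α⁻¹ , αα⁻¹≈1 = inverse α α≉0
      return (- (α⁻¹ * β) , - (α⁻¹ * γ) , unit-coordinates λ j → difference-0 (begin
        V C₂ j + - point ⟨ 0# , - (α⁻¹ * β) , - (α⁻¹ * γ) ⟩ j
          ≈⟨ solve 8 (λ α α⁻¹ β γ p x y z →
               p :+ :- (con (pos 0) :* x :+ (:- (α⁻¹ :* β) :* y :+ :- (α⁻¹ :* γ) :* z)) :=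
               α⁻¹ :* (α :* p :+ (β :* y :+ (γ :* z :+ con (pos 0)))) :+ (con (pos 1) :+ :- (α :* α⁻¹)) :* p) K.refl α α⁻¹ β γ _ _ _ _ ⟩
        α⁻¹ * (α * V C₂ j + (β * V C₀ j + (γ * V C₁ j + 0#))) + (1# + - (α * α⁻¹)) * V C₂ j
          ≈⟨ +-cong (*-congˡ (van j)) (*-congʳ (+-congˡ (-‿cong αα⁻¹≈1))) ⟩
        α⁻¹ * 0# + (1# + - 1#) * V C₂ j
          ≈⟨ solve 2 (λ a p → a :* con (pos 0) :+ (con (pos 1) :+ :- con (pos 1)) :* p := con (pos 0)) K.refl _ _ ⟩
        0# ∎))

    Off-centre : Point → Set
    Off-centre p = line p ≤ 2

    -- Rank 3 makes `p`, `O`, `C₀`, `C₁` dependent. The coefficient of `p` is nonzero because the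
    -- other three are independent, that of `O` because `p` is not on the line of the centres. Both
    -- can then be divided out.
    affine : ∀ p → Off-centre p → Valid m n p → ¬ ¬ ∃₂ λ s t → Coordinates p ⟨ 1# , s , t ⟩
    affine p off vp with p ≟ O
    ... | yes refl = return (0# , 0# , coordinates-O)
    ... | no p≢O   = do
      α ∷ β ∷ γ ∷ δ ∷ [] , van , nontriv ← V-dependent (p ∷ O ∷ C₀ ∷ C₁ ∷ [])
        ((p≢O ∷ off-centre off ∷ off-centre off ∷ []) ∷ ((λ ()) ∷ (λ ()) ∷ []) ∷ ((λ ()) ∷ []) ∷ [] ∷ [])
        (vp ∷ z≤n ∷ tt ∷ tt ∷ []) refl
      let α≉0 = λ α≈0 → nontriv (α≈0 , basis (β ∷ γ ∷ δ ∷ []) λ j → begin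
                  β * V O j + (γ * V C₀ j + (δ * V C₁ j + 0#))                  ≈⟨ K.sym (+-identityˡ _) ⟩
                  0# + (β * V O j + (γ * V C₀ j + (δ * V C₁ j + 0#)))           ≈⟨ +-congʳ (K.sym (K.trans (*-congʳ α≈0) (zeroˡ _))) ⟩
                  α * V p j + (β * V O j + (γ * V C₀ j + (δ * V C₁ j + 0#)))    ≈⟨ van j ⟩
                  0#                                                            ∎)
          β≉0 = λ β≈0 → α≉0 (proj₁ (centre-independent (α ∷ γ ∷ δ ∷ []) λ j → begin
                  α * V p j + (γ * V C₀ j + (δ * V C₁ j + 0#))                  ≈⟨ +-congˡ (K.sym (+-identityˡ _)) ⟩
                  α * V p j + (0# + (γ * V C₀ j + (δ * V C₁ j + 0#)))           ≈⟨ +-congˡ (+-congʳ (K.sym (K.trans (*-congʳ β≈0) (zeroˡ _)))) ⟩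
                  α * V p j + (β * V O j + (γ * V C₀ j + (δ * V C₁ j + 0#)))    ≈⟨ van j ⟩
                  0#                                                            ∎))
          α⁻¹ , αα⁻¹≈1 = inverse α α≉0
          β⁻¹ , ββ⁻¹≈1 = inverse β β≉0
      return (β⁻¹ * γ , β⁻¹ * δ , record
        { scale = - (α⁻¹ * β)
        ; scale≉0 = -‿≉0 (*-≉0 (λ z → 0≉1 (K.trans (K.sym (zeroʳ α)) (K.trans (*-congˡ (K.sym z)) αα⁻¹≈1))) β≉0)
        ; position = λ j → difference-0 (begin
            V p j + - (- (α⁻¹ * β) * point ⟨ 1# , β⁻¹ * γ , β⁻¹ * δ ⟩ j)
              ≈⟨ solve 10 (λ α α⁻¹ β β⁻¹ γ δ p x y z →
                   p :+ :- (:- (α⁻¹ :* β) :* (con (pos 1) :* x :+ (β⁻¹ :* γ :* y :+ β⁻¹ :* δ :* z))) :=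
                   α⁻¹ :* (α :* p :+ (β :* x :+ (γ :* y :+ (δ :* z :+ con (pos 0)))))
                     :+ (con (pos 1) :+ :- (α :* α⁻¹)) :* p
                     :+ (con (pos 1) :+ :- (β :* β⁻¹)) :* (:- (α⁻¹ :* (γ :* y :+ δ :* z)))) K.refl α α⁻¹ β β⁻¹ γ δ _ _ _ _ ⟩
            α⁻¹ * (α * V p j + (β * V O j + (γ * V C₀ j + (δ * V C₁ j + 0#)))) + (1# + - (α * α⁻¹)) * V p j
              + (1# + - (β * β⁻¹)) * (- (α⁻¹ * (γ * V C₀ j + δ * V C₁ j)))
              ≈⟨ +-cong (+-cong (*-congˡ (van j)) (*-congʳ (+-congˡ (-‿cong αα⁻¹≈1)))) (*-congʳ (+-congˡ (-‿cong ββ⁻¹≈1))) ⟩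
            α⁻¹ * 0# + (1# + - 1#) * V p j + (1# + - 1#) * (- (α⁻¹ * (γ * V C₀ j + δ * V C₁ j)))
              ≈⟨ solve 3 (λ a p q → a :* con (pos 0) :+ (con (pos 1) :+ :- con (pos 1)) :* p
                   :+ (con (pos 1) :+ :- con (pos 1)) :* q := con (pos 0)) K.refl _ _ _ ⟩
            0# ∎) })
      where
      off-centre : ∀ {p k} → Off-centre p → p ≢ p₃ k
      off-centre (s≤s (s≤s ())) refl
      not-on-centres : ∀ p → Off-centre p → ¬ Long p C₀ C₁
      not-on-centres (p₃ _) (s≤s (s≤s ())) _
      not-seven : ∀ p → Off-centre p → line p ℕ.+ 4 ℕ.+ 4 ≢ 7
      not-seven (p₁ _ _) _ ()
      not-seven (p₂ _ _) _ ()
      centre-independent : Independent V (p ∷ C₀ ∷ C₁ ∷ [])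
      centre-independent = triple-independent (off-centre off) (off-centre off) (λ ()) (not-on-centres p off) (not-seven p off) vp tt tt

    -- `C₀` is the direction of the second axis, so projecting from it keeps the third coordinate.
    -- In `same-second`, `C₁` has the other axis and its exponent 1 shifts the sum of indices.
    same-third : ∀ b i j {s t s′ t′} → i ≤ size b → j ≤ size b → i ℕ.+ j ≡ size b →
      Coordinates (p₁ b i) ⟨ 1# , s , t ⟩ → Coordinates (p₂ b j) ⟨ 1# , s′ , t′ ⟩ → t ≈ t′
    same-third b i j {s} {t} {s′} {t′} i≤ j≤ i+j P Q = difference-0 (K.trans
      (solve 4 (λ s t s′ t′ → t :+ :- t′ :=
        :determinant (con (pos 1)) s t (con (pos 1)) s′ t′ (con (pos 0)) (con (pos 1)) (con (pos 0))) K.refl s t s′ t′)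
      (collinear-det i≤ j≤ tt (balanced-collinear b i j zero (≡.trans (ℕₚ.+-identityʳ (i ℕ.+ j)) i+j)) P Q coordinates-C₀))

    same-second : ∀ b i j {s t s′ t′} → i ≤ size b → j ≤ size b → suc (i ℕ.+ j) ≡ size b →
      Coordinates (p₁ b i) ⟨ 1# , s , t ⟩ → Coordinates (p₂ b j) ⟨ 1# , s′ , t′ ⟩ → s′ ≈ s
    same-second b i j {s} {t} {s′} {t′} i≤ j≤ i+j P Q = difference-0 (K.trans
      (solve 4 (λ s t s′ t′ → s′ :+ :- s :=
        :determinant (con (pos 1)) s t (con (pos 1)) s′ t′ (con (pos 0)) (con (pos 0)) (con (pos 1))) K.refl s t s′ t′)
      (collinear-det i≤ j≤ tt (balanced-collinear b i j (suc zero) (≡.trans (ℕₚ.+-comm (i ℕ.+ j) 1) i+j)) P Q coordinates-C₁))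

    affine₁ : ∀ b i → i ≤ size b → ¬ ¬ ∃₂ λ s t → Coordinates (p₁ b i) ⟨ 1# , s , t ⟩
    affine₁ b i = affine (p₁ b i) (s≤s z≤n)

    affine₂ : ∀ b i → i ≤ size b → ¬ ¬ ∃₂ λ s t → Coordinates (p₂ b i) ⟨ 1# , s , t ⟩
    affine₂ b i = affine (p₂ b i) (s≤s (s≤s z≤n))

    ⟨⟩-cong : ∀ {a b d b′ d′} → b ≈ b′ → d ≈ d′ → ∀ i → ⟨ a , b , d ⟩ i ≈ ⟨ a , b′ , d′ ⟩ i
    ⟨⟩-cong eq eq′ zero             = K.refl
    ⟨⟩-cong eq eq′ (suc zero)       = eq
    ⟨⟩-cong eq eq′ (suc (suc zero)) = eq′

    -- Projecting `O` to the second line from `C₀` gives `Y₀`, from `C₁` it gives `Y₁`; projecting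
    -- `Y₁` back from `C₀` gives `X₁`. This explains the two zeros and the shared `τ`.
    module Chains {ρ σ τ π θ}
      (Y₀ : Coordinates (p₂ false (2 ℕ.+ m)) ⟨ 1# , ρ , 0# ⟩)
      (Y₁ : Coordinates (p₂ false (1 ℕ.+ m)) ⟨ 1# , 0# , τ ⟩)
      (X₁ : Coordinates (p₁ false 1) ⟨ 1# , σ , τ ⟩)
      (Z  : Coordinates C₂ ⟨ 0# , π , θ ⟩)
      where

      1+m≤ : 1 ℕ.+ m ≤ 2 ℕ.+ m
      1+m≤ = ℕₚ.n≤1+n (1 ℕ.+ m)

      ρ≉0 : ¬ ρ ≈ 0#
      ρ≉0 z = coordinates-injective ℕₚ.≤-refl z≤n (λ ()) Y₀ coordinates-O (⟨⟩-cong z K.refl)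

      τ≉0 : ¬ τ ≈ 0#
      τ≉0 z = coordinates-injective 1+m≤ z≤n (λ ()) Y₁ coordinates-O (⟨⟩-cong K.refl z)

      T : Carrier
      T = τ * π + ρ * θ

      -- Up to sign `T` is the determinant of `Y₀`, `Y₁`, `Z`, and `C₂` is off the second line. The
      -- coefficients θ, -θ, τ combine these vectors to (0, T, 0), so `T ≈ 0#` would force `τ` to
      -- vanish.
      T≉0 : ¬ T ≈ 0#
      T≉0 z = τ≉0 (independent-coefficient θ (- θ) τ Y₀ Y₁ Z
        (triple-independent (λ ()) (λ ()) (λ ()) (λ ()) (λ ()) ℕₚ.≤-refl 1+m≤ tt) relation)
        where
        relation : ∀ i → combine₃ θ (- θ) τ ⟨ 1# , ρ , 0# ⟩ ⟨ 1# , 0# , τ ⟩ ⟨ 0# , π , θ ⟩ i ≈ 0#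
        relation zero = solve 2 (λ θ τ → θ :* con (pos 1) :+ (:- θ :* con (pos 1) :+ (τ :* con (pos 0) :+ con (pos 0))) := con (pos 0)) K.refl θ τ
        relation (suc zero) = K.trans (solve 4 (λ θ τ ρ π →
          θ :* ρ :+ (:- θ :* con (pos 0) :+ (τ :* π :+ con (pos 0))) := τ :* π :+ ρ :* θ) K.refl θ τ ρ π) z
        relation (suc (suc zero)) = solve 2 (λ θ τ →
          θ :* con (pos 0) :+ (:- θ :* τ :+ (τ :* θ :+ con (pos 0))) := con (pos 0)) K.refl θ τ

      first-line : ∀ b i {s t} → i ≤ size b → Coordinates (p₁ b i) ⟨ 1# , s , t ⟩ → σ * t ≈ τ * s
      first-line b i {s} {t} i≤ P = difference-0 (K.trans
        (solve 4 (λ σ τ s t → σ :* t :+ :- (τ :* s) :=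
          :determinant (con (pos 1)) (con (pos 0)) (con (pos 0)) (con (pos 1)) σ τ (con (pos 1)) s t) K.refl σ τ s t)
        (collinear-det z≤n (s≤s z≤n) i≤ (long (refl , refl)) coordinates-O X₁ P))

      second-line : ∀ b i {s t} → i ≤ size b → Coordinates (p₂ b i) ⟨ 1# , s , t ⟩ → τ * s + ρ * t ≈ ρ * τ
      second-line b i {s} {t} i≤ P = K.sym (difference-0 (K.trans
        (solve 4 (λ ρ τ s t → ρ :* τ :+ :- (τ :* s :+ ρ :* t) :=
          :determinant (con (pos 1)) ρ (con (pos 0)) (con (pos 1)) (con (pos 0)) τ (con (pos 1)) s t) K.refl ρ τ s t)
        (collinear-det ℕₚ.≤-refl 1+m≤ i≤ (long (refl , refl)) Y₀ Y₁ P)))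

      ρ⁻¹ κ : Carrier
      ρ⁻¹ = proj₁ (inverse ρ ρ≉0)
      κ   = - (σ * ρ⁻¹)

      ρκ : ρ * κ ≈ - σ
      ρκ = begin
        ρ * - (σ * ρ⁻¹)     ≈⟨ solve 3 (λ ρ σ ρ⁻¹ → ρ :* :- (σ :* ρ⁻¹) := :- (σ :* (ρ :* ρ⁻¹))) K.refl ρ σ ρ⁻¹ ⟩
        - (σ * (ρ * ρ⁻¹))   ≈⟨ -‿cong (K.trans (*-congˡ (proj₂ (inverse ρ ρ≉0))) (*-identityʳ σ)) ⟩
        - σ                 ∎

      -- The way out through `C₁` keeps the second coordinate and the way back through `C₀` keeps
      -- the third. The equations of the two lines then give ρt′ = ρτ - τs = ρτ - σt.
      step : ∀ b i {s t s′ t′} → suc i ≤ size b → Coordinates (p₁ b i) ⟨ 1# , s , t ⟩ →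
        Coordinates (p₁ b (suc i)) ⟨ 1# , s′ , t′ ⟩ → t′ ≈ τ + κ * t
      step b i {s} {t} {s′} {t′} i< P P′ = stable do
        a , d , Q ← affine₂ b j j≤
        let s≈a  = same-second b i j (ℕₚ.<⇒≤ i<) j≤ i+j P Q
            t′≈d = same-third b (suc i) j i< j≤ i+j P′ Q
        return (difference-0 (*-cancel-0 ρ≉0 (begin
          ρ * (t′ + - (τ + κ * t))
            ≈⟨ solve 5 (λ ρ t′ τ κ t → ρ :* (t′ :+ :- (τ :+ κ :* t)) := ρ :* t′ :+ :- (ρ :* τ) :+ :- (ρ :* κ :* t)) K.refl ρ t′ τ κ t ⟩
          ρ * t′ + - (ρ * τ) + - (ρ * κ * t)
            ≈⟨ +-cong (+-cong (*-congˡ t′≈d) (-‿cong (K.sym (second-line b j j≤ Q)))) (-‿cong (*-congʳ ρκ)) ⟩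
          ρ * d + - (τ * a + ρ * d) + - (- σ * t)
            ≈⟨ solve 5 (λ τ a σ t x → x :+ :- (τ :* a :+ x) :+ :- (:- σ :* t) := σ :* t :+ :- (τ :* a)) K.refl τ a σ t (ρ * d) ⟩
          σ * t + - (τ * a)
            ≈⟨ +-cong (first-line b i (ℕₚ.<⇒≤ i<) P) (-‿cong (*-congˡ s≈a)) ⟩
          τ * s + - (τ * s)
            ≈⟨ -‿inverseʳ _ ⟩
          0# ∎)))
        where
        -- The point `p₂ b j` is joined to `p₁ b (suc i)` by `C₀`; as `i + j` is one less than the
        -- length, `C₁` joins it to `p₁ b i`.
        j = size b ℕ.∸ suc i
        j≤ : j ≤ size b
        j≤ = ℕₚ.m∸n≤m (size b) (suc i)
        i+j : suc i ℕ.+ j ≡ size b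
        i+j = ℕₚ.m+[n∸m]≡n i<

      geometric : ℕ → Carrier
      geometric zero    = 0#
      geometric (suc k) = 1# + κ * geometric k

      -- Multiplied out so as to cover `κ` equal to 1, where the steps are translations.
      geometric-sum : ∀ k → 1# + geometric k * (κ + - 1#) ≈ κ ^ k
      geometric-sum zero    = solve 1 (λ κ → con (pos 1) :+ con (pos 0) :* (κ :+ :- con (pos 1)) := con (pos 1)) K.refl κ
      geometric-sum (suc k) = begin
        1# + (1# + κ * geometric k) * (κ + - 1#)
          ≈⟨ solve 2 (λ κ g → con (pos 1) :+ (con (pos 1) :+ κ :* g) :* (κ :+ :- con (pos 1)) :=
               κ :* (con (pos 1) :+ g :* (κ :+ :- con (pos 1)))) K.refl κ (geometric k) ⟩
        κ * (1# + geometric k * (κ + - 1#))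
          ≈⟨ *-congˡ (geometric-sum k) ⟩
        κ * κ ^ k ∎

      iterate : ∀ b k {s₀ t₀ s t} → k ≤ size b → Coordinates (p₁ b 0) ⟨ 1# , s₀ , t₀ ⟩ →
        Coordinates (p₁ b k) ⟨ 1# , s , t ⟩ → t ≈ κ ^ k * t₀ + τ * geometric k
      iterate b zero {t₀ = t₀} {t = t} _ P₀ P = stable do
        -- `P₀` and `P` are possibly different coordinates of one point; they are compared through
        -- its projection from `C₀`.
        _ , d , Q ← affine₂ b (size b) ℕₚ.≤-refl
        return (begin
          t                        ≈⟨ same-third b 0 (size b) z≤n ℕₚ.≤-refl refl P Q ⟩
          d                        ≈⟨ K.sym (same-third b 0 (size b) z≤n ℕₚ.≤-refl refl P₀ Q) ⟩
          t₀                       ≈⟨ solve 2 (λ t τ → t := con (pos 1) :* t :+ τ :* con (pos 0)) K.refl t₀ τ ⟩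
          1# * t₀ + τ * 0#         ∎)
      iterate b (suc k) {t₀ = t₀} {t = t′} k< P₀ P′ = stable do
        s , t , P ← affine₁ b k (ℕₚ.<⇒≤ k<)
        return (begin
          t′                                               ≈⟨ step b k k< P P′ ⟩
          τ + κ * t                                        ≈⟨ +-congˡ (*-congˡ (iterate b k (ℕₚ.<⇒≤ k<) P₀ P)) ⟩
          τ + κ * (κ ^ k * t₀ + τ * geometric k)
            ≈⟨ solve 5 (λ τ κ p t g → τ :+ κ :* (p :* t :+ τ :* g) := κ :* p :* t :+ τ :* (con (pos 1) :+ κ :* g)) K.refl _ _ _ _ _ ⟩
          κ * κ ^ k * t₀ + τ * (1# + κ * geometric k)      ∎)

      -- Collinearity with `C₂` and the equation of the second line determine `d`: it is `t₀` plus
      -- ρθ/T times the displacement of `t₀` under one step. The weight ρθ/T is the same for both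
      -- chains, which is how one chain constrains the other.
      closing : ∀ b {s₀ t₀ a d} → Coordinates (p₁ b 0) ⟨ 1# , s₀ , t₀ ⟩ → Coordinates (p₂ b 0) ⟨ 1# , a , d ⟩ →
        T * d ≈ T * t₀ + ρ * θ * (τ + (κ + - 1#) * t₀)
      closing b {s₀} {t₀} {a} {d} P Q = difference-0 (begin
        T * d + - (T * t₀ + ρ * θ * (τ + (κ + - 1#) * t₀))
          ≈⟨ solve 9 (λ τ π ρ θ κ d t s a →
               (τ :* π :+ ρ :* θ) :* d :+ :- ((τ :* π :+ ρ :* θ) :* t :+ ρ :* θ :* (τ :+ (κ :+ :- con (pos 1)) :* t)) :=
               :- τ :* :determinant (con (pos 1)) s t (con (pos 1)) a d (con (pos 0)) π θ
                 :+ θ :* ((τ :* a :+ ρ :* d) :+ :- (ρ :* τ) :+ :- (ρ :* κ :* t) :+ :- (τ :* s)))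
               K.refl τ π ρ θ κ d t₀ s₀ a ⟩
        - τ * det ⟨ 1# , s₀ , t₀ ⟩ ⟨ 1# , a , d ⟩ ⟨ 0# , π , θ ⟩
          + θ * ((τ * a + ρ * d) + - (ρ * τ) + - (ρ * κ * t₀) + - (τ * s₀))
          ≈⟨ +-cong (*-congˡ (collinear-det z≤n z≤n tt (balanced-collinear b 0 0 (suc (suc zero)) (last-exponent b)) P Q Z))
               (*-congˡ (+-cong (+-cong (+-congʳ (second-line b 0 z≤n Q)) (-‿cong (*-congʳ ρκ))) (-‿cong (K.sym (first-line b 0 z≤n P))))) ⟩
        - τ * 0# + θ * (ρ * τ + - (ρ * τ) + - (- σ * t₀) + - (σ * t₀))
          ≈⟨ solve 5 (λ τ θ x σ t → :- τ :* con (pos 0) :+ θ :* (x :+ :- x :+ :- (:- σ :* t) :+ :- (σ :* t)) := con (pos 0)) K.refl τ θ (ρ * τ) σ t₀ ⟩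
        0# ∎)
        where
        last-exponent : ∀ b → exponent (size b) (suc (suc zero)) ≡ size b
        last-exponent false = refl
        last-exponent true  = refl

      -- The left chain fixes the scalar ρθ in terms of T, so that C₂ acts on line 1 as the (2 + m)-th iterate of the step map;
      -- the right chain says that it acts there as the (2 + n)-th iterate.
      contradictory : ⊥
      contradictory = (do
        _ , dᴸ , Qᴸ ← affine₂ false 0 z≤n
        _ , tᴸ , Pᴸ ← affine₁ false M ℕₚ.≤-refl
        s₀ , t₀ , P₀ ← affine₁ true 0 z≤n
        a , d , Q ← affine₂ true 0 z≤n
        _ , t , P ← affine₁ true M M≤
        -- The projection from `C₀` of the `M`-th point of the right chain. It will share its
        -- coordinates with `p₂ true 0`, although `N ∸ M` is positive.
        a′ , d′ , Q′ ← affine₂ true (N ℕ.∸ M) (ℕₚ.m∸n≤m N M)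
        let TG≈ρθ : T * geometric M ≈ ρ * θ
            TG≈ρθ = difference-0 (*-cancel-0 τ≉0 (begin
              τ * (T * geometric M + - (ρ * θ))
                ≈⟨ solve 5 (λ τ t g ρ θ → τ :* (t :* g :+ :- (ρ :* θ)) := t :* (τ :* g) :+ :- (ρ :* θ :* τ)) K.refl τ T (geometric M) ρ θ ⟩
              T * (τ * geometric M) + - (ρ * θ * τ)
                ≈⟨ +-congʳ (*-congˡ (K.sym (K.trans (iterate false M ℕₚ.≤-refl coordinates-O Pᴸ) (K.trans (+-congʳ (zeroʳ _)) (+-identityˡ _))))) ⟩
              T * tᴸ + - (ρ * θ * τ)
                ≈⟨ +-congʳ (*-congˡ (same-third false M 0 ℕₚ.≤-refl z≤n (ℕₚ.+-identityʳ M) Pᴸ Qᴸ)) ⟩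
              T * dᴸ + - (ρ * θ * τ)
                ≈⟨ +-congʳ (closing false coordinates-O Qᴸ) ⟩
              T * 0# + ρ * θ * (τ + (κ + - 1#) * 0#) + - (ρ * θ * τ)
                ≈⟨ solve 4 (λ t x τ κ → t :* con (pos 0) :+ x :* (τ :+ (κ :+ :- con (pos 1)) :* con (pos 0)) :+ :- (x :* τ) := con (pos 0)) K.refl T (ρ * θ) τ κ ⟩
              0# ∎))
            d≈t : d ≈ t
            d≈t = difference-0 (*-cancel-0 T≉0 (begin
              T * (d + - t)
                ≈⟨ solve 3 (λ x d t → x :* (d :+ :- t) := x :* d :+ :- (x :* t)) K.refl T d t ⟩
              T * d + - (T * t)
                ≈⟨ +-cong (closing true P₀ Q) (-‿cong (*-congˡ (K.trans (iterate true M M≤ P₀ P) (+-congʳ (*-congʳ (K.sym (geometric-sum M))))))) ⟩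
              T * t₀ + ρ * θ * (τ + (κ + - 1#) * t₀) + - (T * ((1# + geometric M * (κ + - 1#)) * t₀ + τ * geometric M))
                ≈⟨ +-congʳ (+-congˡ (*-congʳ (K.sym TG≈ρθ))) ⟩
              T * t₀ + T * geometric M * (τ + (κ + - 1#) * t₀) + - (T * ((1# + geometric M * (κ + - 1#)) * t₀ + τ * geometric M))
                ≈⟨ solve 5 (λ x t g τ κ →
                     x :* t :+ x :* g :* (τ :+ (κ :+ :- con (pos 1)) :* t)
                     :+ :- (x :* ((con (pos 1) :+ g :* (κ :+ :- con (pos 1))) :* t :+ τ :* g)) := con (pos 0)) K.refl T t₀ (geometric M) τ κ ⟩
              0# ∎))
            d≈d′ : d ≈ d′
            d≈d′ = K.trans d≈t (same-third true M (N ℕ.∸ M) M≤ (ℕₚ.m∸n≤m N M) (ℕₚ.m+[n∸m]≡n M≤) P Q′)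
            a≈a′ : a ≈ a′
            a≈a′ = difference-0 (*-cancel-0 τ≉0 (begin
              τ * (a + - a′)
                ≈⟨ solve 5 (λ τ a a′ ρ d → τ :* (a :+ :- a′) := (τ :* a :+ ρ :* d) :+ :- (τ :* a′ :+ ρ :* d)) K.refl τ a a′ ρ d ⟩
              (τ * a + ρ * d) + - (τ * a′ + ρ * d)
                ≈⟨ +-cong (second-line true 0 z≤n Q) (-‿cong (K.trans (+-congˡ (*-congˡ d≈d′)) (second-line true (N ℕ.∸ M) (ℕₚ.m∸n≤m N M) Q′))) ⟩
              ρ * τ + - (ρ * τ)
                ≈⟨ -‿inverseʳ _ ⟩
              0# ∎))
        return (coordinates-injective z≤n (ℕₚ.m∸n≤m N M) 0≢N∸M Q Q′ (⟨⟩-cong a≈a′ d≈d′))) λ x → x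
        where
        M N : ℕ
        M = 2 ℕ.+ m
        N = 2 ℕ.+ n
        M≤ : M ≤ N
        M≤ = s≤s (s≤s (ℕₚ.<⇒≤ m<n))
        0≢N∸M : p₂ true 0 ≢ p₂ true (N ℕ.∸ M)
        0≢N∸M eq = ℕₚ.<⇒≢ (ℕₚ.m<n⇒0<n∸m m<n) (index eq)
          where
          index : ∀ {i j} → p₂ true i ≡ p₂ true j → i ≡ j
          index refl = refl

    unrepresentable : ⊥
    unrepresentable = (do
      ρ , ζ , Y₀ ← affine₂ false (2 ℕ.+ m) ℕₚ.≤-refl
      ζ′ , τ , Y₁ ← affine₂ false (1 ℕ.+ m) (ℕₚ.n≤1+n _)
      σ , τ′ , X₁ ← affine₁ false 1 (s≤s z≤n)
      π , θ , Z ← coordinates-C₂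
      let ζ≈0  = K.sym (same-third false 0 (2 ℕ.+ m) z≤n ℕₚ.≤-refl refl coordinates-O Y₀)
          ζ′≈0 = same-second false 0 (1 ℕ.+ m) z≤n (ℕₚ.n≤1+n _) refl coordinates-O Y₁
          τ′≈τ = same-third false 1 (1 ℕ.+ m) (s≤s z≤n) (ℕₚ.n≤1+n _) refl X₁ Y₁
      return (Chains.contradictory
        (coordinates-cong (⟨⟩-cong K.refl ζ≈0) Y₀) (coordinates-cong (⟨⟩-cong ζ′≈0 K.refl) Y₁)
        (coordinates-cong (⟨⟩-cong K.refl τ′≈τ) X₁) Z)) λ x → x

open UnequalLengths

-- From a representation over `K` to vectors over the stabilised field.

module Unrepresentability where

  open import Data.Nat as ℕ using (ℕ; suc; _≤_; _<_; s≤s)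
  open import Data.Bool using (true; false)
  open import Data.Fin using (Fin; suc; toℕ; _↑ˡ_; _↑ʳ_; fromℕ<)
  open import Data.Fin.Properties using (any?; toℕ-fromℕ<)
  open import Data.List using (List; []; _∷_)
  open import Data.List.Relation.Unary.All as All using (All; []; _∷_)
  open import Data.List.Relation.Unary.Unique.Propositional using (Unique)
  open import Data.List.Relation.Binary.Permutation.Propositional using (↭-sym)
  open import Data.Vec using (lookup)
  open import Data.Vec.Properties using (lookup-++ˡ; lookup-++ʳ; lookup∘tabulate)
  open import Data.Vec.Relation.Unary.Unique.Propositional.Properties using (lookup-injective)
  open import Data.Product using (_×_; ∃; _,_; proj₁; proj₂)
  open import Data.Sum using (inj₁; inj₂)
  open import Function using (_∘_)
  open import Relation.Nullary using (yes; no; ¬_; contradiction)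
  open import Relation.Binary.PropositionalEquality as ≡ using (_≡_; refl; cong; sym; trans)

  module Stabilisation {c ℓ} (K : Field c ℓ) where
    private module K = Field K
    open K using (Carrier; _≈_)

    infix 4 _≋_
    _≋_ : Carrier → Carrier → Set ℓ
    x ≋ y = ¬ ¬ x ≈ y

    lift₁ : ∀ {x y u v} → (x ≈ y → u ≈ v) → x ≋ y → u ≋ v
    lift₁ f x≋y = x≋y >>= λ x≈y → return (f x≈y)

    lift₂ : ∀ {x y u v s t} → (x ≈ y → u ≈ v → s ≈ t) → x ≋ y → u ≋ v → s ≋ t
    lift₂ f x≋y u≋v = x≋y >>= λ x≈y → u≋v >>= λ u≈v → return (f x≈y u≈v)

    -- Equations in the stabilised field can be proved by contradiction.
    stabilised : Field c ℓ
    stabilised = record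
      { commutativeRing = record
        { Carrier = Carrier ; _≈_ = _≋_ ; _+_ = K._+_ ; _*_ = K._*_ ; -_ = K.-_ ; 0# = K.0# ; 1# = K.1#
        ; isCommutativeRing = record
          { isRing = record
            { +-isAbelianGroup = record
              { isGroup = record
                { isMonoid = record
                  { isSemigroup = record
                    { isMagma = record
                      { isEquivalence = record { refl = return K.refl ; sym = lift₁ K.sym ; trans = lift₂ K.trans }
                      ; ∙-cong = lift₂ K.+-cong }
                    ; assoc = λ x y z → return (K.+-assoc x y z) }
                  ; identity = (λ x → return (K.+-identityˡ x)) , λ x → return (K.+-identityʳ x) }
                ; inverse = (λ x → return (K.-‿inverseˡ x)) , λ x → return (K.-‿inverseʳ x)
                ; ⁻¹-cong = lift₁ K.-‿cong }
              ; comm = λ x y → return (K.+-comm x y) }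
            ; *-cong = lift₂ K.*-cong
            ; *-assoc = λ x y z → return (K.*-assoc x y z)
            ; *-identity = (λ x → return (K.*-identityˡ x)) , λ x → return (K.*-identityʳ x)
            ; distrib = (λ x y z → return (K.distribˡ x y z)) , λ x y z → return (K.distribʳ x y z) }
          ; *-comm = λ x y → return (K.*-comm x y) } }
      ; 0≉1 = λ 0≋1 → 0≋1 K.0≉1
      ; inverse = λ x x≉0 → let y , xy≈1 = K.inverse x (x≉0 ∘ return) in y , return xy≈1
      }

    private
      module L  = LinearAlgebra K
      module L′ = LinearAlgebra stabilised

    module _ {A : Set} {r} (V : A → Fin r → Carrier) where

      combination-≡ : ∀ {l : List A} (αs : L.Coefficients l) j → L′.combination V αs j ≡ L.combination V αs j
      combination-≡ []       j = refl
      combination-≡ (α ∷ αs) j = cong (_ K.+_) (combination-≡ αs j)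

      trivial⁺ : ∀ {l : List A} (αs : L.Coefficients l) → ¬ ¬ L.Trivial αs → L′.Trivial αs
      trivial⁺ []       _ = _
      trivial⁺ (α ∷ αs) t = (t >>= λ t → return (proj₁ t)) , trivial⁺ αs (t >>= λ t → return (proj₂ t))

      trivial⁻ : ∀ {l : List A} (αs : L.Coefficients l) → L′.Trivial αs → ¬ ¬ L.Trivial αs
      trivial⁻ []       _ = return _
      trivial⁻ (α ∷ αs) (z , t) = do
        z ← z
        t ← trivial⁻ αs t
        return (z , t)

      independent⁺ : ∀ {l} → L.Independent V l → L′.Independent V l
      independent⁺ indep αs van = trivial⁺ αs (do
        -- There are finitely many coordinates, so the double negations can be collected in front of
        -- the quantifier over `j`.
        van ← ¬¬-∀Fin r λ j → ≡.subst (_≋ K.0#) (combination-≡ αs j) (van j)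
        return (indep αs van))

      dependent⁺ : ∀ {l} → L.Dependent V l → L′.Dependent V l
      dependent⁺ (αs , van , nontriv) =
        αs , (λ j → return (≡.subst (_≈ K.0#) (sym (combination-≡ αs j)) (van j))) , λ t → trivial⁻ αs t nontriv

  module _ (m n : ℕ) where

    private
      l = 2 ℕ.+ m
      r = 2 ℕ.+ n

    chain-position₁ : ∀ b k i → i ≤ k → ∃ λ j → lookup (chain b k) j ≡ p₁ b i
    chain-position₁ b k i i≤k = j ↑ˡ suc k ,
      trans (lookup-++ˡ (firsts b k) (seconds b k) j)
        (trans (lookup∘tabulate (p₁ b ∘ toℕ) j) (cong (p₁ b) (toℕ-fromℕ< (s≤s i≤k))))
      where j = fromℕ< (s≤s i≤k)

    chain-position₂ : ∀ b k i → i ≤ k → ∃ λ j → lookup (chain b k) j ≡ p₂ b i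
    chain-position₂ b k i i≤k = suc k ↑ʳ j ,
      trans (lookup-++ʳ (firsts b k) (seconds b k) j)
        (trans (lookup∘tabulate (p₂ b ∘ toℕ) j) (cong (p₂ b) (toℕ-fromℕ< (s≤s i≤k))))
      where j = fromℕ< (s≤s i≤k)

    left-position : ∀ {p} → (∃ λ j → lookup (chain false l) j ≡ p) → ∃ λ j → lookup (points m n) j ≡ p
    left-position (j , eq) = j ↑ˡ _ , trans (lookup-++ˡ (chain false l) (rest n) j) eq

    right-position : ∀ {p} → (∃ λ j → lookup (chain true r) j ≡ p) → ∃ λ j → lookup (points m n) j ≡ p
    right-position (j , eq) = width m ↑ʳ (3 ↑ʳ j) ,
      trans (lookup-++ʳ (chain false l) (rest n) (3 ↑ʳ j)) (trans (lookup-++ʳ centres (chain true r) j) eq)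

    position : ∀ p → Valid m n p → ∃ λ j → lookup (points m n) j ≡ p
    position (p₁ false i) i≤ = left-position (chain-position₁ false l i i≤)
    position (p₂ false i) i≤ = left-position (chain-position₂ false l i i≤)
    position (p₁ true i)  i≤ = right-position (chain-position₁ true r i i≤)
    position (p₂ true i)  i≤ = right-position (chain-position₂ true r i i≤)
    position (p₃ k)       _  = width m ↑ʳ (k ↑ˡ _) ,
      trans (lookup-++ʳ (chain false l) (rest n) (k ↑ˡ _))
        (trans (lookup-++ˡ centres (chain true r) k) (lookup∘tabulate p₃ k))

  module _ {c ℓ} (K : Field c ℓ) where
    open Stabilisation K
    open Field K using (Carrier; 0#)

    not-representable : ∀ {m n} → m < n → ¬ Representable K (glued m n)
    not-representable {m} {n} m<n (r , v , rep) =
      Obstruction.unrepresentable stabilised (λ ¬¬¬¬eq ¬eq → ¬¬¬¬eq λ ¬¬eq → ¬¬eq ¬eq)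
        m n m<n V faithful
      where
      open Configuration m n using (independent; independent-↭)
      open LinearAlgebra hiding (independent-↭)

      V : Point → Fin r → Carrier
      V p with any? (λ i → lookup (points m n) i ≟ p)
      ... | yes (i , _) = v i
      -- A default for points outside the ground set; `faithful` speaks of valid points only.
      ... | no _        = λ _ → 0#

      V-lookup : ∀ i → v i ≡ V (lookup (points m n) i)
      V-lookup i with any? (λ j → lookup (points m n) j ≟ lookup (points m n) i)
      -- The search may stop at any position of the point, and uniqueness identifies it with `i`.
      ... | yes (j , eq) = cong v (lookup-injective (points-unique m n) i j (sym eq))
      ... | no none      = contradiction (i , refl) none

      faithful : ∀ l → Unique l → All (Valid m n) l →
        (independent l ≡ true → Independent stabilised V l) × (independent l ≡ false → ¬ ¬ Dependent stabilised V l)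
      faithful l u val with toSubset (points m n) l u (All.map (λ {p} → position m n p) val)
      ... | X , X↭l = on-true , on-false
        where
        on-true : independent l ≡ true → Independent stabilised V l
        on-true eq = independent⁺ V (LinearAlgebra.independent-↭ K (↭-sym X↭l)
          (linIndep⇒independent K V (points m n) v V-lookup X (proj₁ (rep X) (trans (independent-↭ X↭l) eq))))
        on-false : independent l ≡ false → ¬ ¬ Dependent stabilised V l
        on-false eq = do
          -- Dependence in the matroid only refutes linear independence; elimination turns this into
          -- the coefficients of an actual relation.
          inj₂ dep ← dichotomy K V l
            where inj₁ indep → contradiction
                    (trans (sym eq) (trans (sym (independent-↭ X↭l)) (proj₂ (rep X)
                      (independent⇒linIndep K V (points m n) v V-lookup X (LinearAlgebra.independent-↭ K X↭l indep))))) λ ()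
          return (dependent⁺ V dep)

open Unrepresentability

-- Pigeonhole on the colours.

open import Data.Fin.Properties using (pigeonhole)
open import Data.Fin using (toℕ)
open import Data.Nat.Properties using (n<1+n)
open import Data.Product using (_,_)
import Data.Fin.Subset as Subset
open import Function.Bundles using (Equivalence)
open import Relation.Binary.PropositionalEquality using (sym)

theorem1p2 : ∀ {c ℓ} (K : Field c ℓ) → Infinite K →
    ¬ (Σ Formula λ ψ → Sentence ψ ×
    (∀ (n : ℕ) (M : Matroid n) → Representable K M ⇔ Satisfies M ψ))
theorem1p2 K inf (ψ , _ , defines) with pigeonhole (n<1+n (colours ψ)) (λ i → colour (toℕ i) (λ _ → Subset.⊥) ψ)
... | i , j , i<j , same =
  -- Representability of two chains of length parameter `j` is known only under a double negation,
  -- which suffices for an absurdity. The left chain is then shortened to the equally coloured `i`,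
  -- with the truth of `ψ` preserved.
  Representation.representable K (toℕ j) inf λ rep →
    not-representable K i<j
      (Equivalence.from (defines _ (glued (toℕ i) (toℕ j)))
        (satisfies-transfer ψ (sym same) (Equivalence.to (defines _ (glued (toℕ j) (toℕ j))) rep)))
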